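{- Let $x_1,x_2,y_1,y_2,u_1,u_2,v_1,v_2,w_{\rm e},w_{\rm o},z_{\rm e},z_{\rm o},\lambda$ be commuting indeterminates and for $n\ge0$ define \[ \widehat{P}_n=\sum_{\sigma\in\mathfrak{D}_{2n}}x_1^{\mathrm{eareccpeak}}x_2^{\mathrm{eareccdfall}}y_1^{\mathrm{ereccval}}y_2^{\mathrm{ereccdrise}}u_1^{\mathrm{nrcpeak}}u_2^{\mathrm{nrcdfall}}v_1^{\mathrm{nrcval}}v_2^{\mathrm{nrcdrise}}W(\sigma), \] \[ \widehat{P}'_n=\sum_{\sigma\in\mathfrak{D}_{2n}}x_1^{\mathrm{ereccpeak}'}x_2^{\mathrm{eareccdfall}'}y_1^{\mathrm{eareccval}'}y_2^{\mathrm{ereccdrise}'}u_1^{\mathrm{nrcpeak}'}u_2^{\mathrm{nrcdfall}'}v_1^{\mathrm{nrcval}'}v_2^{\mathrm{nrcdrise}'}W(\sigma), \] where $W(\sigma)=w_{\rm e}^{\mathrm{evennrfix}}w_{\rm o}^{\mathrm{oddnrfix}}z_{\rm e}^{\mathrm{evenrar}}z_{\rm o}^{\mathrm{oddrar}}\lambda^{\mathrm{cyc}}$ and all statistics are evaluated at $\sigma$. Then, with $v_1$ specialised to $y_1$, \[ \sum_{n\ge0}\widehat{P}'_n\,t^n=\cfrac{1}{1-\delta_1t-\cfrac{\alpha_1t}{1-\delta_2t-\cfrac{\alpha_2t}{1-\cdots}}} \] with, for $k\ge1$, $\alpha_{2k-1}=(\lambda+k-1)[x_1+(k-1)u_1]y_1$,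 $\alpha_{2k}=[x_2+(k-1)u_2+\lambda w_{\rm e}][y_2+(k-1)v_2+\lambda w_{\rm o}]$, $\delta_1=\lambda^2z_{\rm e}z_{\rm o}$, $\delta_n=0$ for $n\ge2$ (this is the same continued fraction as for $\widehat{P}_n$ with $v_1=y_1$); consequently $\widehat{P}'_n=\widehat{P}_n$ for all $n$ when both are specialised to $v_1=y_1$.
   Context: A D-permutation of $[2n]$ is a permutation with $\sigma(2k-1)\ge2k-1$, $\sigma(2k)\le2k$ for all $k$; $\mathfrak{D}_{2n}$ is their set. Index $i$: cycle peak if $\sigma^{ -1}(i)<i>\sigma(i)$, cycle valley if $\sigma^{ -1}(i)>i<\sigma(i)$, cycle double rise if $\sigma^{ -1}(i)<i<\sigma(i)$, cycle double fall if $\sigma^{ -1}(i)>i>\sigma(i)$, fixed point if $\sigma(i)=i$. Index $i$ is a record if $\sigma(j)<\sigma(i)$ for all $j<i$, antirecord if $\sigma(j)>\sigma(i)$ for all $j>i$; exclusive record = record not antirecord; exclusive antirecord = antirecord not record; record-antirecord = both. Unprimed statistics: $\mathrm{eareccpeak},\mathrm{eareccdfall}$ count cycle peaks, double falls $i$ that are exclusive antirecords; $\mathrm{ereccval},\mathrm{ereccdrise}$ count cycle valleys, double rises $i$ that are exclusive records; $\mathrm{nrcpeak},\mathrm{nrcdfall},\mathrm{nrcval},\mathrm{nrcdrise}$ count cycle peaks, double falls, valleys, double rises $i$ that are neither records nor antirecords. Primed (value-based) statistics: the same cycle type of $i$ is used but the record condition is applied to $\sigma^{ -1}(i)$: $\mathrm{ereccpeak}'$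 counts cycle peaks $i$ with $\sigma^{ -1}(i)$ an exclusive record; $\mathrm{eareccdfall}'$ counts cycle double falls $i$ with $\sigma^{ -1}(i)$ an exclusive antirecord; $\mathrm{eareccval}'$ counts cycle valleys $i$ with $\sigma^{ -1}(i)$ an exclusive antirecord; $\mathrm{ereccdrise}'$ counts cycle double rises $i$ with $\sigma^{ -1}(i)$ an exclusive record; $\mathrm{nrcpeak}',\mathrm{nrcdfall}',\mathrm{nrcval}',\mathrm{nrcdrise}'$ count cycle peaks, double falls, valleys, double rises $i$ with $\sigma^{ -1}(i)$ neither a record nor an antirecord. $\mathrm{evennrfix}$ ($\mathrm{oddnrfix}$) counts even (odd) fixed points that are neither records nor antirecords; $\mathrm{evenrar}$ ($\mathrm{oddrar}$) counts even (odd) record-antirecords; $\mathrm{cyc}$ = number of cycles. -}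

module Defs where

open import Level using (Level)
open import Data.Bool using (Bool; true; false; _∧_; _∨_; not; if_then_else_)
open import Data.Nat using (ℕ; zero; suc; _∸_; _<ᵇ_; _≤ᵇ_; _≡ᵇ_; ⌊_/2⌋)
open import Data.Fin using (Fin; toℕ)
open import Data.List using (List; []; _∷_; map; concatMap; allFin; foldr; upTo)
open import Data.Product using (_×_)
open import Algebra.Bundles using (CommutativeSemiring)

-- Combinatorics of D-permutations (pure, Bool-valued, decidable)
-- Conventions: [2n] = {1,…,2n} is represented by Fin (2n) with
-- 0-based index i standing for the integer i+1.  A candidate
-- permutation is a function σ : Fin m → Fin m.

evenᵇ : ℕ → Bool
evenᵇ zero = true
evenᵇ (suc n) = not (evenᵇ n)

all : ∀ {a} {A : Set a} → (A → Bool) → List A → Bool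
all p [] = true
all p (x ∷ xs) = p x ∧ all p xs

count : ∀ {a} {A : Set a} → (A → Bool) → List A → ℕ
count p [] = 0
count p (x ∷ xs) = if p x then suc (count p xs) else count p xs

funs : (m k : ℕ) → List (Fin k → Fin m)
funs m zero = (λ ()) ∷ []
funs m (suc k) = concatMap (λ a → map (λ f → λ { Fin.zero → a ; (Fin.suc i) → f i }) (funs m k)) (allFin m)

module _ {m : ℕ} (σ : Fin m → Fin m) where

  private
    s : Fin m → ℕ
    s i = toℕ (σ i)
    fins = allFin m

  isPermᵇ : Bool
  isPermᵇ = all (λ i → all (λ j → not (s i ≡ᵇ s j) ∨ (toℕ i ≡ᵇ toℕ j)) fins) fins

  -- D-condition: σ(2k-1) ≥ 2k-1 and σ(2k) ≤ 2k (1-based);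
  -- 1-based odd positions are 0-based even indices.
  isDᵇ : Bool
  isDᵇ = all (λ i → if evenᵇ (toℕ i) then toℕ i ≤ᵇ s i else s i ≤ᵇ toℕ i) fins

  inv : Fin m → Fin m
  inv i = foldr (λ j r → if s j ≡ᵇ toℕ i then j else r) i fins

  recᵇ : Fin m → Bool
  recᵇ i = all (λ j → not (toℕ j <ᵇ toℕ i) ∨ (s j <ᵇ s i)) fins

  arecᵇ : Fin m → Bool
  arecᵇ i = all (λ j → not (toℕ i <ᵇ toℕ j) ∨ (s i <ᵇ s j)) fins

  erecᵇ earecᵇ rarᵇ nrᵇ : Fin m → Bool
  erecᵇ i = recᵇ i ∧ not (arecᵇ i)
  earecᵇ i = arecᵇ i ∧ not (recᵇ i)
  rarᵇ i = recᵇ i ∧ arecᵇ i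
  nrᵇ i = not (recᵇ i) ∧ not (arecᵇ i)

  cpeakᵇ cvalᵇ cdriseᵇ cdfallᵇ fixᵇ : Fin m → Bool
  cpeakᵇ i = (toℕ (inv i) <ᵇ toℕ i) ∧ (s i <ᵇ toℕ i)
  cvalᵇ i = (toℕ i <ᵇ toℕ (inv i)) ∧ (toℕ i <ᵇ s i)
  cdriseᵇ i = (toℕ (inv i) <ᵇ toℕ i) ∧ (toℕ i <ᵇ s i)
  cdfallᵇ i = (toℕ i <ᵇ toℕ (inv i)) ∧ (s i <ᵇ toℕ i)
  fixᵇ i = s i ≡ᵇ toℕ i

  -- 1-based parity: 1-based even ⇔ 0-based odd
  evenPosᵇ : Fin m → Bool
  evenPosᵇ i = not (evenᵇ (toℕ i))

  stat : (Fin m → Bool) → ℕ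
  stat p = count p fins

  eareccpeak eareccdfall ereccval ereccdrise : ℕ
  eareccpeak = stat (λ i → cpeakᵇ i ∧ earecᵇ i)
  eareccdfall = stat (λ i → cdfallᵇ i ∧ earecᵇ i)
  ereccval = stat (λ i → cvalᵇ i ∧ erecᵇ i)
  ereccdrise = stat (λ i → cdriseᵇ i ∧ erecᵇ i)

  nrcpeak nrcdfall nrcval nrcdrise : ℕ
  nrcpeak = stat (λ i → cpeakᵇ i ∧ nrᵇ i)
  nrcdfall = stat (λ i → cdfallᵇ i ∧ nrᵇ i)
  nrcval = stat (λ i → cvalᵇ i ∧ nrᵇ i)
  nrcdrise = stat (λ i → cdriseᵇ i ∧ nrᵇ i)

  -- primed (value-based) statistics: record condition applied to σ⁻¹(i)
  ereccpeak′ eareccdfall′ eareccval′ ereccdrise′ : ℕ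
  ereccpeak′ = stat (λ i → cpeakᵇ i ∧ erecᵇ (inv i))
  eareccdfall′ = stat (λ i → cdfallᵇ i ∧ earecᵇ (inv i))
  eareccval′ = stat (λ i → cvalᵇ i ∧ earecᵇ (inv i))
  ereccdrise′ = stat (λ i → cdriseᵇ i ∧ erecᵇ (inv i))

  nrcpeak′ nrcdfall′ nrcval′ nrcdrise′ : ℕ
  nrcpeak′ = stat (λ i → cpeakᵇ i ∧ nrᵇ (inv i))
  nrcdfall′ = stat (λ i → cdfallᵇ i ∧ nrᵇ (inv i))
  nrcval′ = stat (λ i → cvalᵇ i ∧ nrᵇ (inv i))
  nrcdrise′ = stat (λ i → cdriseᵇ i ∧ nrᵇ (inv i))

  evennrfix oddnrfix evenrar oddrar : ℕ
  evennrfix = stat (λ i → fixᵇ i ∧ nrᵇ i ∧ evenPosᵇ i)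
  oddnrfix = stat (λ i → fixᵇ i ∧ nrᵇ i ∧ not (evenPosᵇ i))
  evenrar = stat (λ i → rarᵇ i ∧ evenPosᵇ i)
  oddrar = stat (λ i → rarᵇ i ∧ not (evenPosᵇ i))

  iter : ℕ → Fin m → Fin m
  iter zero i = i
  iter (suc k) i = σ (iter k i)

  -- number of cycles = number of indices i that are the minimum of
  -- their cycle, i.e. σ^k(i) ≥ i for all k = 1,…,m
  cyc : ℕ
  cyc = stat (λ i → all (λ k → toℕ i ≤ᵇ toℕ (iter (suc k) i)) (upTo m))

-- the set 𝔇_{2n} of D-permutations of [2n], as an (exhaustive,
-- duplicate-free) list
Dperms : (n : ℕ) → List (Fin (n Data.Nat.+ n) → Fin (n Data.Nat.+ n))
Dperms n = Data.List.filterᵇ (λ σ → isPermᵇ σ ∧ isDᵇ σ) (funs (n Data.Nat.+ n) (n Data.Nat.+ n))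

-- Algebra: the generating polynomials and the continued fraction,
-- over an arbitrary commutative semiring (the indeterminates being
-- arbitrary elements; the free case is ℕ[x₁,…,λ]).

record Vars {c ℓ : Level} (R : CommutativeSemiring c ℓ) : Set c where
  open CommutativeSemiring R
  field
    x₁ x₂ y₁ y₂ u₁ u₂ v₁ v₂ wₑ wₒ zₑ zₒ λ′ : Carrier

specV₁ : ∀ {c ℓ} {R : CommutativeSemiring c ℓ} → Vars R → Vars R
specV₁ a = record a { v₁ = Vars.y₁ a }

module _ {c ℓ : Level} (R : CommutativeSemiring c ℓ) where
  open CommutativeSemiring R

  pow : Carrier → ℕ → Carrier
  pow x zero = 1#
  pow x (suc n) = x * pow x n

  nat : ℕ → Carrier
  nat zero = 0#
  nat (suc n) = 1# + nat n

  sumL : List Carrier → Carrier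
  sumL = foldr _+_ 0#

  module _ (a : Vars R) where
    open Vars a

    W : ∀ {m} → (Fin m → Fin m) → Carrier
    W σ = pow wₑ (evennrfix σ) * pow wₒ (oddnrfix σ) * pow zₑ (evenrar σ)
          * pow zₒ (oddrar σ) * pow λ′ (cyc σ)

    weight : ∀ {m} → (Fin m → Fin m) → Carrier
    weight σ = pow x₁ (eareccpeak σ) * pow x₂ (eareccdfall σ)
               * pow y₁ (ereccval σ) * pow y₂ (ereccdrise σ)
               * pow u₁ (nrcpeak σ) * pow u₂ (nrcdfall σ)
               * pow v₁ (nrcval σ) * pow v₂ (nrcdrise σ) * W σ

    weight′ : ∀ {m} → (Fin m → Fin m) → Carrier
    weight′ σ = pow x₁ (ereccpeak′ σ) * pow x₂ (eareccdfall′ σ)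
                * pow y₁ (eareccval′ σ) * pow y₂ (ereccdrise′ σ)
                * pow u₁ (nrcpeak′ σ) * pow u₂ (nrcdfall′ σ)
                * pow v₁ (nrcval′ σ) * pow v₂ (nrcdrise′ σ) * W σ

    P̂ : ℕ → Carrier
    P̂ n = sumL (map weight (Dperms n))

    P̂′ : ℕ → Carrier
    P̂′ n = sumL (map weight′ (Dperms n))

    -- continued-fraction coefficients (indexed from 1; index 0 unused)
    α : ℕ → Carrier
    α zero = 0#
    α (suc n) = if evenᵇ n
      then (λ′ + nat k) * (x₁ + nat k * u₁) * y₁                 -- α_{2k+1}
      else (x₂ + nat k * u₂ + λ′ * wₑ) * (y₂ + nat k * v₂ + λ′ * wₒ)  -- α_{2k+2}
      where k = ⌊ n /2⌋

    δ : ℕ → Carrier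
    δ (suc zero) = λ′ * λ′ * zₑ * zₒ
    δ _ = 0#

  Series : Set c
  Series = ℕ → Carrier

  sumTo : ℕ → (ℕ → Carrier) → Carrier
  sumTo n f = sumL (map f (upTo (suc n)))

  _⊛_ : Series → Series → Series
  (f ⊛ g) n = sumTo n (λ i → f i * g (n ∸ i))

  oneS : Series
  oneS zero = 1#
  oneS (suc _) = 0#

  spow : Series → ℕ → Series
  spow h zero = oneS
  spow h (suc j) = h ⊛ spow h j

  -- 1 / (1 - t·h) = Σ_j t^j h^j
  geom : Series → Series
  geom h n = sumTo n (λ j → spow h j (n ∸ j))

  -- truncated continued fraction at depth d, starting at level k:
  --   F_k = 1 / (1 - δ_k t - α_k t F_{k+1}),  with F at depth 0 equal to 1
  cfTrunc : (ℕ → Carrier) → (ℕ → Carrier) → ℕ → ℕ → Series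
  cfTrunc α δ zero k = oneS
  cfTrunc α δ (suc d) k =
    geom (λ n → δ k * oneS n + α k * cfTrunc α δ d (suc k) n)

  -- coefficient of tⁿ of the infinite continued fraction
  -- 1/(1 - δ₁t - α₁t/(1 - δ₂t - α₂t/(1 - ⋯))): it agrees with that of
  -- every truncation of depth ≥ n+1; we use depth n+1.
  cfCoeff : (ℕ → Carrier) → (ℕ → Carrier) → ℕ → Carrier
  cfCoeff α δ n = cfTrunc α δ (suc n) 1 n

{-# OPTIONS --safe #-}
module Submission where

-- A permutation is peeled from the left: its restriction to the positions i, …, m - 1 is a partial
-- permutation that covers some set P of k values below i and misses equally many values from i on. Given
-- the restriction to the positions after i, the value at i is one of k + 1 missing values (valley), one of k
-- missing values (double rise), one of k values of P (double fall), one of the values of P (peak), or i. The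
-- chosen value is a record or an antirecord exactly if it is extremal among the candidates, and for a valley
-- exactly one candidate closes a cycle, whose least element is then i. So the weighted sum over the
-- restrictions depends on P only through k and is a sum over Motzkin paths, and the D-condition merely kills
-- some of the steps. The primed statistics of σ are the unprimed ones of σ⁻¹ with double rises and double
-- falls exchanged; this exchange does not change the sum of the two level weights, which is all that the
-- Motzkin paths see. Contracting the steps two by two gives the continued fraction.

open import Defs
open import Level using (Level)
open import Algebra.Bundles using (CommutativeSemiring)
open import Data.Bool using (Bool; true; false; not; if_then_else_; _∧_; _∨_)
import Data.Bool.Properties as 𝔹ₚ
open import Data.Empty using (⊥; ⊥-elim)
open import Data.Fin as Fin using (Fin; toℕ; fromℕ<; inject≤)
import Data.Fin.Properties as Finₚ
open import Data.List using (List; []; _∷_; length; map; foldr; concatMap; allFin; upTo; applyUpTo; tabulate; filterᵇ; _++_)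
open import Data.List.Membership.Propositional using (_∈_)
open import Data.List.Membership.Propositional.Properties using (∈-allFin; ∈-upTo⁺)
import Data.List.Properties as Listₚ
open import Data.List.Relation.Unary.All as All using (All; []; _∷_)
open import Data.List.Relation.Unary.Any using (here; there)
open import Data.Nat as ℕ using (ℕ; zero; suc; _∸_; _≤_; _<_; z≤n; s≤s; pred; _≡ᵇ_; _<ᵇ_; _≤ᵇ_; ⌊_/2⌋)
import Data.Nat.Properties as ℕₚ
open import Data.Product using (_×_; _,_; ∃; proj₁; proj₂)
open import Data.Sum using (_⊎_; inj₁; inj₂)
open import Function using (_∘_; id)
open import Function.Bundles using (Equivalence)
open import Relation.Binary.Definitions using (Tri; tri<; tri≈; tri>)
open import Relation.Binary.PropositionalEquality as ≡ using (_≡_; _≢_)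
open import Relation.Nullary using (yes; no; ¬_; does; _→-dec_)
open import Relation.Nullary.Decidable using (dec-true)

-- Counting and finite sums

-- The obstacle that the specialisation `v₁ = y₁` removes lies in the valleys. Of the k + 1
-- candidates for a valley one closes a cycle and one is a record, and whether these two coincide
-- depends on the whole restriction, not on k alone. Once records and non-records weigh the same,
-- only the closing candidate is distinguished. The other moving types do not meet this conflict,
-- because a cycle is counted at its least element, which is a valley or a fixed point.
--
-- Inversion does not preserve the D-condition, so the inverse of σ is sought among all
-- permutations. But the condition only restricts the cycle type at each index: an odd integer is a
-- valley, a double rise or a fixed point of σ, an even one a peak, a double fall or a fixed point.
-- Read on σ⁻¹ this is again a restriction of the type at each index, with rises and falls
-- exchanged. The factor `W` survives inversion, since record-antirecords are fixed points, a fixed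
-- point is a record exactly if it is an antirecord, and cycles keep their least elements.

bool-ext : ∀ {b c} → (b ≡ true → c ≡ true) → (c ≡ true → b ≡ true) → b ≡ c
bool-ext {false} {false} f g = ≡.refl
bool-ext {false} {true} f g = g ≡.refl
bool-ext {true} f g = ≡.sym (f ≡.refl)

≢true⇒false : ∀ {b} → ¬ (b ≡ true) → b ≡ false
≢true⇒false {false} _ = ≡.refl
≢true⇒false {true} f = ⊥-elim (f ≡.refl)

false≢true : ∀ {b} → b ≡ false → ¬ (b ≡ true)
false≢true ≡.refl ()

∧-split : ∀ {b c} → b ∧ c ≡ true → b ≡ true × c ≡ true
∧-split {true} e = ≡.refl , e

∧-join : ∀ {b c} → b ≡ true → c ≡ true → b ∧ c ≡ true
∧-join ≡.refl e = e

≡ᵇ-true : ∀ {a b} → (a ≡ᵇ b) ≡ true → a ≡ b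
≡ᵇ-true {a} {b} e = ℕₚ.≡ᵇ⇒≡ a b (Equivalence.from 𝔹ₚ.T-≡ e)

≡ᵇ-refl : ∀ a → (a ≡ᵇ a) ≡ true
≡ᵇ-refl a = Equivalence.to 𝔹ₚ.T-≡ (ℕₚ.≡⇒≡ᵇ a a ≡.refl)

≡ᵇ-false : ∀ {a b} → a ≢ b → (a ≡ᵇ b) ≡ false
≡ᵇ-false ne = ≢true⇒false (ne ∘ ≡ᵇ-true)

<ᵇ-true : ∀ {a b} → (a <ᵇ b) ≡ true → a < b
<ᵇ-true {a} {b} e = ℕₚ.<ᵇ⇒< a b (Equivalence.from 𝔹ₚ.T-≡ e)

true-<ᵇ : ∀ {a b} → a < b → (a <ᵇ b) ≡ true
true-<ᵇ lt = Equivalence.to 𝔹ₚ.T-≡ (ℕₚ.<⇒<ᵇ lt)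

false-<ᵇ : ∀ {a b} → ¬ (a < b) → (a <ᵇ b) ≡ false
false-<ᵇ nlt = ≢true⇒false (nlt ∘ <ᵇ-true)

≤ᵇ-true : ∀ {a b} → (a ≤ᵇ b) ≡ true → a ≤ b
≤ᵇ-true {a} {b} e = ℕₚ.≤ᵇ⇒≤ a b (Equivalence.from 𝔹ₚ.T-≡ e)

true-≤ᵇ : ∀ {a b} → a ≤ b → (a ≤ᵇ b) ≡ true
true-≤ᵇ le = Equivalence.to 𝔹ₚ.T-≡ (ℕₚ.≤⇒≤ᵇ le)

if-true : ∀ {a} {A : Set a} {b} {x y : A} → b ≡ true → (if b then x else y) ≡ x
if-true ≡.refl = ≡.refl

if-false : ∀ {a} {A : Set a} {b} {x y : A} → b ≡ false → (if b then x else y) ≡ y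
if-false ≡.refl = ≡.refl

upd : (ℕ → Bool) → ℕ → Bool → ℕ → Bool
upd Q a b v = if v ≡ᵇ a then b else Q v

upd-eq : ∀ Q a b → upd Q a b a ≡ b
upd-eq Q a b rewrite ≡ᵇ-refl a = ≡.refl

upd-neq : ∀ Q a b {v} → v ≢ a → upd Q a b v ≡ Q v
upd-neq Q a b ne rewrite ≡ᵇ-false ne = ≡.refl

card : ℕ → (ℕ → Bool) → ℕ
card zero Q = 0
card (suc n) Q = if Q 0 then suc (card n (Q ∘ suc)) else card n (Q ∘ suc)

card-cong : ∀ n {Q Q′} → (∀ v → v < n → Q v ≡ Q′ v) → card n Q ≡ card n Q′
card-cong zero e = ≡.refl
card-cong (suc n) {Q} {Q′} e rewrite e 0 (s≤s z≤n) | card-cong n {Q ∘ suc} {Q′ ∘ suc} (λ v lt → e (suc v) (s≤s lt)) = ≡.refl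

card-zero : ∀ n {Q} → card n Q ≡ 0 → ∀ v → v < n → Q v ≡ false
card-zero (suc n) {Q} e v lt with Q 0 in eq
card-zero (suc n) () v lt | true
card-zero (suc n) e zero lt | false = eq
card-zero (suc n) e (suc v) (s≤s lt) | false = card-zero n e v lt

card-false : ∀ n {Q} → (∀ v → v < n → Q v ≡ false) → card n Q ≡ 0
card-false zero e = ≡.refl
card-false (suc n) e rewrite e 0 (s≤s z≤n) = card-false n (λ v lt → e (suc v) (s≤s lt))

card-insert : ∀ n Q a → a < n → Q a ≡ false → card n (upd Q a true) ≡ suc (card n Q)
card-insert (suc n) Q zero lt e rewrite e = ≡.refl
card-insert (suc n) Q (suc a) (s≤s lt) e with Q 0
... | true = ≡.cong suc (card-insert n (Q ∘ suc) a lt e)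
... | false = card-insert n (Q ∘ suc) a lt e

card-remove : ∀ n Q a → a < n → Q a ≡ true → card n Q ≡ suc (card n (upd Q a false))
card-remove n Q a lt e = ≡.trans (card-cong n same) (card-insert n (upd Q a false) a lt (upd-eq Q a false))
  where
  same : ∀ v → v < n → Q v ≡ upd (upd Q a false) a true v
  same v _ with v ≡ᵇ a in eq
  ... | true = ≡.trans (≡.cong Q (≡ᵇ-true eq)) e
  ... | false = ≡.refl

card-pos : ∀ n {Q} {k} → card n Q ≡ suc k → ∃ λ v → v < n × Q v ≡ true
card-pos (suc n) {Q} e with Q 0 in eq
... | true = 0 , s≤s z≤n , eq
... | false = let v , lt , q = card-pos n e in suc v , s≤s lt , q

card-min : ∀ n {Q} {k} → card n Q ≡ suc k → ∃ λ v → v < n × Q v ≡ true × (∀ u → u < v → Q u ≡ false)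
card-min (suc n) {Q} e with Q 0 in eq
... | true = 0 , s≤s z≤n , eq , λ _ ()
... | false = let v , lt , q , least = card-min n e in
  suc v , s≤s lt , q , λ { zero _ → eq ; (suc u) (s≤s lt) → least u lt }

card-max : ∀ n {Q} {k} → card n Q ≡ suc k → ∃ λ v → v < n × Q v ≡ true × (∀ u → u < n → Q u ≡ true → u ≤ v)
card-max (suc n) {Q} e with card n (Q ∘ suc) in eq
card-max (suc n) {Q} e | suc k = let v , lt , q , greatest = card-max n eq in
  suc v , s≤s lt , q , λ { zero _ _ → z≤n ; (suc u) (s≤s lt) q → s≤s (greatest u lt q) }
card-max (suc n) {Q} e | zero with Q 0 in eq′
... | true = 0 , s≤s z≤n , eq′ ,
  λ { zero _ _ → z≤n ; (suc u) (s≤s lt) q → ⊥-elim (false≢true (card-zero n eq u lt) q) }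

card-≥ : ∀ n i → i ≤ n → card n (λ v → i ≤ᵇ v) ℕ.+ i ≡ n
card-≥ zero zero le = ≡.refl
card-≥ (suc n) zero le = ≡.cong suc (card-≥ n zero z≤n)
card-≥ (suc n) (suc zero) le = ≡.trans (ℕₚ.+-suc _ 0) (≡.cong suc (card-≥ n zero z≤n))
card-≥ (suc n) (suc (suc i)) (s≤s le) = ≡.trans (ℕₚ.+-suc _ (suc i)) (≡.cong suc (card-≥ n (suc i) le))

bit : Bool → ℕ
bit b = if b then 1 else 0

card-suc : ∀ n Q → card (suc n) Q ≡ bit (Q 0) ℕ.+ card n (Q ∘ suc)
card-suc n Q with Q 0
... | true = ≡.refl
... | false = ≡.refl

-- Cardinalities are compared by adding indicators point by point, so that double counting needs no
-- subtraction.
card-+ : ∀ n {A B C D} → (∀ v → v < n → bit (A v) ℕ.+ bit (B v) ≡ bit (C v) ℕ.+ bit (D v)) →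
  card n A ℕ.+ card n B ≡ card n C ℕ.+ card n D
card-+ zero e = ≡.refl
card-+ (suc n) {A} {B} {C} {D} e rewrite card-suc n A | card-suc n B | card-suc n C | card-suc n D = begin
  (bit (A 0) ℕ.+ card n (A ∘ suc)) ℕ.+ (bit (B 0) ℕ.+ card n (B ∘ suc))
    ≡⟨ interchange (bit (A 0)) _ _ _ ⟩
  (bit (A 0) ℕ.+ bit (B 0)) ℕ.+ (card n (A ∘ suc) ℕ.+ card n (B ∘ suc))
    ≡⟨ ≡.cong₂ ℕ._+_ (e 0 (s≤s z≤n)) (card-+ n (λ v lt → e (suc v) (s≤s lt))) ⟩
  (bit (C 0) ℕ.+ bit (D 0)) ℕ.+ (card n (C ∘ suc) ℕ.+ card n (D ∘ suc))
    ≡⟨ interchange (bit (C 0)) _ _ _ ⟩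
  (bit (C 0) ℕ.+ card n (C ∘ suc)) ℕ.+ (bit (D 0) ℕ.+ card n (D ∘ suc)) ∎
  where
  open ≡.≡-Reasoning
  open import Algebra.Properties.CommutativeSemigroup ℕₚ.+-commutativeSemigroup using (interchange)

module FiniteSums {c ℓ : Level} (R : CommutativeSemiring c ℓ) where
  open CommutativeSemiring R hiding (zero)
  open import Relation.Binary.Reasoning.Setoid setoid
  open import Algebra.Solver.Ring.NaturalCoefficients.Default R using (solve; _:=_; _:+_; _:*_; con)

  ∑ : ℕ → (ℕ → Carrier) → Carrier
  ∑ zero f = 0#
  ∑ (suc n) f = f 0 + ∑ n (f ∘ suc)

  sumL-applyUpTo : ∀ (f : ℕ → Carrier) (g : ℕ → ℕ) n → sumL R (map f (applyUpTo g n)) ≡ ∑ n (f ∘ g)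
  sumL-applyUpTo f g zero = ≡.refl
  sumL-applyUpTo f g (suc n) = ≡.cong (f (g 0) +_) (sumL-applyUpTo f (g ∘ suc) n)

  ∑-cong : ∀ n {f g : ℕ → Carrier} → (∀ a → a < n → f a ≈ g a) → ∑ n f ≈ ∑ n g
  ∑-cong zero p = refl
  ∑-cong (suc n) p = +-cong (p 0 (s≤s z≤n)) (∑-cong n (λ a lt → p (suc a) (s≤s lt)))

  ∑-zero : ∀ n → ∑ n (λ _ → 0#) ≈ 0#
  ∑-zero zero = refl
  ∑-zero (suc n) = trans (+-identityˡ _) (∑-zero n)

  ∑-+ : ∀ n f g → ∑ n (λ a → f a + g a) ≈ ∑ n f + ∑ n g
  ∑-+ zero f g = sym (+-identityˡ _)
  ∑-+ (suc n) f g = trans (+-congˡ (∑-+ n (f ∘ suc) (g ∘ suc)))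
    (solve 4 (λ a b x y → (a :+ b) :+ (x :+ y) := (a :+ x) :+ (b :+ y)) refl _ _ _ _)

  ∑-*ˡ : ∀ n x f → ∑ n (λ a → x * f a) ≈ x * ∑ n f
  ∑-*ˡ zero x f = sym (zeroʳ _)
  ∑-*ˡ (suc n) x f = trans (+-congˡ (∑-*ˡ n x (f ∘ suc))) (sym (distribˡ _ _ _))

  ∑-*ʳ : ∀ n x f → ∑ n (λ a → f a * x) ≈ ∑ n f * x
  ∑-*ʳ zero x f = sym (zeroˡ _)
  ∑-*ʳ (suc n) x f = trans (+-congˡ (∑-*ʳ n x (f ∘ suc))) (sym (distribʳ _ _ _))

  -- The Iverson bracket: a sum over a subset is a sum over a fixed range, which may be split and
  -- exchanged freely.
  ι : Bool → Carrier → Carrier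
  ι b x = if b then x else 0#

  ι-cong : ∀ b {x y} → (b ≡ true → x ≈ y) → ι b x ≈ ι b y
  ι-cong true p = p ≡.refl
  ι-cong false p = refl

  ι-true : ∀ {b x} → b ≡ true → ι b x ≈ x
  ι-true ≡.refl = refl

  ι-false : ∀ {b x} → b ≡ false → ι b x ≈ 0#
  ι-false ≡.refl = refl

  *-ι-comm : ∀ b x y → ι b (x * y) ≈ x * ι b y
  *-ι-comm true x y = refl
  *-ι-comm false x y = sym (zeroʳ x)

  ι-*-comm : ∀ b x y → ι b (x * y) ≈ ι b x * y
  ι-*-comm true x y = refl
  ι-*-comm false x y = sym (zeroˡ y)

  ι-+ : ∀ b x y → ι b (x + y) ≈ ι b x + ι b y
  ι-+ true x y = refl
  ι-+ false x y = sym (+-identityˡ 0#)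

  ∑-ι-const : ∀ n Q x → ∑ n (λ a → ι (Q a) x) ≈ nat R (card n Q) * x
  ∑-ι-const zero Q x = sym (zeroˡ x)
  ∑-ι-const (suc n) Q x with Q 0
  ... | true = trans (+-cong (sym (*-identityˡ x)) (∑-ι-const n (Q ∘ suc) x)) (sym (distribʳ _ _ _))
  ... | false = trans (+-identityˡ _) (∑-ι-const n (Q ∘ suc) x)

  ∑-point : ∀ n i (f : ℕ → Carrier) → i < n → ∑ n (λ a → ι (a ≡ᵇ i) (f a)) ≈ f i
  ∑-point (suc n) zero f lt = trans (+-congˡ (∑-zero n)) (+-identityʳ _)
  ∑-point (suc n) (suc i) f (s≤s lt) = trans (+-identityˡ _) (∑-point n i (f ∘ suc) lt)

  -- `pred` loses nothing here, since `ρ` itself makes the count positive.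
  ∑-mark : ∀ n Q ρ x y → ρ < n → Q ρ ≡ true →
    ∑ n (λ a → ι (Q a) (if a ≡ᵇ ρ then x else y)) ≈ x + nat R (pred (card n Q)) * y
  ∑-mark (suc n) Q zero x y lt q rewrite q = +-congˡ (∑-ι-const n (Q ∘ suc) y)
  ∑-mark (suc n) Q (suc ρ) x y (s≤s lt) q with Q 0
  ... | false = trans (+-identityˡ _) (∑-mark n (Q ∘ suc) ρ x y lt q)
  ... | true = begin
    y + ∑ n (λ a → ι (Q (suc a)) (if a ≡ᵇ ρ then x else y))   ≈⟨ +-congˡ (∑-mark n (Q ∘ suc) ρ x y lt q) ⟩
    y + (x + nat R (pred (card n (Q ∘ suc))) * y)
      ≈⟨ solve 3 (λ y x k → y :+ (x :+ k :* y) := x :+ (con 1 :+ k) :* y) refl _ _ _ ⟩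
    x + nat R (suc (pred (card n (Q ∘ suc)))) * y
      ≈⟨ reflexive (≡.cong (λ k → x + nat R k * y) (suc-pred (card-remove n (Q ∘ suc) ρ lt q))) ⟩
    x + nat R (card n (Q ∘ suc)) * y ∎
    where
    suc-pred : ∀ {k l} → k ≡ suc l → suc (pred k) ≡ k
    suc-pred ≡.refl = ≡.refl

  -- The total weight of k choices, exactly one of which is marked.
  pick : (Bool → Carrier) → ℕ → Carrier
  pick w zero = 0#
  pick w (suc k) = w true + nat R k * w false

  -- The mark is supplied only for a positive count, and `t` has to recognise it only inside `Q`:
  -- being extremal makes sense only among the candidates.
  ∑-pick : ∀ n Q (w : Bool → Carrier) (t : ℕ → Bool) {k} → card n Q ≡ k →
    (∀ {l} → card n Q ≡ suc l → ∃ λ ρ → ρ < n × Q ρ ≡ true × (∀ a → a < n → Q a ≡ true → t a ≡ (a ≡ᵇ ρ))) →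
    ∑ n (λ a → ι (Q a) (w (t a))) ≈ pick w k
  ∑-pick n Q w t {zero} e h = trans
    (∑-cong n (λ a lt → reflexive (≡.cong (λ b → ι b (w (t a))) (card-zero n e a lt)))) (∑-zero n)
  ∑-pick n Q w t {suc k} e h with h e
  ... | ρ , lt , q , mark = begin
    ∑ n (λ a → ι (Q a) (w (t a)))                                      ≈⟨ ∑-cong n (λ a lt → ι-cong (Q a) (λ qa →
                                                                          trans (reflexive (≡.cong w (mark a lt qa))) (split (a ≡ᵇ ρ)))) ⟩
    ∑ n (λ a → ι (Q a) (if a ≡ᵇ ρ then w true else w false))           ≈⟨ ∑-mark n Q ρ _ _ lt q ⟩
    w true + nat R (pred (card n Q)) * w false                          ≈⟨ reflexive (≡.cong (λ k → w true + nat R (pred k) * w false) e) ⟩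
    w true + nat R k * w false                                          ∎
    where
    split : ∀ b → w b ≈ (if b then w true else w false)
    split true = refl
    split false = refl

  module _ (m : ℕ) where

    ∑ₗ : ℕ → (List ℕ → Carrier) → Carrier
    ∑ₗ zero H = H []
    ∑ₗ (suc r) H = ∑ m (λ a → ∑ₗ r (λ τ → H (a ∷ τ)))

    ∑ₗ-cong : ∀ r {H H′ : List ℕ → Carrier} → (∀ τ → length τ ≡ r → All (_< m) τ → H τ ≈ H′ τ) →
      ∑ₗ r H ≈ ∑ₗ r H′
    ∑ₗ-cong zero p = p [] ≡.refl []
    ∑ₗ-cong (suc r) p = ∑-cong m (λ a lt → ∑ₗ-cong r (λ τ e lts → p (a ∷ τ) (≡.cong suc e) (lt ∷ lts)))

    ∑ₗ-+ : ∀ r H H′ → ∑ₗ r (λ τ → H τ + H′ τ) ≈ ∑ₗ r H + ∑ₗ r H′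
    ∑ₗ-+ zero H H′ = refl
    ∑ₗ-+ (suc r) H H′ = trans (∑-cong m (λ a _ → ∑ₗ-+ r _ _)) (∑-+ m _ _)

    ∑ₗ-*ˡ : ∀ r x H → ∑ₗ r (λ τ → x * H τ) ≈ x * ∑ₗ r H
    ∑ₗ-*ˡ zero x H = refl
    ∑ₗ-*ˡ (suc r) x H = trans (∑-cong m (λ a _ → ∑ₗ-*ˡ r x _)) (∑-*ˡ m x _)

    ∑ₗ-zero : ∀ r → ∑ₗ r (λ _ → 0#) ≈ 0#
    ∑ₗ-zero zero = refl
    ∑ₗ-zero (suc r) = trans (∑-cong m (λ _ _ → ∑ₗ-zero r)) (∑-zero m)

    ∑ₗ-ι : ∀ r b H → ∑ₗ r (λ τ → ι b (H τ)) ≈ ι b (∑ₗ r H)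
    ∑ₗ-ι r true H = refl
    ∑ₗ-ι r false H = ∑ₗ-zero r

    ∑ₗ-∑ : ∀ r n (H : ℕ → List ℕ → Carrier) →
      ∑ n (λ a → ∑ₗ r (H a)) ≈ ∑ₗ r (λ τ → ∑ n (λ a → H a τ))
    ∑ₗ-∑ r zero H = sym (∑ₗ-zero r)
    ∑ₗ-∑ r (suc n) H = trans (+-congˡ (∑ₗ-∑ r n (H ∘ suc))) (sym (∑ₗ-+ r _ _))

-- Continued fractions and Motzkin paths

double : ℕ → ℕ
double zero = zero
double (suc n) = suc (suc (double n))

module PowerSeries {c ℓ : Level} (R : CommutativeSemiring c ℓ) where
  open CommutativeSemiring R hiding (zero)
  open import Relation.Binary.Reasoning.Setoid setoid
  open import Algebra.Solver.Ring.NaturalCoefficients.Default R using (solve; _:=_; _:+_; _:*_)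

  open FiniteSums R

  -- The Cauchy product by recursion on the exponent, which suits induction; `⊛≈conv` links it to
  -- `_⊛_`.
  conv : Series R → Series R → Series R
  conv f g zero = f 0 * g 0
  conv f g (suc n) = f 0 * g (suc n) + conv (f ∘ suc) g n

  conv-cong : ∀ {f f′ g g′ : Series R} n → (∀ i → i ≤ n → f i ≈ f′ i) → (∀ i → i ≤ n → g i ≈ g′ i) →
    conv f g n ≈ conv f′ g′ n
  conv-cong zero p q = *-cong (p 0 z≤n) (q 0 z≤n)
  conv-cong (suc n) p q = +-cong (*-cong (p 0 z≤n) (q (suc n) ℕₚ.≤-refl))
    (conv-cong n (λ i le → p (suc i) (s≤s le)) (λ i le → q i (ℕₚ.m≤n⇒m≤1+n le)))

  conv-congˡ : ∀ {f f′ : Series R} g n → (∀ i → f i ≈ f′ i) → conv f g n ≈ conv f′ g n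
  conv-congˡ g n p = conv-cong n (λ i _ → p i) (λ _ _ → refl)

  conv-congʳ : ∀ f {g g′ : Series R} n → (∀ i → g i ≈ g′ i) → conv f g n ≈ conv f g′ n
  conv-congʳ f n q = conv-cong {f} n (λ _ _ → refl) (λ i _ → q i)

  conv-distribʳ : ∀ f g (h : Series R) n → conv (λ i → f i + g i) h n ≈ conv f h n + conv g h n
  conv-distribʳ f g h zero = distribʳ _ _ _
  conv-distribʳ f g h (suc n) = begin
    (f 0 + g 0) * h (suc n) + conv (λ i → f (suc i) + g (suc i)) h n
      ≈⟨ +-congˡ (conv-distribʳ (f ∘ suc) (g ∘ suc) h n) ⟩
    (f 0 + g 0) * h (suc n) + (conv (f ∘ suc) h n + conv (g ∘ suc) h n)
      ≈⟨ solve 5 (λ a b x y z → (a :+ b) :* x :+ (y :+ z) := (a :* x :+ y) :+ (b :* x :+ z)) refl _ _ _ _ _ ⟩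
    (f 0 * h (suc n) + conv (f ∘ suc) h n) + (g 0 * h (suc n) + conv (g ∘ suc) h n) ∎

  conv-distribˡ : ∀ f g (h : Series R) n → conv f (λ i → g i + h i) n ≈ conv f g n + conv f h n
  conv-distribˡ f g h zero = distribˡ _ _ _
  conv-distribˡ f g h (suc n) = begin
    f 0 * (g (suc n) + h (suc n)) + conv (f ∘ suc) (λ i → g i + h i) n
      ≈⟨ +-congˡ (conv-distribˡ (f ∘ suc) g h n) ⟩
    f 0 * (g (suc n) + h (suc n)) + (conv (f ∘ suc) g n + conv (f ∘ suc) h n)
      ≈⟨ solve 5 (λ a b x y z → a :* (b :+ x) :+ (y :+ z) := (a :* b :+ y) :+ (a :* x :+ z)) refl _ _ _ _ _ ⟩
    (f 0 * g (suc n) + conv (f ∘ suc) g n) + (f 0 * h (suc n) + conv (f ∘ suc) h n) ∎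

  conv-*ˡ : ∀ x f (g : Series R) n → conv (λ i → x * f i) g n ≈ x * conv f g n
  conv-*ˡ x f g zero = *-assoc _ _ _
  conv-*ˡ x f g (suc n) = begin
    x * f 0 * g (suc n) + conv (λ i → x * f (suc i)) g n  ≈⟨ +-cong (*-assoc _ _ _) (conv-*ˡ x (f ∘ suc) g n) ⟩
    x * (f 0 * g (suc n)) + x * conv (f ∘ suc) g n        ≈⟨ distribˡ _ _ _ ⟨
    x * (f 0 * g (suc n) + conv (f ∘ suc) g n)            ∎

  conv-*ʳ : ∀ x f (g : Series R) n → conv f (λ i → x * g i) n ≈ x * conv f g n
  conv-*ʳ x f g zero = solve 3 (λ x a b → a :* (x :* b) := x :* (a :* b)) refl _ _ _
  conv-*ʳ x f g (suc n) = begin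
    f 0 * (x * g (suc n)) + conv (f ∘ suc) (λ i → x * g i) n
      ≈⟨ +-congˡ (conv-*ʳ x (f ∘ suc) g n) ⟩
    f 0 * (x * g (suc n)) + x * conv (f ∘ suc) g n
      ≈⟨ solve 4 (λ x a b y → a :* (x :* b) :+ x :* y := x :* (a :* b :+ y)) refl _ _ _ _ ⟩
    x * (f 0 * g (suc n) + conv (f ∘ suc) g n) ∎

  conv-assoc : ∀ f g (h : Series R) n → conv (conv f g) h n ≈ conv f (conv g h) n
  conv-assoc f g h zero = *-assoc _ _ _
  conv-assoc f g h (suc n) = begin
    f 0 * g 0 * h (suc n) + conv (λ i → f 0 * g (suc i) + conv (f ∘ suc) g i) h n
      ≈⟨ +-congˡ (trans (conv-distribʳ (λ i → f 0 * g (suc i)) (conv (f ∘ suc) g) h n)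
                        (+-cong (conv-*ˡ (f 0) (g ∘ suc) h n) (conv-assoc (f ∘ suc) g h n))) ⟩
    f 0 * g 0 * h (suc n) + (f 0 * conv (g ∘ suc) h n + conv (f ∘ suc) (conv g h) n)
      ≈⟨ solve 5 (λ a b x y z → a :* b :* x :+ (a :* y :+ z) := a :* (b :* x :+ y) :+ z) refl _ _ _ _ _ ⟩
    f 0 * (g 0 * h (suc n) + conv (g ∘ suc) h n) + conv (f ∘ suc) (conv g h) n ∎

  shift : Series R → Series R
  shift f zero = 0#
  shift f (suc n) = f n

  conv-shift : ∀ f (g : Series R) n → conv f (shift g) (suc n) ≈ conv f g n
  conv-shift f g zero = trans (+-congˡ (zeroʳ _)) (+-identityʳ _)
  conv-shift f g (suc n) = +-congˡ (conv-shift (f ∘ suc) g n)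

  conv-zeroˡ : ∀ (g : Series R) n → conv (λ _ → 0#) g n ≈ 0#
  conv-zeroˡ g zero = zeroˡ _
  conv-zeroˡ g (suc n) = trans (+-cong (zeroˡ _) (conv-zeroˡ g n)) (+-identityˡ _)

  conv-oneˡ : ∀ (g : Series R) n → conv (oneS R) g n ≈ g n
  conv-oneˡ g zero = *-identityˡ _
  conv-oneˡ g (suc n) = trans (+-cong (*-identityˡ _) (conv-zeroˡ g n)) (+-identityʳ _)

  ⊛≈conv : ∀ f g n → (_⊛_ R f g) n ≈ conv f g n
  ⊛≈conv f g n = trans (reflexive (sumL-applyUpTo (λ i → f i * g (n ∸ i)) id (suc n))) (go f n)
    where
    go : ∀ f n → ∑ (suc n) (λ i → f i * g (n ∸ i)) ≈ conv f g n
    go f zero = +-identityʳ _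
    go f (suc n) = +-congˡ (go (f ∘ suc) n)

  -- The sum of t^j G_j over all j. With the powers of h for `G` it is 1 / (1 - t h).
  diag : (ℕ → Series R) → Series R
  diag G zero = G 0 0
  diag G (suc n) = G 0 (suc n) + diag (G ∘ suc) n

  diag-cong : ∀ {G H : ℕ → Series R} n → (∀ j i → G j i ≈ H j i) → diag G n ≈ diag H n
  diag-cong zero p = p 0 0
  diag-cong (suc n) p = +-cong (p 0 (suc n)) (diag-cong n (λ j → p (suc j)))

  conv-diag : ∀ h (G : ℕ → Series R) n → diag (λ j → conv h (G j)) n ≈ conv h (diag G) n
  conv-diag h G zero = refl
  conv-diag h G (suc n) = begin
    conv h (G 0) (suc n) + diag (λ j → conv h (G (suc j))) n
      ≈⟨ +-congˡ (trans (conv-diag h (G ∘ suc) n) (sym (conv-shift h (diag (G ∘ suc)) n))) ⟩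
    conv h (G 0) (suc n) + conv h (shift (diag (G ∘ suc))) (suc n)
      ≈⟨ conv-distribˡ h (G 0) (shift (diag (G ∘ suc))) (suc n) ⟨
    conv h (λ i → G 0 i + shift (diag (G ∘ suc)) i) (suc n)
      ≈⟨ conv-congʳ h (suc n) (λ { zero → +-identityʳ _ ; (suc i) → refl }) ⟩
    conv h (diag G) (suc n) ∎

  geom≈diag : ∀ h n → geom R h n ≈ diag (spow R h) n
  geom≈diag h n = trans (reflexive (sumL-applyUpTo (λ j → spow R h j (n ∸ j)) id (suc n))) (go (spow R h) n)
    where
    go : ∀ G n → ∑ (suc n) (λ j → G j (n ∸ j)) ≈ diag G n
    go G zero = +-identityʳ _
    go G (suc n) = +-congˡ (go (G ∘ suc) n)

  geom-zero : ∀ h → geom R h 0 ≈ 1#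
  geom-zero h = geom≈diag h 0

  -- Coefficients of 1 / (1 - t h) = 1 + t h / (1 - t h).
  geom-suc : ∀ h n → geom R h (suc n) ≈ conv h (geom R h) n
  geom-suc h n = begin
    geom R h (suc n)                            ≈⟨ geom≈diag h (suc n) ⟩
    0# + diag (λ j → _⊛_ R h (spow R h j)) n    ≈⟨ +-identityˡ _ ⟩
    diag (λ j → _⊛_ R h (spow R h j)) n         ≈⟨ diag-cong n (λ j → ⊛≈conv h (spow R h j)) ⟩
    diag (λ j → conv h (spow R h j)) n          ≈⟨ conv-diag h (spow R h) n ⟩
    conv h (diag (spow R h)) n                  ≈⟨ conv-congʳ h n (λ i → sym (geom≈diag h i)) ⟩
    conv h (geom R h) n                         ∎

  geom-cong : ∀ {h h′ : Series R} n → (∀ i → suc i ≤ n → h i ≈ h′ i) →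
    ∀ i → i ≤ n → geom R h i ≈ geom R h′ i
  geom-cong {h} {h′} n p zero _ = trans (geom-zero h) (sym (geom-zero h′))
  geom-cong {h} {h′} (suc n) p (suc i) (s≤s le) = begin
    geom R h (suc i)      ≈⟨ geom-suc h i ⟩
    conv h (geom R h) i   ≈⟨ conv-cong i (λ j le′ → p j (s≤s (ℕₚ.≤-trans le′ le)))
                              (λ j le′ → geom-cong n (λ k lt → p k (ℕₚ.m≤n⇒m≤1+n lt)) j (ℕₚ.≤-trans le′ le)) ⟩
    conv h′ (geom R h′) i ≈⟨ geom-suc h′ i ⟨
    geom R h′ (suc i)     ∎

  module _ (α δ : ℕ → Carrier) where

    cfTrunc-zero : ∀ d k → cfTrunc R α δ (suc d) k 0 ≈ 1#
    cfTrunc-zero d k = geom-zero (λ i → δ k * oneS R i + α k * cfTrunc R α δ d (suc k) i)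

    -- Each level of the fraction contributes a factor t, so one more level at depth `d` affects
    -- only the coefficients beyond `d`.
    cfTrunc-suc : ∀ d k n → n ≤ d → cfTrunc R α δ (suc d) k n ≈ cfTrunc R α δ d k n
    cfTrunc-suc zero k .zero z≤n = cfTrunc-zero 0 k
    cfTrunc-suc (suc d) k n le = geom-cong (suc d)
      (λ i lt → +-congˡ (*-congˡ (cfTrunc-suc d (suc k) i (ℕ.≤-pred lt)))) n le

    -- The infinite fraction from level `k` on; at `k = 1` it is `cfCoeff` by definition.
    cf : ℕ → Series R
    cf k n = cfTrunc R α δ (suc n) k n

    cfTrunc≈cf : ∀ d k n → n ≤ d → cfTrunc R α δ d k n ≈ cf k n
    cfTrunc≈cf zero k .zero z≤n = sym (cfTrunc-suc 0 k 0 z≤n)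
    cfTrunc≈cf (suc d) k n le with n ℕₚ.≤? d
    ... | yes le′ = trans (cfTrunc-suc d k n le′) (cfTrunc≈cf d k n le′)
    ... | no nle rewrite ℕₚ.≤-antisym le (ℕₚ.≰⇒> nle) = sym (cfTrunc-suc (suc d) k (suc d) ℕₚ.≤-refl)

    cf-zero : ∀ k → cf k 0 ≈ 1#
    cf-zero k = cfTrunc-zero 0 k

    -- Coefficients of F(k) = 1 + t (δ(k) F(k) + α(k) F(k+1) F(k)). The truncations that arise have
    -- different depths, but all are deep enough to be replaced by `cf`.
    cf-suc : ∀ k n → cf k (suc n) ≈ δ k * cf k n + α k * conv (cf (suc k)) (cf k) n
    cf-suc k n = begin
      geom R h (suc n)
        ≈⟨ geom-suc h n ⟩
      conv h (geom R h) n
        ≈⟨ conv-cong n (λ i le → +-congˡ (*-congˡ (cfTrunc≈cf (suc n) (suc k) i (ℕₚ.m≤n⇒m≤1+n le))))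
                       (λ i le → cfTrunc≈cf (suc (suc n)) k i (ℕₚ.m≤n⇒m≤1+n (ℕₚ.m≤n⇒m≤1+n le))) ⟩
      conv (λ i → δ k * oneS R i + α k * cf (suc k) i) (cf k) n
        ≈⟨ conv-distribʳ (λ i → δ k * oneS R i) (λ i → α k * cf (suc k) i) (cf k) n ⟩
      conv (λ i → δ k * oneS R i) (cf k) n + conv (λ i → α k * cf (suc k) i) (cf k) n
        ≈⟨ +-cong (trans (conv-*ˡ (δ k) (oneS R) (cf k) n) (*-congˡ (conv-oneˡ (cf k) n)))
                  (conv-*ˡ (α k) (cf (suc k)) (cf k) n) ⟩
      δ k * cf k n + α k * conv (cf (suc k)) (cf k) n ∎
      where
      h : Series R
      h = λ i → δ k * oneS R i + α k * cfTrunc R α δ (suc n) (suc k) i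

    -- With δ(k) = 0 the recursion reads F(k) = 1 + t α(k) F(k+1) F(k); here it is multiplied by an
    -- arbitrary series.
    conv-cf-suc : ∀ k → δ k ≈ 0# → ∀ X n →
      conv (cf k) X (suc n) ≈ X (suc n) + α k * conv (cf (suc k)) (conv (cf k) X) n
    conv-cf-suc k δ≈0 X n = +-cong (trans (*-congʳ (cf-zero k)) (*-identityˡ _)) (begin
      conv (cf k ∘ suc) X n
        ≈⟨ conv-congˡ X n (λ i → trans (cf-suc k i) (trans (+-congʳ (trans (*-congʳ δ≈0) (zeroˡ _))) (+-identityˡ _))) ⟩
      conv (λ i → α k * conv (cf (suc k)) (cf k) i) X n
        ≈⟨ conv-*ˡ (α k) _ X n ⟩
      α k * conv (conv (cf (suc k)) (cf k)) X n
        ≈⟨ *-congˡ (conv-assoc (cf (suc k)) (cf k) X n) ⟩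
      α k * conv (cf (suc k)) (conv (cf k) X) n ∎)

-- Motzkin paths with alternating step sets, and their contraction

module MotzkinPaths {c ℓ : Level} (R : CommutativeSemiring c ℓ) where
  open CommutativeSemiring R hiding (zero)
  open import Relation.Binary.Reasoning.Setoid setoid
  open import Algebra.Solver.Ring.NaturalCoefficients.Default R using (solve; _:=_; _:+_; _:*_)
  open PowerSeries R

  record Steps : Set c where
    field
      up level down : ℕ → ℕ → Carrier

  -- The paths of r steps from height k at time i to height 0.
  paths : Steps → ℕ → ℕ → ℕ → Carrier
  paths w zero i zero = 1#
  paths w zero i (suc k) = 0#
  paths w (suc r) i k =
    level i k * paths w r (suc i) k + up i k * paths w r (suc i) (suc k) + down i k * paths w r (suc i) (pred k)
    where open Steps w

  paths-cong : ∀ {w w′} → (∀ i k → Steps.up w i k ≈ Steps.up w′ i k) →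
    (∀ i k → Steps.level w i k ≈ Steps.level w′ i k) → (∀ i k → Steps.down w i k ≈ Steps.down w′ i k) →
    ∀ r i k → paths w r i k ≈ paths w′ r i k
  paths-cong u l d zero i zero = refl
  paths-cong u l d zero i (suc k) = refl
  paths-cong u l d (suc r) i k = +-cong (+-cong
    (*-cong (l i k) (paths-cong u l d r (suc i) k))
    (*-cong (u i k) (paths-cong u l d r (suc i) (suc k))))
    (*-cong (d i k) (paths-cong u l d r (suc i) (pred k)))

  -- Merging the steps of an even time and the following odd time turns the paths into those of a
  -- J-fraction, the contraction of the S-fraction on the right.
  module _ (w : Steps) (α δ up level₀ level₁ down : ℕ → Carrier)
    (up-even : ∀ i k → evenᵇ i ≡ true → Steps.up w i k ≈ up k)
    (level-even : ∀ i k → evenᵇ i ≡ true → Steps.level w i k ≈ level₀ k)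
    (down-even : ∀ i k → evenᵇ i ≡ true → Steps.down w i k ≈ 0#)
    (up-odd : ∀ i k → evenᵇ i ≡ false → Steps.up w i k ≈ 0#)
    (level-odd : ∀ i k → evenᵇ i ≡ false → Steps.level w i k ≈ level₁ k)
    (down-odd : ∀ i k → evenᵇ i ≡ false → Steps.down w i k ≈ down k)
    (down-zero : down 0 ≈ 0#)
    (α-odd : ∀ k → α (suc (double k)) ≈ up k * down (suc k))
    (α-even : ∀ k → α (double (suc k)) ≈ level₀ (suc k) * level₁ (suc k))
    (δ-one : δ 1 ≈ level₀ 0 * level₁ 0)
    (δ-rest : ∀ k → δ (suc (suc k)) ≈ 0#)
    where

    F : ℕ → Series R
    F = cf α δ

    -- The first-passage decomposition of the paths that descend from height k to 0.
    X : ℕ → Series R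
    X zero = F 1
    X (suc k) zero = 0#
    X (suc k) (suc n) =
      level₀ (suc k) * down (suc k) * conv (F (suc (double (suc k)))) (conv (F (double (suc k))) (X k)) n

    -- Both terms begin with an up step at an even time. Coming down at once and staying up
    -- correspond to the two summands of F(2k+2) = 1 + t α(2k+2) F(2k+3) F(2k+2): the factor
    -- `level₁` of the second step and the factor `level₀` that `X (suc k)` spends on leaving height
    -- k + 1 make up α(2k+2).
    up-X : ∀ k n →
      up k * down (suc k) * X k n + up k * level₁ (suc k) * X (suc k) n
      ≈ up k * down (suc k) * conv (F (double (suc k))) (X k) n
    up-X k zero = begin
      up k * down (suc k) * X k 0 + up k * level₁ (suc k) * 0#  ≈⟨ trans (+-congˡ (zeroʳ _)) (+-identityʳ _) ⟩
      up k * down (suc k) * X k 0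
        ≈⟨ *-congˡ (trans (*-congʳ (cf-zero α δ (double (suc k)))) (*-identityˡ _)) ⟨
      up k * down (suc k) * (F (double (suc k)) 0 * X k 0) ∎
    up-X k (suc n) = begin
      up k * down (suc k) * X k (suc n) + up k * level₁ (suc k) * (level₀ (suc k) * down (suc k) * C)
        ≈⟨ solve 6 (λ u d l₁ l₀ x y → u :* d :* x :+ u :* l₁ :* (l₀ :* d :* y) := u :* d :* (x :+ l₀ :* l₁ :* y))
             refl (up k) (down (suc k)) (level₁ (suc k)) (level₀ (suc k)) (X k (suc n)) C ⟩
      up k * down (suc k) * (X k (suc n) + level₀ (suc k) * level₁ (suc k) * C)
        ≈⟨ *-congˡ (+-congˡ (*-congʳ (α-even k))) ⟨
      up k * down (suc k) * (X k (suc n) + α (double (suc k)) * C)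
        ≈⟨ *-congˡ (conv-cf-suc α δ (double (suc k)) (δ-rest (double k)) (X k) n) ⟨
      up k * down (suc k) * conv (F (double (suc k))) (X k) (suc n) ∎
      where
      C : Carrier
      C = conv (F (suc (double (suc k)))) (conv (F (double (suc k))) (X k)) n

    X-zero-suc : ∀ n → X 0 (suc n) ≈
      level₀ 0 * level₁ 0 * X 0 n + (up 0 * down 1 * X 0 n + up 0 * level₁ 1 * X 1 n)
    X-zero-suc n = begin
      F 1 (suc n)                                           ≈⟨ cf-suc α δ 1 n ⟩
      δ 1 * F 1 n + α 1 * conv (F 2) (F 1) n                ≈⟨ +-cong (*-congʳ δ-one) (*-congʳ (α-odd 0)) ⟩
      level₀ 0 * level₁ 0 * F 1 n + up 0 * down 1 * conv (F 2) (F 1) n  ≈⟨ +-congˡ (up-X 0 n) ⟨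
      level₀ 0 * level₁ 0 * F 1 n + (up 0 * down 1 * X 0 n + up 0 * level₁ 1 * X 1 n) ∎

    -- The product F(2k+2) F(2k+3) is the J-fraction with level coefficient α(2k+2) + α(2k+3) at its
    -- top, the odd contraction; it counts the merged excursions that stay at height k + 1 or above.
    -- Expanding each of the two factors once splits off the first merged step.
    X-suc-suc : ∀ k n → X (suc k) (suc n) ≈
      level₀ (suc k) * level₁ (suc k) * X (suc k) n
      + (up (suc k) * down (suc (suc k)) * X (suc k) n + up (suc k) * level₁ (suc (suc k)) * X (suc (suc k)) n)
      + level₀ (suc k) * down (suc k) * X k n
    X-suc-suc k n = trans (go n) (sym (+-congʳ (+-congˡ (up-X (suc k) n))))
      where
      cd : Carrier
      cd = level₀ (suc k) * down (suc k)
      F₂ F₃ F₄ Y : Series R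
      F₂ = F (double (suc k))
      F₃ = F (suc (double (suc k)))
      F₄ = F (double (suc (suc k)))
      Y = conv F₂ (X k)
      go : ∀ n → X (suc k) (suc n) ≈
        level₀ (suc k) * level₁ (suc k) * X (suc k) n
        + up (suc k) * down (suc (suc k)) * conv F₄ (X (suc k)) n
        + cd * X k n
      go zero = begin
        cd * (F₃ 0 * (F₂ 0 * X k 0))
          ≈⟨ *-congˡ (trans (*-cong (cf-zero α δ (suc (double (suc k)))) (trans (*-congʳ (cf-zero α δ (double (suc k)))) (*-identityˡ _))) (*-identityˡ _)) ⟩
        cd * X k 0
          ≈⟨ +-identityˡ _ ⟨
        0# + cd * X k 0
          ≈⟨ +-congʳ (trans (+-cong (zeroʳ _) (trans (*-congˡ (zeroʳ _)) (zeroʳ _))) (+-identityˡ _)) ⟨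
        level₀ (suc k) * level₁ (suc k) * 0# + up (suc k) * down (suc (suc k)) * (F₄ 0 * 0#) + cd * X k 0 ∎
      go (suc n) = begin
        cd * conv F₃ Y (suc n)
          ≈⟨ *-congˡ (conv-cf-suc α δ (suc (double (suc k))) (δ-rest (suc (double k))) Y n) ⟩
        cd * (Y (suc n) + α (suc (double (suc k))) * conv F₄ (conv F₃ Y) n)
          ≈⟨ *-congˡ (+-cong (conv-cf-suc α δ (double (suc k)) (δ-rest (double k)) (X k) n) (*-congʳ (α-odd (suc k)))) ⟩
        cd * (X k (suc n) + α (double (suc k)) * conv F₃ Y n + ud * conv F₄ (conv F₃ Y) n)
          ≈⟨ *-congˡ (+-congʳ (+-congˡ (*-congʳ (α-even k)))) ⟩
        cd * (X k (suc n) + ll * conv F₃ Y n + ud * conv F₄ (conv F₃ Y) n)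
          ≈⟨ solve 6 (λ c x l y u z → c :* (x :+ l :* y :+ u :* z) := l :* (c :* y) :+ u :* (c :* z) :+ c :* x)
               refl cd (X k (suc n)) ll (conv F₃ Y n) ud (conv F₄ (conv F₃ Y) n) ⟩
        ll * (cd * conv F₃ Y n) + ud * (cd * conv F₄ (conv F₃ Y) n) + cd * X k (suc n)
          -- The scalar `cd` and one power of t are absorbed, as `X (suc k)` is t times `cd` times
          -- the product of `F₃` and `Y`.
          ≈⟨ +-congʳ (+-congˡ (*-congˡ (begin
               cd * conv F₄ (conv F₃ Y) n             ≈⟨ conv-*ʳ cd F₄ (conv F₃ Y) n ⟨
               conv F₄ (λ i → cd * conv F₃ Y i) n     ≈⟨ conv-shift F₄ (λ i → cd * conv F₃ Y i) n ⟨
               conv F₄ (shift (λ i → cd * conv F₃ Y i)) (suc n)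
                 ≈⟨ conv-congʳ F₄ (suc n) (λ { zero → refl ; (suc i) → refl }) ⟩
               conv F₄ (X (suc k)) (suc n)            ∎))) ⟩
        ll * X (suc k) (suc n) + ud * conv F₄ (X (suc k)) (suc n) + cd * X k (suc n) ∎
        where
        ll ud : Carrier
        ll = level₀ (suc k) * level₁ (suc k)
        ud = up (suc k) * down (suc (suc k))

    paths-even : ∀ r i k → evenᵇ i ≡ true → paths w (suc r) i k ≈
      level₀ k * paths w r (suc i) k + up k * paths w r (suc i) (suc k)
    paths-even r i k e = trans
      (+-cong (+-cong (*-congʳ (level-even i k e)) (*-congʳ (up-even i k e)))
              (trans (*-congʳ (down-even i k e)) (zeroˡ _)))
      (+-identityʳ _)

    paths-odd : ∀ r i k → evenᵇ i ≡ false → paths w (suc r) i k ≈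
      level₁ k * paths w r (suc i) k + down k * paths w r (suc i) (pred k)
    paths-odd r i k e = +-cong
      (trans (+-cong (*-congʳ (level-odd i k e)) (trans (*-congʳ (up-odd i k e)) (zeroˡ _))) (+-identityʳ _))
      (*-congʳ (down-odd i k e))

    paths≈X : ∀ n i k → evenᵇ i ≡ true → paths w (n ℕ.+ n) i k ≈ X k n
    paths≈X zero i zero e = sym (cf-zero α δ 1)
    paths≈X zero i (suc k) e = refl
    paths≈X (suc n) i k e rewrite ℕₚ.+-suc n n = begin
      paths w (suc (suc (n ℕ.+ n))) i k
        ≈⟨ paths-even (suc (n ℕ.+ n)) i k e ⟩
      level₀ k * paths w (suc (n ℕ.+ n)) (suc i) k + up k * paths w (suc (n ℕ.+ n)) (suc i) (suc k)
        ≈⟨ +-cong (*-congˡ (odd k)) (*-congˡ (odd (suc k))) ⟩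
      level₀ k * (level₁ k * X k n + down k * X (pred k) n)
        + up k * (level₁ (suc k) * X (suc k) n + down (suc k) * X k n)
        ≈⟨ fold k ⟩
      X k (suc n) ∎
      where
      odd : ∀ k → paths w (suc (n ℕ.+ n)) (suc i) k ≈ level₁ k * X k n + down k * X (pred k) n
      odd k = trans (paths-odd (n ℕ.+ n) (suc i) k (≡.cong not e))
        (+-cong (*-congˡ (paths≈X n (suc (suc i)) k (≡.trans (𝔹ₚ.not-involutive _) e)))
                (*-congˡ (paths≈X n (suc (suc i)) (pred k) (≡.trans (𝔹ₚ.not-involutive _) e))))
      fold : ∀ k →
        level₀ k * (level₁ k * X k n + down k * X (pred k) n)
        + up k * (level₁ (suc k) * X (suc k) n + down (suc k) * X k n) ≈ X k (suc n)
      -- At height 0 there is still a formal down step to `pred 0`, that is, to 0 again; `down-zero`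
      -- removes it.
      fold zero = begin
        level₀ 0 * (level₁ 0 * X 0 n + down 0 * X 0 n) + up 0 * (level₁ 1 * X 1 n + down 1 * X 0 n)
          ≈⟨ +-congʳ (*-congˡ (trans (+-congˡ (trans (*-congʳ down-zero) (zeroˡ _))) (+-identityʳ _))) ⟩
        level₀ 0 * (level₁ 0 * X 0 n) + up 0 * (level₁ 1 * X 1 n + down 1 * X 0 n)
          ≈⟨ solve 7 (λ a b x u l y d → a :* (b :* x) :+ u :* (l :* y :+ d :* x)
                 := a :* b :* x :+ (u :* d :* x :+ u :* l :* y))
               refl (level₀ 0) (level₁ 0) (X 0 n) (up 0) (level₁ 1) (X 1 n) (down 1) ⟩
        level₀ 0 * level₁ 0 * X 0 n + (up 0 * down 1 * X 0 n + up 0 * level₁ 1 * X 1 n)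
          ≈⟨ X-zero-suc n ⟨
        X 0 (suc n) ∎
      fold (suc k) = trans
        (solve 9 (λ a b x d z u l y d′ → a :* (b :* x :+ d :* z) :+ u :* (l :* y :+ d′ :* x)
            := a :* b :* x :+ (u :* d′ :* x :+ u :* l :* y) :+ a :* d :* z)
          refl (level₀ (suc k)) (level₁ (suc k)) (X (suc k) n) (down (suc k)) (X k n)
               (up (suc k)) (level₁ (suc (suc k))) (X (suc (suc k)) n) (down (suc (suc k))))
        (sym (X-suc-suc k n))

    paths≈cfCoeff : ∀ n → paths w (n ℕ.+ n) 0 0 ≈ cfCoeff R α δ n
    paths≈cfCoeff n = paths≈X n 0 0 ≡.refl

-- Restrictions of a permutation to the positions from i on

mem : ℕ → List ℕ → Bool
mem v [] = false
mem v (a ∷ τ) = (v ≡ᵇ a) ∨ mem v τ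

mem-here : ∀ a τ → mem a (a ∷ τ) ≡ true
mem-here a τ rewrite ≡ᵇ-refl a = ≡.refl

mem-≢ : ∀ {v a} τ → v ≢ a → mem v (a ∷ τ) ≡ mem v τ
mem-≢ τ ne rewrite ≡ᵇ-false ne = ≡.refl

mem-∷ : ∀ {v} a τ → mem v τ ≡ true → mem v (a ∷ τ) ≡ true
mem-∷ {v} a τ e with v ≡ᵇ a
... | true = ≡.refl
... | false = e

∉-∷ : ∀ {v} a τ → mem v (a ∷ τ) ≡ false → v ≢ a × mem v τ ≡ false
∉-∷ {v} a τ e with v ≡ᵇ a in eq
... | false = (λ { ≡.refl → false≢true eq (≡ᵇ-refl v) }) , e

uniqueᵇ : List ℕ → Bool
uniqueᵇ [] = true
uniqueᵇ (a ∷ τ) = not (mem a τ) ∧ uniqueᵇ τ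

not-true : ∀ {b} → not b ≡ true → b ≡ false
not-true {false} _ = ≡.refl

true-not : ∀ {b} → b ≡ false → not b ≡ true
true-not ≡.refl = ≡.refl

unique-∷ : ∀ a τ → uniqueᵇ (a ∷ τ) ≡ true → mem a τ ≡ false × uniqueᵇ τ ≡ true
unique-∷ a τ e = let p , q = ∧-split {not (mem a τ)} e in not-true p , q

agreeᵇ : ℕ → (ℕ → Bool) → (ℕ → Bool) → Bool
agreeᵇ n P Q = does (ℕₚ.allUpTo? (λ v → P v 𝔹ₚ.≟ Q v) n)

agree-true : ∀ n {P Q} → agreeᵇ n P Q ≡ true → ∀ v → v < n → P v ≡ Q v
agree-true n {P} {Q} e v lt with ℕₚ.allUpTo? (λ v → P v 𝔹ₚ.≟ Q v) n
agree-true n e v lt | yes p = p lt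

true-agree : ∀ n {P Q} → (∀ v → v < n → P v ≡ Q v) → agreeᵇ n P Q ≡ true
true-agree n {P} {Q} p = dec-true (ℕₚ.allUpTo? (λ v → P v 𝔹ₚ.≟ Q v) n) (λ {v} → p v)

-- A list τ stands for the values of a permutation at the positions i, i + 1, …, m - 1, and P for
-- the set of values below i that occur in τ.
fitsᵇ : ℕ → (ℕ → Bool) → List ℕ → Bool
fitsᵇ i P τ = uniqueᵇ τ ∧ agreeᵇ i (λ v → mem v τ) P

fits-unique : ∀ {i P} τ → fitsᵇ i P τ ≡ true → uniqueᵇ τ ≡ true
fits-unique τ e = proj₁ (∧-split e)

fits-agree : ∀ {i P} τ → fitsᵇ i P τ ≡ true → ∀ v → v < i → mem v τ ≡ P v
fits-agree {i} τ e = agree-true i (proj₂ (∧-split {uniqueᵇ τ} e))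

true-fits : ∀ {i P} τ → uniqueᵇ τ ≡ true → (∀ v → v < i → mem v τ ≡ P v) → fitsᵇ i P τ ≡ true
true-fits {i} τ u p = ∧-join u (true-agree i p)

-- `P₁` is what the tail has to cover below `i`: `P` itself if `a` is at least `i`, and `P` without
-- `a` otherwise. The tail starts one position later and so must also prescribe the membership of
-- `i`; it is prescribed to be whatever it is in `τ`.
fits-tail : ∀ i P P₁ a τ →
  (∀ v → v < i → v ≢ a → P₁ v ≡ P v) → (a < i → P a ≡ true × P₁ a ≡ false) →
  fitsᵇ i P (a ∷ τ) ≡ not (mem a τ) ∧ fitsᵇ (suc i) (upd P₁ i (mem i τ)) τ
fits-tail i P P₁ a τ off at = bool-ext to from
  where
  to : fitsᵇ i P (a ∷ τ) ≡ true → not (mem a τ) ∧ fitsᵇ (suc i) (upd P₁ i (mem i τ)) τ ≡ true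
  to e with unique-∷ a τ (fits-unique {i} (a ∷ τ) e)
  ... | a∉τ , u = ∧-join (true-not a∉τ) (true-fits {suc i} τ u agree)
    where
    agree : ∀ v → v < suc i → mem v τ ≡ upd P₁ i (mem i τ) v
    agree v lt with v ℕₚ.≟ i
    ... | yes ≡.refl = ≡.sym (upd-eq P₁ i _)
    ... | no v≢i with ℕₚ.≤∧≢⇒< (ℕ.≤-pred lt) v≢i | v ℕₚ.≟ a
    ...   | v<i | yes ≡.refl = ≡.trans a∉τ (≡.sym (≡.trans (upd-neq P₁ i _ v≢i) (proj₂ (at v<i))))
    ...   | v<i | no v≢a = ≡.trans (≡.sym (mem-≢ τ v≢a))
      (≡.trans (fits-agree {i} (a ∷ τ) e v v<i) (≡.sym (≡.trans (upd-neq P₁ i _ v≢i) (off v v<i v≢a))))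
  from : not (mem a τ) ∧ fitsᵇ (suc i) (upd P₁ i (mem i τ)) τ ≡ true → fitsᵇ i P (a ∷ τ) ≡ true
  from e with ∧-split {not (mem a τ)} e
  ... | a∉τ , f = true-fits {i} (a ∷ τ) (∧-join a∉τ (fits-unique {suc i} τ f)) agree
    where
    agree : ∀ v → v < i → mem v (a ∷ τ) ≡ P v
    agree v v<i with v ℕₚ.≟ a
    ... | yes ≡.refl = ≡.trans (mem-here a τ) (≡.sym (proj₁ (at v<i)))
    ... | no v≢a = ≡.trans (mem-≢ τ v≢a) (≡.trans (fits-agree {suc i} τ f v (ℕₚ.m<n⇒m<1+n v<i))
      (≡.trans (upd-neq P₁ i _ (ℕₚ.<⇒≢ v<i)) (off v v<i v≢a)))

fits-wrong : ∀ i P b τ → mem i τ ≢ b → fitsᵇ (suc i) (upd P i b) τ ≡ false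
fits-wrong i P b τ ne = ≢true⇒false (λ f → ne (≡.trans (fits-agree {suc i} τ f i ℕₚ.≤-refl) (upd-eq P i b)))

fits-absent : ∀ i P a τ → a < i → P a ≡ false → fitsᵇ i P (a ∷ τ) ≡ false
fits-absent i P a τ a<i e = ≢true⇒false (λ f → false≢true e (≡.trans (≡.sym (fits-agree {i} (a ∷ τ) f a a<i)) (mem-here a τ)))

-- The arcs p → σ p at the positions p ≥ i form paths; root sends the end of such a path, a value
-- below i, to its start, and leaves the other values below i alone.
root : ℕ → List ℕ → ℕ → ℕ
root i [] p = p
root i (a ∷ τ) p with ℕₚ.<-cmp a i
... | tri< _ _ _ = if p ≡ᵇ a then root (suc i) τ i else root (suc i) τ p
... | tri≈ _ _ _ = root (suc i) τ p
... | tri> _ _ _ = if root (suc i) τ p ≡ᵇ a then root (suc i) τ i else root (suc i) τ p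

freeᵇ : ℕ → List ℕ → ℕ → Bool
freeᵇ i τ u = (i ≤ᵇ u) ∧ not (mem u τ)

free-split : ∀ {i} τ {u} → freeᵇ i τ u ≡ true → i ≤ u × mem u τ ≡ false
free-split {i} τ {u} e = let p , q = ∧-split {i ≤ᵇ u} e in ≤ᵇ-true p , not-true q

free-join : ∀ {i} τ {u} → i ≤ u → mem u τ ≡ false → freeᵇ i τ u ≡ true
free-join τ le e = ∧-join (true-≤ᵇ le) (true-not e)

root-outside : ∀ i τ p → p < i → mem p τ ≡ false → root i τ p ≡ p
root-outside i [] p lt e = ≡.refl
root-outside i (a ∷ τ) p lt e with ∉-∷ {p} a τ e
... | p≢a , p∉τ with ℕₚ.<-cmp a i | root-outside (suc i) τ p (ℕₚ.m<n⇒m<1+n lt) p∉τ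
...   | tri< _ _ _ | ih rewrite ≡ᵇ-false p≢a = ih
...   | tri≈ _ _ _ | ih = ih
...   | tri> _ _ _ | ih rewrite ih | ≡ᵇ-false p≢a = ≡.refl

root-< : ∀ {i a} τ → a < i → ∀ p →
  root i (a ∷ τ) p ≡ (if p ≡ᵇ a then root (suc i) τ i else root (suc i) τ p)
root-< {i} {a} τ a<i p with ℕₚ.<-cmp a i
... | tri< _ _ _ = ≡.refl
... | tri≈ ¬a<i _ _ = ⊥-elim (¬a<i a<i)
... | tri> ¬a<i _ _ = ⊥-elim (¬a<i a<i)

root-≡ : ∀ i τ p → root i (i ∷ τ) p ≡ root (suc i) τ p
root-≡ i τ p with ℕₚ.<-cmp i i
... | tri< _ i≢i _ = ⊥-elim (i≢i ≡.refl)
... | tri≈ _ _ _ = ≡.refl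
... | tri> _ i≢i _ = ⊥-elim (i≢i ≡.refl)

root-> : ∀ {i a} τ → i < a → ∀ p →
  root i (a ∷ τ) p ≡ (if root (suc i) τ p ≡ᵇ a then root (suc i) τ i else root (suc i) τ p)
root-> {i} {a} τ i<a p with ℕₚ.<-cmp a i
... | tri< _ _ ¬i<a = ⊥-elim (¬i<a i<a)
... | tri≈ _ _ ¬i<a = ⊥-elim (¬i<a i<a)
... | tri> _ _ _ = ≡.refl

module _ {m : ℕ} where

  record IsSuffix (i : ℕ) (τ : List ℕ) : Set where
    constructor isSuffix
    field
      bound : i ℕ.+ length τ ≡ m
      values : All (_< m) τ
      unique : uniqueᵇ τ ≡ true

  suffix-tail : ∀ {i a τ} → IsSuffix i (a ∷ τ) → IsSuffix (suc i) τ
  suffix-tail {i} {a} {τ} (isSuffix b (_ ∷ v) u) =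
    isSuffix (≡.trans (≡.sym (ℕₚ.+-suc i (length τ))) b) v (proj₂ (unique-∷ a τ u))

  suffix-< : ∀ {i a τ} → IsSuffix i (a ∷ τ) → i < m
  suffix-< {i} {a} {τ} s = ℕₚ.≤-trans (ℕₚ.m≤m+n (suc i) (length τ))
    (ℕₚ.≤-reflexive (IsSuffix.bound (suffix-tail s)))

  suffix-∉ : ∀ {i a τ} → IsSuffix i (a ∷ τ) → mem a τ ≡ false
  suffix-∉ {i} {a} {τ} s = proj₁ (unique-∷ a τ (IsSuffix.unique s))

  ends≢ : ∀ {p a τ} → mem p τ ≡ true → mem a τ ≡ false → p ≢ a
  ends≢ p∈ a∉ ≡.refl = false≢true a∉ p∈

  -- A bijection between the values below `i` that are used and the values from `i` on that are
  -- missing. The first three fields make the start of a path an admissible value for a valley; the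
  -- last two decide which value closes a cycle.
  record Roots (i : ℕ) (τ : List ℕ) (f : ℕ → ℕ) : Set where
    field
      lower : ∀ {p} → p < i → mem p τ ≡ true → i ≤ f p
      upper : ∀ {p} → p < i → mem p τ ≡ true → f p < m
      fresh : ∀ {p} → p < i → mem p τ ≡ true → mem (f p) τ ≡ false
      injective : ∀ {p q} → p < i → q < i → mem p τ ≡ true → mem q τ ≡ true → f p ≡ f q → p ≡ q
      surjective : ∀ {u} → i ≤ u → u < m → mem u τ ≡ false → ∃ λ p → p < i × mem p τ ≡ true × f p ≡ u

  roots-cong : ∀ {i τ} {f g : ℕ → ℕ} → (∀ p → g p ≡ f p) → Roots i τ f → Roots i τ g
  roots-cong {τ = τ} e r = record
    { lower = λ {p} p<i p∈ → ≡.subst (_ ≤_) (≡.sym (e p)) (lower p<i p∈)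
    ; upper = λ {p} p<i p∈ → ≡.subst (_< m) (≡.sym (e p)) (upper p<i p∈)
    ; fresh = λ {p} p<i p∈ → ≡.trans (≡.cong (λ v → mem v τ) (e p)) (fresh p<i p∈)
    ; injective = λ {p} {q} p<i q<i p∈ q∈ gp≡gq → injective p<i q<i p∈ q∈ (≡.trans (≡.sym (e p)) (≡.trans gp≡gq (e q)))
    ; surjective = λ le lt u∉ → let p , p<i , p∈ , fp≡u = surjective le lt u∉ in p , p<i , p∈ , ≡.trans (e p) fp≡u }
    where open Roots r

  -- `root (suc i) τ i` is the start of the path that ends at `i`. If `i` does not occur in `τ`,
  -- that path is trivial and starts at `i`, which `ih` does not cover; the lemmas below treat both
  -- cases alike.
  module RootStep {i : ℕ} {τ : List ℕ} (i<m : i < m) (ih : Roots (suc i) τ (root (suc i) τ)) where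
    open Roots ih

    lower-i : i ≤ root (suc i) τ i
    lower-i with mem i τ in eq
    ... | true = ℕₚ.<⇒≤ (lower ℕₚ.≤-refl eq)
    ... | false = ℕₚ.≤-reflexive (≡.sym (root-outside (suc i) τ i ℕₚ.≤-refl eq))

    upper-i : root (suc i) τ i < m
    upper-i with mem i τ in eq
    ... | true = upper ℕₚ.≤-refl eq
    ... | false = ≡.subst (_< m) (≡.sym (root-outside (suc i) τ i ℕₚ.≤-refl eq)) i<m

    fresh-i : mem (root (suc i) τ i) τ ≡ false
    fresh-i with mem i τ in eq
    ... | true = fresh ℕₚ.≤-refl eq
    ... | false = ≡.trans (≡.cong (λ v → mem v τ) (root-outside (suc i) τ i ℕₚ.≤-refl eq)) eq

    apart : ∀ {q} → q < i → mem q τ ≡ true → root (suc i) τ i ≢ root (suc i) τ q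
    apart {q} q<i q∈ e with mem i τ in eq
    ... | true = ℕₚ.<⇒≢ q<i (≡.sym (injective ℕₚ.≤-refl (ℕₚ.m<n⇒m<1+n q<i) eq q∈ e))
    ... | false = ℕₚ.<⇒≢ (lower (ℕₚ.m<n⇒m<1+n q<i) q∈) (≡.trans (≡.sym (root-outside (suc i) τ i ℕₚ.≤-refl eq)) e)

    surjective-i : ∀ {u} → i ≤ u → u < m → mem u τ ≡ false →
      root (suc i) τ i ≡ u ⊎ ∃ λ p → p < i × mem p τ ≡ true × root (suc i) τ p ≡ u
    surjective-i {u} le lt u∉ with u ℕₚ.≟ i
    ... | yes ≡.refl = inj₁ (root-outside (suc i) τ i ℕₚ.≤-refl u∉)
    ... | no u≢i with surjective (ℕₚ.≤∧≢⇒< le (u≢i ∘ ≡.sym)) lt u∉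
    ...   | p , p<1+i , p∈ , e with p ℕₚ.≟ i
    ...     | yes ≡.refl = inj₁ e
    ...     | no p≢i = inj₂ (p , ℕₚ.≤∧≢⇒< (ℕ.≤-pred p<1+i) p≢i , p∈ , e)

  roots-step : ∀ {i a τ} → IsSuffix i (a ∷ τ) → Roots (suc i) τ (root (suc i) τ) →
    Tri (a < i) (a ≡ i) (i < a) → Roots i (a ∷ τ) (root i (a ∷ τ))
  roots-step {i} {a} {τ} s ih (tri< a<i _ _) = roots-cong (root-< τ a<i) record
    { lower = λ p<i p∈ → proj₁ (range p<i p∈)
    ; upper = λ p<i p∈ → proj₁ (proj₂ (range p<i p∈))
    ; fresh = λ p<i p∈ → proj₂ (proj₂ (range p<i p∈))
    ; injective = inj
    ; surjective = sur }
    where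
    open Roots ih
    open RootStep (suffix-< s) ih
    f : ℕ → ℕ
    f p = if p ≡ᵇ a then root (suc i) τ i else root (suc i) τ p
    range : ∀ {p} → p < i → mem p (a ∷ τ) ≡ true → i ≤ f p × f p < m × mem (f p) (a ∷ τ) ≡ false
    range {p} p<i p∈ with p ≡ᵇ a
    ... | true = lower-i , upper-i , ≡.trans (mem-≢ τ (λ e → ℕₚ.<⇒≱ a<i (≡.subst (i ≤_) e lower-i))) fresh-i
    ... | false = ℕₚ.<⇒≤ (lower (ℕₚ.m<n⇒m<1+n p<i) p∈) , upper (ℕₚ.m<n⇒m<1+n p<i) p∈ ,
      ≡.trans (mem-≢ τ (λ e → ℕₚ.<⇒≱ (ℕₚ.m<n⇒m<1+n a<i) (≡.subst (suc i ≤_) e (lower (ℕₚ.m<n⇒m<1+n p<i) p∈))))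
        (fresh (ℕₚ.m<n⇒m<1+n p<i) p∈)
    inj : ∀ {p q} → p < i → q < i → mem p (a ∷ τ) ≡ true → mem q (a ∷ τ) ≡ true → f p ≡ f q → p ≡ q
    inj {p} {q} p<i q<i p∈ q∈ e with p ≡ᵇ a in pa | q ≡ᵇ a in qa
    ... | true | true = ≡.trans (≡ᵇ-true pa) (≡.sym (≡ᵇ-true qa))
    ... | true | false = ⊥-elim (apart q<i q∈ e)
    ... | false | true = ⊥-elim (apart p<i p∈ (≡.sym e))
    ... | false | false = injective (ℕₚ.m<n⇒m<1+n p<i) (ℕₚ.m<n⇒m<1+n q<i) p∈ q∈ e
    sur : ∀ {u} → i ≤ u → u < m → mem u (a ∷ τ) ≡ false → ∃ λ p → p < i × mem p (a ∷ τ) ≡ true × f p ≡ u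
    sur {u} le lt u∉ with surjective-i le lt (proj₂ (∉-∷ {u} a τ u∉))
    ... | inj₁ e = a , a<i , mem-here a τ , ≡.trans (if-true (≡ᵇ-refl a)) e
    ... | inj₂ (p , p<i , p∈ , e) = p , p<i , mem-∷ {p} a τ p∈ ,
      ≡.trans (if-false (≡ᵇ-false (ends≢ {p} {a} {τ} p∈ (suffix-∉ s)))) e
  roots-step {i} {a} {τ} s ih (tri≈ _ ≡.refl _) = roots-cong (root-≡ i τ) record
    { lower = λ {p} p<i p∈ → ℕₚ.<⇒≤ (lower (ℕₚ.m<n⇒m<1+n p<i) (drop {p} p<i p∈))
    ; upper = λ {p} p<i p∈ → upper (ℕₚ.m<n⇒m<1+n p<i) (drop {p} p<i p∈)
    ; fresh = λ {p} p<i p∈ → ≡.trans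
        (mem-≢ τ (ℕₚ.<⇒≢ (lower (ℕₚ.m<n⇒m<1+n p<i) (drop {p} p<i p∈)) ∘ ≡.sym))
        (fresh (ℕₚ.m<n⇒m<1+n p<i) (drop {p} p<i p∈))
    ; injective = λ {p} {q} p<i q<i p∈ q∈ →
        injective (ℕₚ.m<n⇒m<1+n p<i) (ℕₚ.m<n⇒m<1+n q<i) (drop {p} p<i p∈) (drop {q} q<i q∈)
    ; surjective = sur }
    where
    open Roots ih
    open RootStep (suffix-< s) ih
    drop : ∀ {p} → p < i → mem p (i ∷ τ) ≡ true → mem p τ ≡ true
    drop p<i p∈ = ≡.trans (≡.sym (mem-≢ τ (ℕₚ.<⇒≢ p<i))) p∈
    sur : ∀ {u} → i ≤ u → u < m → mem u (i ∷ τ) ≡ false →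
      ∃ λ p → p < i × mem p (i ∷ τ) ≡ true × root (suc i) τ p ≡ u
    sur {u} le lt u∉ with ∉-∷ {u} i τ u∉
    ... | u≢i , u∉τ with surjective-i le lt u∉τ
    ...   | inj₁ e = ⊥-elim (u≢i (≡.trans (≡.sym e) (root-outside (suc i) τ i ℕₚ.≤-refl (suffix-∉ s))))
    ...   | inj₂ (p , p<i , p∈ , e) = p , p<i , mem-∷ {p} i τ p∈ , e
  roots-step {i} {a} {τ} s ih (tri> _ _ i<a) = roots-cong (root-> τ i<a) record
    { lower = λ p<i p∈ → proj₁ (range p<i p∈)
    ; upper = λ p<i p∈ → proj₁ (proj₂ (range p<i p∈))
    ; fresh = λ p<i p∈ → proj₂ (proj₂ (range p<i p∈))
    ; injective = inj
    ; surjective = sur }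
    where
    open Roots ih
    open RootStep (suffix-< s) ih
    f : ℕ → ℕ
    f p = if root (suc i) τ p ≡ᵇ a then root (suc i) τ i else root (suc i) τ p
    drop : ∀ {p} → p < i → mem p (a ∷ τ) ≡ true → mem p τ ≡ true
    drop p<i p∈ = ≡.trans (≡.sym (mem-≢ τ (ℕₚ.<⇒≢ (ℕₚ.<-trans p<i i<a)))) p∈
    range : ∀ {p} → p < i → mem p (a ∷ τ) ≡ true → i ≤ f p × f p < m × mem (f p) (a ∷ τ) ≡ false
    range {p} p<i p∈ with root (suc i) τ p ≡ᵇ a in eq
    ... | true = lower-i , upper-i , ≡.trans
      (mem-≢ τ (λ e → apart p<i (drop {p} p<i p∈) (≡.trans e (≡.sym (≡ᵇ-true eq))))) fresh-i
    ... | false = ℕₚ.<⇒≤ (lower (ℕₚ.m<n⇒m<1+n p<i) (drop {p} p<i p∈)) , upper (ℕₚ.m<n⇒m<1+n p<i) (drop {p} p<i p∈) ,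
      ≡.trans (mem-≢ τ (λ e → false≢true eq (≡.trans (≡.cong (_≡ᵇ a) e) (≡ᵇ-refl a))))
        (fresh (ℕₚ.m<n⇒m<1+n p<i) (drop {p} p<i p∈))
    inj : ∀ {p q} → p < i → q < i → mem p (a ∷ τ) ≡ true → mem q (a ∷ τ) ≡ true → f p ≡ f q → p ≡ q
    inj {p} {q} p<i q<i p∈ q∈ e with root (suc i) τ p ≡ᵇ a in pa | root (suc i) τ q ≡ᵇ a in qa
    ... | true | true = injective (ℕₚ.m<n⇒m<1+n p<i) (ℕₚ.m<n⇒m<1+n q<i) (drop {p} p<i p∈) (drop {q} q<i q∈)
      (≡.trans (≡ᵇ-true pa) (≡.sym (≡ᵇ-true qa)))
    ... | true | false = ⊥-elim (apart q<i (drop {q} q<i q∈) e)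
    ... | false | true = ⊥-elim (apart p<i (drop {p} p<i p∈) (≡.sym e))
    ... | false | false = injective (ℕₚ.m<n⇒m<1+n p<i) (ℕₚ.m<n⇒m<1+n q<i) (drop {p} p<i p∈) (drop {q} q<i q∈) e
    sur : ∀ {u} → i ≤ u → u < m → mem u (a ∷ τ) ≡ false → ∃ λ p → p < i × mem p (a ∷ τ) ≡ true × f p ≡ u
    sur {u} le lt u∉ with ∉-∷ {u} a τ u∉
    ... | u≢a , u∉τ with surjective-i le lt u∉τ
    ...   | inj₂ (p , p<i , p∈ , e) = p , p<i , mem-∷ {p} a τ p∈ ,
      ≡.trans (if-false (≡ᵇ-false (u≢a ∘ ≡.trans (≡.sym e)))) e
    -- The arc from `i` to `a` joins the path that starts at `u` and ends at `i` to the one that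
    -- started at `a`. So the end `p` of the latter is the preimage of `u`.
    ...   | inj₁ e with surjective-i (ℕₚ.<⇒≤ i<a) (All.head (IsSuffix.values s)) (suffix-∉ s)
    ...     | inj₁ e′ = ⊥-elim (u≢a (≡.trans (≡.sym e) e′))
    ...     | inj₂ (p , p<i , p∈ , e′) = p , p<i , mem-∷ {p} a τ p∈ ,
      ≡.trans (if-true (≡.trans (≡.cong (_≡ᵇ a) e′) (≡ᵇ-refl a))) e

  roots : ∀ i τ → IsSuffix i τ → Roots i τ (root i τ)
  roots i [] s = record
    { lower = λ _ () ; upper = λ _ () ; fresh = λ _ () ; injective = λ _ _ ()
    ; surjective = λ le lt _ → ⊥-elim (ℕₚ.<⇒≱ lt (≡.subst (_≤ _) (≡.trans (≡.sym (ℕₚ.+-identityʳ i)) (IsSuffix.bound s)) le)) }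
  roots i (a ∷ τ) s = roots-step s (roots (suc i) τ (suffix-tail s)) (ℕₚ.<-cmp a i)

-- The sum over restrictions

belowᵇ : ℕ → List ℕ → Bool
belowᵇ a [] = true
belowᵇ a (x ∷ τ) = (a <ᵇ x) ∧ belowᵇ a τ

below-true : ∀ {a} τ → belowᵇ a τ ≡ true → ∀ v → mem v τ ≡ true → a < v
below-true {a} (x ∷ τ) e v v∈ with ∧-split {a <ᵇ x} e | v ≡ᵇ x in eq
... | p , q | true = ≡.subst (a <_) (≡.sym (≡ᵇ-true eq)) (<ᵇ-true p)
... | p , q | false = below-true τ q v v∈

true-below : ∀ {a} τ → (∀ v → mem v τ ≡ true → a < v) → belowᵇ a τ ≡ true
true-below [] h = ≡.refl
true-below (x ∷ τ) h = ∧-join (true-<ᵇ (h x (mem-here x τ))) (true-below τ (λ v v∈ → h v (mem-∷ {v} x τ v∈)))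

leastᵇ : (ℕ → Bool) → ℕ → Bool
leastᵇ P a = agreeᵇ a P (λ _ → false)

card-mem : ∀ {m} τ → uniqueᵇ τ ≡ true → All (_< m) τ → card m (λ v → mem v τ) ≡ length τ
card-mem {m} [] u [] = card-false m (λ _ _ → ≡.refl)
card-mem {m} (a ∷ τ) u (a<m ∷ v) with unique-∷ a τ u
... | a∉τ , u′ = ≡.trans (card-cong m same)
  (≡.trans (card-insert m (λ v → mem v τ) a a<m a∉τ) (≡.cong suc (card-mem τ u′ v)))
  where
  same : ∀ v → v < m → mem v (a ∷ τ) ≡ upd (λ v → mem v τ) a true v
  same v _ with v ≡ᵇ a
  ... | true = ≡.refl
  ... | false = ≡.refl

-- The entries of `τ` below `a` lie below `i`, where `P` decides membership. Hence the antirecord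
-- status of a low value can be read off from `P` without knowing `τ`.
fits-least : ∀ i P a b τ → a < i → fitsᵇ (suc i) (upd (upd P a false) i b) τ ≡ true → belowᵇ a τ ≡ leastᵇ P a
fits-least i P a b τ a<i f = bool-ext to from
  where
  a∉τ : mem a τ ≡ false
  a∉τ = ≡.trans (fits-agree {suc i} τ f a (ℕₚ.m<n⇒m<1+n a<i))
    (≡.trans (upd-neq (upd P a false) i b (ℕₚ.<⇒≢ a<i)) (upd-eq P a false))
  agree : ∀ {v} → v < a → mem v τ ≡ P v
  agree {v} v<a = let v<i = ℕₚ.<-trans v<a a<i in ≡.trans (fits-agree {suc i} τ f v (ℕₚ.m<n⇒m<1+n v<i))
    (≡.trans (upd-neq (upd P a false) i b (ℕₚ.<⇒≢ v<i)) (upd-neq P a false (ℕₚ.<⇒≢ v<a)))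
  to : belowᵇ a τ ≡ true → leastᵇ P a ≡ true
  to e = true-agree a (λ v v<a → ≢true⇒false (λ Pv →
    ℕₚ.<-asym v<a (below-true τ e v (≡.trans (agree v<a) Pv))))
  from : leastᵇ P a ≡ true → belowᵇ a τ ≡ true
  from e = true-below τ λ v v∈ → case v v∈ (ℕₚ.<-cmp a v)
    where
    case : ∀ v → mem v τ ≡ true → Tri (a < v) (a ≡ v) (v < a) → a < v
    case v v∈ (tri< a<v _ _) = a<v
    case v v∈ (tri≈ _ ≡.refl _) = ⊥-elim (false≢true a∉τ v∈)
    case v v∈ (tri> _ _ v<a) = ⊥-elim (false≢true (≡.trans (agree v<a) (agree-true a e v v<a)) v∈)

-- A fixed point fails to be an antirecord exactly if some smaller value is left to the later
-- positions; this is what makes height 0 special.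
fits-empty : ∀ {m} i P τ → i < m → (∀ v → i ≤ v → P v ≡ false) → fitsᵇ (suc i) (upd P i false) τ ≡ true →
  belowᵇ i τ ≡ (card m P ≡ᵇ 0)
fits-empty {m} i P τ i<m P≥ f = bool-ext to from
  where
  agree : ∀ {v} → v < i → mem v τ ≡ P v
  agree {v} v<i = ≡.trans (fits-agree {suc i} τ f v (ℕₚ.m<n⇒m<1+n v<i)) (upd-neq P i false (ℕₚ.<⇒≢ v<i))
  to : belowᵇ i τ ≡ true → (card m P ≡ᵇ 0) ≡ true
  to e = ≡.cong (_≡ᵇ 0) (card-false m none)
    where
    none : ∀ v → v < m → P v ≡ false
    none v _ with v ℕₚ.<? i
    ... | yes v<i = ≢true⇒false (λ Pv → ℕₚ.<-asym v<i (below-true τ e v (≡.trans (agree v<i) Pv)))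
    ... | no v≮i = P≥ v (ℕₚ.≮⇒≥ v≮i)
  from : (card m P ≡ᵇ 0) ≡ true → belowᵇ i τ ≡ true
  from e = true-below τ λ v v∈ → case v v∈ (ℕₚ.<-cmp i v)
    where
    case : ∀ v → mem v τ ≡ true → Tri (i < v) (i ≡ v) (v < i) → i < v
    case v v∈ (tri< i<v _ _) = i<v
    case v v∈ (tri≈ _ ≡.refl _) =
      ⊥-elim (false≢true (≡.trans (fits-agree {suc i} τ f i ℕₚ.≤-refl) (upd-eq P i false)) v∈)
    case v v∈ (tri> _ _ v<i) =
      ⊥-elim (false≢true (≡.trans (agree v<i) (card-zero m (≡ᵇ-true e) v (ℕₚ.<-trans v<i i<m))) v∈)

-- Double counting: `τ` has as many entries as there are numbers from `i` to `m - 1`, so it misses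
-- as many of these as it uses of the smaller ones. The number of candidates for a high value thus
-- depends on `P` alone, although the candidates themselves depend on `τ`.
card-free : ∀ {m} i P τ → IsSuffix {m} i τ → (∀ v → i ≤ v → P v ≡ false) → fitsᵇ i P τ ≡ true →
  card m (freeᵇ i τ) ≡ card m P
card-free {m} i P τ s P≥ f = ℕₚ.+-cancelˡ-≡ (length τ) _ _ (begin
  length τ ℕ.+ card m (freeᵇ i τ)                    ≡⟨ ≡.cong (ℕ._+ card m (freeᵇ i τ)) (card-mem τ unique values) ⟨
  card m (λ v → mem v τ) ℕ.+ card m (freeᵇ i τ)      ≡⟨ card-+ m bits ⟩
  card m (λ v → i ≤ᵇ v) ℕ.+ card m P                 ≡⟨ ≡.cong (ℕ._+ card m P) later ⟩
  length τ ℕ.+ card m P                              ∎)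
  where
  open ≡.≡-Reasoning
  open IsSuffix s
  later : card m (λ v → i ≤ᵇ v) ≡ length τ
  later = ℕₚ.+-cancelʳ-≡ i _ _ (≡.trans (card-≥ m i (≡.subst (i ≤_) bound (ℕₚ.m≤m+n i _)))
    (≡.trans (≡.sym bound) (ℕₚ.+-comm i _)))
  bits : ∀ v → v < m → bit (mem v τ) ℕ.+ bit (freeᵇ i τ v) ≡ bit (i ≤ᵇ v) ℕ.+ bit (P v)
  bits v _ with i ℕₚ.≤? v
  ... | yes i≤v rewrite true-≤ᵇ i≤v | P≥ v i≤v with mem v τ
  ...   | true = ≡.refl
  ...   | false = ≡.refl
  bits v _ | no i≰v rewrite ≢true⇒false (i≰v ∘ ≤ᵇ-true) | fits-agree {i} τ f v (ℕₚ.≰⇒> i≰v) = ℕₚ.+-identityʳ _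

module _ (m : ℕ) where

  greatestᵇ : (ℕ → Bool) → ℕ → Bool
  greatestᵇ Q a = does (ℕₚ.allUpTo? (λ u → (Q u 𝔹ₚ.≟ true) →-dec (u ℕₚ.≤? a)) m)

  greatest-true : ∀ {Q a} → greatestᵇ Q a ≡ true → ∀ u → u < m → Q u ≡ true → u ≤ a
  greatest-true {Q} {a} e u lt q with ℕₚ.allUpTo? (λ u → (Q u 𝔹ₚ.≟ true) →-dec (u ℕₚ.≤? a)) m
  greatest-true e u lt q | yes p = p lt q

  true-greatest : ∀ {Q a} → (∀ u → u < m → Q u ≡ true → u ≤ a) → greatestᵇ Q a ≡ true
  true-greatest {Q} {a} h = dec-true (ℕₚ.allUpTo? (λ u → (Q u 𝔹ₚ.≟ true) →-dec (u ℕₚ.≤? a)) m) (λ {u} → h u)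

  greatest-mark : ∀ {Q l} → card m Q ≡ suc l →
    ∃ λ ρ → ρ < m × Q ρ ≡ true × (∀ a → a < m → Q a ≡ true → greatestᵇ Q a ≡ (a ≡ᵇ ρ))
  greatest-mark {Q} e with card-max m e
  ... | ρ , ρ<m , Qρ , max = ρ , ρ<m , Qρ , λ a a<m Qa → bool-ext
    (λ g → ≡.subst (λ b → (b ≡ᵇ ρ) ≡ true) (ℕₚ.≤-antisym (greatest-true g ρ ρ<m Qρ) (max a a<m Qa)) (≡ᵇ-refl ρ))
    (λ a≡ρ → true-greatest (λ u u<m Qu → ≡.subst (u ≤_) (≡.sym (≡ᵇ-true a≡ρ)) (max u u<m Qu)))

  least-mark : ∀ {Q l} → card m Q ≡ suc l →
    ∃ λ ρ → ρ < m × Q ρ ≡ true × (∀ a → a < m → Q a ≡ true → leastᵇ Q a ≡ (a ≡ᵇ ρ))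
  least-mark {Q} e with card-min m e
  ... | ρ , ρ<m , Qρ , min = ρ , ρ<m , Qρ , λ a a<m Qa → bool-ext
    (λ g → eq a Qa g (ℕₚ.<-cmp a ρ))
    (λ a≡ρ → true-agree a (λ u u<a → min u (≡.subst (u <_) (≡ᵇ-true a≡ρ) u<a)))
    where
    eq : ∀ a → Q a ≡ true → leastᵇ Q a ≡ true → Tri (a < ρ) (a ≡ ρ) (ρ < a) → (a ≡ᵇ ρ) ≡ true
    eq a Qa g (tri< a<ρ _ _) = ⊥-elim (false≢true (min a a<ρ) Qa)
    eq a Qa g (tri≈ _ ≡.refl _) = ≡ᵇ-refl a
    eq a Qa g (tri> _ _ ρ<a) = ⊥-elim (false≢true (agree-true a g ρ ρ<a) Qρ)

-- Summation over the restrictions, one position at a time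

module SuffixSums {c ℓ : Level} (R : CommutativeSemiring c ℓ) where
  open CommutativeSemiring R hiding (zero)
  open import Relation.Binary.Reasoning.Setoid setoid
  open import Algebra.Solver.Ring.NaturalCoefficients.Default R using (solve; _:=_; _:+_; _:*_)
  open FiniteSums R
  open MotzkinPaths R

  -- The flag is the record or antirecord status. `valley` carries none: the record and the
  -- cycle-closing candidate may or may not coincide, so a joint weight would not sum to a function
  -- of the height. `cycle` is the extra factor of the closing candidate.
  record LocalWeights : Set c where
    field
      peak fall rise fixed : ℕ → Bool → Carrier
      valley : ℕ → Carrier
      cycle : Carrier

  module _ (w : LocalWeights) where
    open LocalWeights w

    steps : Steps
    steps = record
      { up = λ i k → valley i * (cycle + nat R k)
      ; level = λ i k → fixed i (k ≡ᵇ 0) + (pick (fall i) k + pick (rise i) k)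
      ; down = λ i → pick (peak i) }

    module _ (m : ℕ) where

      local : ℕ → ℕ → List ℕ → Carrier
      local i a τ with ℕₚ.<-cmp a i
      ... | tri< _ _ _ = if mem i τ then fall i (belowᵇ a τ) else peak i (belowᵇ a τ)
      ... | tri≈ _ _ _ = fixed i (belowᵇ i τ)
      ... | tri> _ _ _ = if mem i τ
        then valley i * (if a ≡ᵇ root (suc i) τ i then cycle else 1#)
        else rise i (greatestᵇ m (freeᵇ (suc i) τ) a)

      local-< : ∀ {i a} τ → a < i → local i a τ ≡ (if mem i τ then fall i (belowᵇ a τ) else peak i (belowᵇ a τ))
      local-< {i} {a} τ a<i with ℕₚ.<-cmp a i
      ... | tri< _ _ _ = ≡.refl
      ... | tri≈ ¬a<i _ _ = ⊥-elim (¬a<i a<i)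
      ... | tri> ¬a<i _ _ = ⊥-elim (¬a<i a<i)

      local-≡ : ∀ i τ → local i i τ ≡ fixed i (belowᵇ i τ)
      local-≡ i τ with ℕₚ.<-cmp i i
      ... | tri< _ i≢i _ = ⊥-elim (i≢i ≡.refl)
      ... | tri≈ _ _ _ = ≡.refl
      ... | tri> _ i≢i _ = ⊥-elim (i≢i ≡.refl)

      local-> : ∀ {i a} τ → i < a → local i a τ ≡
        (if mem i τ then valley i * (if a ≡ᵇ root (suc i) τ i then cycle else 1#)
          else rise i (greatestᵇ m (freeᵇ (suc i) τ) a))
      local-> {i} {a} τ i<a with ℕₚ.<-cmp a i
      ... | tri< _ _ ¬i<a = ⊥-elim (¬i<a i<a)
      ... | tri≈ _ _ ¬i<a = ⊥-elim (¬i<a i<a)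
      ... | tri> _ _ _ = ≡.refl

      total : ℕ → List ℕ → Carrier
      total i [] = 1#
      total i (a ∷ τ) = local i a τ * total (suc i) τ

      module _ (i : ℕ) (P : ℕ → Bool) (i<m : i < m) (P≥ : ∀ v → i ≤ v → P v ≡ false) where

        -- `b` prescribes whether `i` is a value at a later position. For each `τ` the wrong `b`
        -- contributes zero, so adding the terms for both values of `b` separates the cycle types
        -- without a case distinction on `τ`, and the sum over `τ` of each term falls under the
        -- induction.
        G : (ℕ → Bool) → Bool → List ℕ → Carrier
        G Q b τ = ι (fitsᵇ (suc i) (upd Q i b) τ) (total (suc i) τ)

        G-wrong : ∀ Q b τ → mem i τ ≢ b → G Q b τ ≈ 0#
        G-wrong Q b τ ne = ι-false (fits-wrong i Q b τ ne)

        pull : ∀ b {x y z} → (b ≡ true → x ≈ y) → ι b (x * z) ≈ y * ι b z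
        pull b h = trans (ι-cong b (λ e → *-congʳ (h e))) (*-ι-comm b _ _)

        fixedTerm lowTerm highTerm : ℕ → List ℕ → Carrier
        fixedTerm a τ = ι (a ≡ᵇ i) (fixed i (card m P ≡ᵇ 0) * G P false τ)
        lowTerm a τ = ι (P a) (peak i (leastᵇ P a) * G (upd P a false) false τ
                             + fall i (leastᵇ P a) * G (upd P a false) true τ)
        highTerm a τ =
          ι (freeᵇ (suc i) τ a) (rise i (greatestᵇ m (freeᵇ (suc i) τ) a)) * G P false τ
          + ι (freeᵇ (suc i) τ a) (valley i * (if a ≡ᵇ root (suc i) τ i then cycle else 1#)) * G P true τ

        highTerm-zero : ∀ a τ → freeᵇ (suc i) τ a ≡ false → highTerm a τ ≈ 0#
        highTerm-zero a τ e = trans (+-cong (trans (*-congʳ (ι-false e)) (zeroˡ _)) (trans (*-congʳ (ι-false e)) (zeroˡ _)))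
          (+-identityˡ _)

        not-free : ∀ {a} τ → a ≤ i → freeᵇ (suc i) τ a ≡ false
        not-free {a} τ a≤i = ≢true⇒false (λ e → ℕₚ.<⇒≱ (proj₁ (free-split {suc i} τ {a} e)) a≤i)

        summand : ℕ → List ℕ → Carrier
        summand a τ = ι (fitsᵇ i P (a ∷ τ)) (total i (a ∷ τ))

        summand-low : ∀ a τ → a < i → summand a τ ≈ lowTerm a τ
        summand-low a τ a<i with P a in Pa
        ... | false = ι-false (fits-absent i P a τ a<i Pa)
        ... | true = trans (trans (reflexive (≡.cong (λ b → ι b (total i (a ∷ τ))) fits-eq))
                                  (ι-cong fit (λ _ → *-congʳ (reflexive (local-< τ a<i)))))
                           (byType (mem i τ) ≡.refl)
          where
          Q : ℕ → Bool
          Q = upd P a false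
          fit : Bool
          fit = fitsᵇ (suc i) (upd Q i (mem i τ)) τ
          a∉ : fit ≡ true → mem a τ ≡ false
          a∉ f = ≡.trans (fits-agree {suc i} τ f a (ℕₚ.m<n⇒m<1+n a<i))
            (≡.trans (upd-neq Q i _ (ℕₚ.<⇒≢ a<i)) (upd-eq P a false))
          fits-eq : fitsᵇ i P (a ∷ τ) ≡ fit
          fits-eq = ≡.trans
            (fits-tail i P Q a τ (λ v _ v≢a → upd-neq P a false v≢a) (λ _ → Pa , upd-eq P a false))
            (bool-ext (λ e → proj₂ (∧-split {not (mem a τ)} e)) (λ e → ∧-join (true-not (a∉ e)) e))
          byType : ∀ b → mem i τ ≡ b →
            ι (fitsᵇ (suc i) (upd Q i b) τ)
              ((if b then fall i (belowᵇ a τ) else peak i (belowᵇ a τ)) * total (suc i) τ)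
            ≈ peak i (leastᵇ P a) * G Q false τ + fall i (leastᵇ P a) * G Q true τ
          byType true e = begin
            ι (fitsᵇ (suc i) (upd Q i true) τ) (fall i (belowᵇ a τ) * total (suc i) τ)
              ≈⟨ pull _ (λ f → reflexive (≡.cong (fall i) (fits-least i P a true τ a<i f))) ⟩
            fall i (leastᵇ P a) * G Q true τ        ≈⟨ +-identityˡ _ ⟨
            0# + fall i (leastᵇ P a) * G Q true τ
              ≈⟨ +-congʳ (trans (*-congˡ (G-wrong Q false τ (λ e′ → false≢true e′ e))) (zeroʳ _)) ⟨
            peak i (leastᵇ P a) * G Q false τ + fall i (leastᵇ P a) * G Q true τ ∎
          byType false e = begin
            ι (fitsᵇ (suc i) (upd Q i false) τ) (peak i (belowᵇ a τ) * total (suc i) τ)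
              ≈⟨ pull _ (λ f → reflexive (≡.cong (peak i) (fits-least i P a false τ a<i f))) ⟩
            peak i (leastᵇ P a) * G Q false τ       ≈⟨ +-identityʳ _ ⟨
            peak i (leastᵇ P a) * G Q false τ + 0#
              ≈⟨ +-congˡ (trans (*-congˡ (G-wrong Q true τ (false≢true e))) (zeroʳ _)) ⟨
            peak i (leastᵇ P a) * G Q false τ + fall i (leastᵇ P a) * G Q true τ ∎

        fits-later : ∀ a τ → i ≤ a → fitsᵇ i P (a ∷ τ) ≡ not (mem a τ) ∧ fitsᵇ (suc i) (upd P i (mem i τ)) τ
        fits-later a τ i≤a = fits-tail i P P a τ (λ _ _ _ → ≡.refl) (λ a<i → ⊥-elim (ℕₚ.<⇒≱ a<i i≤a))

        summand-fixed : ∀ τ → summand i τ ≈ fixed i (card m P ≡ᵇ 0) * G P false τ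
        summand-fixed τ = byType (mem i τ) ≡.refl (fits-later i τ ℕₚ.≤-refl)
          where
          byType : ∀ b → mem i τ ≡ b → fitsᵇ i P (i ∷ τ) ≡ not b ∧ fitsᵇ (suc i) (upd P i b) τ →
            summand i τ ≈ fixed i (card m P ≡ᵇ 0) * G P false τ
          byType true e fe = trans (ι-false fe)
            (sym (trans (*-congˡ (G-wrong P false τ (λ e′ → false≢true e′ e))) (zeroʳ _)))
          byType false e fe = begin
            ι (fitsᵇ i P (i ∷ τ)) (local i i τ * total (suc i) τ)
              ≈⟨ reflexive (≡.cong (λ b → ι b (local i i τ * total (suc i) τ)) fe) ⟩
            ι (fitsᵇ (suc i) (upd P i false) τ) (local i i τ * total (suc i) τ)
              ≈⟨ pull _ (λ f → reflexive (≡.trans (local-≡ i τ) (≡.cong (fixed i) (fits-empty i P τ i<m P≥ f)))) ⟩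
            fixed i (card m P ≡ᵇ 0) * G P false τ ∎

        summand-high : ∀ a τ → i < a → summand a τ ≈ highTerm a τ
        summand-high a τ i<a = byMem (mem a τ) ≡.refl (fits-later a τ (ℕₚ.<⇒≤ i<a))
          where
          fit : Bool
          fit = fitsᵇ (suc i) (upd P i (mem i τ)) τ
          r v : Carrier
          r = rise i (greatestᵇ m (freeᵇ (suc i) τ) a)
          v = valley i * (if a ≡ᵇ root (suc i) τ i then cycle else 1#)
          byType : ∀ b → mem i τ ≡ b →
            ι (fitsᵇ (suc i) (upd P i b) τ) ((if b then v else r) * total (suc i) τ)
            ≈ r * G P false τ + v * G P true τ
          byType true e = begin
            ι (fitsᵇ (suc i) (upd P i true) τ) (v * total (suc i) τ)  ≈⟨ *-ι-comm (fitsᵇ (suc i) (upd P i true) τ) v _ ⟩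
            v * G P true τ                        ≈⟨ +-identityˡ _ ⟨
            0# + v * G P true τ                   ≈⟨ +-congʳ (trans (*-congˡ (G-wrong P false τ (λ e′ → false≢true e′ e))) (zeroʳ _)) ⟨
            r * G P false τ + v * G P true τ      ∎
          byType false e = begin
            ι (fitsᵇ (suc i) (upd P i false) τ) (r * total (suc i) τ) ≈⟨ *-ι-comm (fitsᵇ (suc i) (upd P i false) τ) r _ ⟩
            r * G P false τ                       ≈⟨ +-identityʳ _ ⟨
            r * G P false τ + 0#                  ≈⟨ +-congˡ (trans (*-congˡ (G-wrong P true τ (false≢true e))) (zeroʳ _)) ⟨
            r * G P false τ + v * G P true τ      ∎
          byMem : ∀ b → mem a τ ≡ b → fitsᵇ i P (a ∷ τ) ≡ not b ∧ fit → summand a τ ≈ highTerm a τ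
          byMem true a∈ fe = trans (ι-false fe)
            (sym (highTerm-zero a τ (≢true⇒false (λ e → false≢true (proj₂ (free-split {suc i} τ {a} e)) a∈))))
          byMem false a∉ fe = trans
            (trans (reflexive (≡.cong (λ b → ι b (total i (a ∷ τ))) fe))
                   (ι-cong fit (λ _ → *-congʳ (reflexive (local-> τ i<a)))))
            (trans (byType (mem i τ) ≡.refl)
              (sym (+-cong (*-congʳ (ι-true free)) (*-congʳ (ι-true free)))))
            where
            free : freeᵇ (suc i) τ a ≡ true
            free = free-join {suc i} τ {a} i<a a∉

        summand-split : ∀ a τ → summand a τ ≈ fixedTerm a τ + (lowTerm a τ + highTerm a τ)
        summand-split a τ = cases (ℕₚ.<-cmp a i)
          where
          cases : Tri (a < i) (a ≡ i) (i < a) → summand a τ ≈ fixedTerm a τ + (lowTerm a τ + highTerm a τ)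
          cases (tri< a<i a≢i _) = trans (summand-low a τ a<i) (sym (trans
            (+-cong (ι-false (≡ᵇ-false a≢i)) (+-congˡ (highTerm-zero a τ (not-free τ (ℕₚ.<⇒≤ a<i)))))
            (trans (+-identityˡ _) (+-identityʳ _))))
          cases (tri≈ _ ≡.refl _) = trans (summand-fixed τ) (sym (trans
            (+-cong (ι-true (≡ᵇ-refl a)) (+-cong (ι-false (P≥ a ℕₚ.≤-refl)) (highTerm-zero a τ (not-free τ ℕₚ.≤-refl))))
            (trans (+-congˡ (+-identityˡ _)) (+-identityʳ _))))
          cases (tri> _ a≢i i<a) = trans (summand-high a τ i<a) (sym (trans
            (+-cong (ι-false (≡ᵇ-false a≢i)) (+-congʳ (ι-false (P≥ a (ℕₚ.<⇒≤ i<a)))))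
            (trans (+-identityˡ _) (+-identityˡ _))))

      -- The candidates for a high value vary with `τ`, so the sum over the value is carried out for
      -- fixed `τ`; only their number enters the result. If `τ` repeats an entry, both `G` vanish.
      ∑-highTerm : ∀ i P i<m P≥ τ → IsSuffix {m} (suc i) τ ⊎ uniqueᵇ τ ≡ false →
        ∑ m (λ a → highTerm i P i<m P≥ a τ)
        ≈ pick (rise i) (card m P) * G i P i<m P≥ P false τ
          + valley i * (cycle + nat R (card m P)) * G i P i<m P≥ P true τ
      ∑-highTerm i P i<m P≥ τ s = trans (∑-+ m _ _) (+-cong
        (trans (∑-*ʳ m _ _) (under false rises))
        (trans (∑-*ʳ m _ _) (under true valleys)))
        where
        Pₛ : Bool → ℕ → Bool
        Pₛ = upd P i
        fit : Bool → Bool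
        fit b = fitsᵇ (suc i) (Pₛ b) τ
        under : ∀ b {x y} → (IsSuffix (suc i) τ → fit b ≡ true → x ≈ y) → x * G i P i<m P≥ P b τ ≈ y * G i P i<m P≥ P b τ
        under b {x} {y} h = case (fit b) ≡.refl s
          where
          case : ∀ c → fit b ≡ c → IsSuffix (suc i) τ ⊎ uniqueᵇ τ ≡ false →
            x * ι c (total (suc i) τ) ≈ y * ι c (total (suc i) τ)
          case false f _ = trans (zeroʳ _) (sym (zeroʳ _))
          case true f (inj₁ s) = *-congʳ (h s f)
          case true f (inj₂ nu) = ⊥-elim (false≢true nu (fits-unique {suc i} τ f))
        Pₛ≥ : ∀ b v → suc i ≤ v → Pₛ b v ≡ false
        Pₛ≥ b v lt = ≡.trans (upd-neq P i b (ℕₚ.<⇒≢ lt ∘ ≡.sym)) (P≥ v (ℕₚ.<⇒≤ lt))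
        rises : IsSuffix (suc i) τ → fit false ≡ true →
          ∑ m (λ a → ι (freeᵇ (suc i) τ a) (rise i (greatestᵇ m (freeᵇ (suc i) τ) a))) ≈ pick (rise i) (card m P)
        rises s f = ∑-pick m (freeᵇ (suc i) τ) (rise i) (greatestᵇ m (freeᵇ (suc i) τ))
          (≡.trans (card-free (suc i) (Pₛ false) τ s (Pₛ≥ false) f) (card-cong m same)) (greatest-mark m)
          where
          same : ∀ v → v < m → Pₛ false v ≡ P v
          same v _ with v ≡ᵇ i in e
          ... | true = ≡.sym (P≥ v (ℕₚ.≤-reflexive (≡.sym (≡ᵇ-true e))))
          ... | false = ≡.refl
        valleys : IsSuffix (suc i) τ → fit true ≡ true →
          ∑ m (λ a → ι (freeᵇ (suc i) τ a) (valley i * (if a ≡ᵇ root (suc i) τ i then cycle else 1#)))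
          ≈ valley i * (cycle + nat R (card m P))
        valleys s f = begin
          ∑ m (λ a → ι (Q a) (valley i * (if a ≡ᵇ ρ then cycle else 1#)))
            ≈⟨ ∑-cong m (λ a _ → *-ι-comm (Q a) (valley i) _) ⟩
          ∑ m (λ a → valley i * ι (Q a) (if a ≡ᵇ ρ then cycle else 1#))
            ≈⟨ ∑-*ˡ m (valley i) _ ⟩
          valley i * ∑ m (λ a → ι (Q a) (if a ≡ᵇ ρ then cycle else 1#))
            ≈⟨ *-congˡ (∑-mark m Q ρ cycle 1# (upper ℕₚ.≤-refl i∈) (free-join {suc i} τ (lower ℕₚ.≤-refl i∈) (fresh ℕₚ.≤-refl i∈))) ⟩
          valley i * (cycle + nat R (pred (card m Q)) * 1#)
            ≈⟨ *-congˡ (+-congˡ (*-identityʳ _)) ⟩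
          valley i * (cycle + nat R (pred (card m Q)))
            ≈⟨ reflexive (≡.cong (λ k → valley i * (cycle + nat R (pred k))) cardQ) ⟩
          valley i * (cycle + nat R (card m P)) ∎
          where
          Q : ℕ → Bool
          Q = freeᵇ (suc i) τ
          ρ : ℕ
          ρ = root (suc i) τ i
          i∈ : mem i τ ≡ true
          i∈ = ≡.trans (fits-agree {suc i} τ f i ℕₚ.≤-refl) (upd-eq P i true)
          open Roots (roots (suc i) τ s)
          cardQ : card m Q ≡ suc (card m P)
          cardQ = ≡.trans (card-free (suc i) (Pₛ true) τ s (Pₛ≥ true) f) (card-insert m P i i<m (P≥ i ℕₚ.≤-refl))

      -- The induction is over all `P` at once, since the tail is summed against `P` with `i`
      -- inserted or a value removed; only the cardinality remains in the result.
      ∑ₗ-total : ∀ r i P → i ℕ.+ r ≡ m → (∀ v → i ≤ v → P v ≡ false) →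
        ∑ₗ m r (λ τ → ι (fitsᵇ i P τ) (total i τ)) ≈ paths steps r i (card m P)
      -- No position is left, so `τ` is empty and fits only an empty `P`: a path must end at height
      -- 0.
      ∑ₗ-total zero i P i+0≡m P≥ with card m P in e
      ... | zero = ι-true (true-agree i (λ v v<i → ≡.sym (card-zero m e v
              (≡.subst (v <_) (≡.trans (≡.sym (ℕₚ.+-identityʳ i)) i+0≡m) v<i))))
      ... | suc k = ι-false (≢true⇒false (λ f → let v , v<m , Pv = card-pos m e in
              false≢true (≡.sym (agree-true i f v (≡.subst (v <_) (≡.sym (≡.trans (≡.sym (ℕₚ.+-identityʳ i)) i+0≡m)) v<m))) Pv))
      ∑ₗ-total (suc r) i P i+r≡m P≥ = begin
        ∑ m (λ a → ∑ₗ m r (summand i P i<m P≥ a))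
          ≈⟨ ∑-cong m (λ a _ → trans (∑ₗ-cong m r (λ τ _ _ → summand-split i P i<m P≥ a τ))
               (trans (∑ₗ-+ m r _ _) (+-congˡ (∑ₗ-+ m r _ _)))) ⟩
        ∑ m (λ a → ∑ₗ m r (Fx a) + (∑ₗ m r (Lo a) + ∑ₗ m r (Hi a)))
          ≈⟨ trans (∑-+ m _ _) (+-congˡ (∑-+ m _ _)) ⟩
        ∑ m (λ a → ∑ₗ m r (Fx a)) + (∑ m (λ a → ∑ₗ m r (Lo a)) + ∑ m (λ a → ∑ₗ m r (Hi a)))
          ≈⟨ +-cong fixeds (+-cong lows highs) ⟩
        fixed i (k ≡ᵇ 0) * T k + (pick (peak i) k * T (pred k) + pick (fall i) k * T k
          + (pick (rise i) k * T k + valley i * (cycle + nat R k) * T (suc k)))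
          ≈⟨ solve 8 (λ f p l s v t t⁻ t⁺ → f :* t :+ (p :* t⁻ :+ l :* t :+ (s :* t :+ v :* t⁺))
                := (f :+ (l :+ s)) :* t :+ v :* t⁺ :+ p :* t⁻)
              refl (fixed i (k ≡ᵇ 0)) (pick (peak i) k) (pick (fall i) k) (pick (rise i) k)
              (valley i * (cycle + nat R k)) (T k) (T (pred k)) (T (suc k)) ⟩
        paths steps (suc r) i k ∎
        where
        k : ℕ
        k = card m P
        T : ℕ → Carrier
        T = paths steps r (suc i)
        1+i+r≡m : suc i ℕ.+ r ≡ m
        1+i+r≡m = ≡.trans (≡.sym (ℕₚ.+-suc i r)) i+r≡m
        i<m : i < m
        i<m = ≡.subst (suc i ≤_) 1+i+r≡m (ℕₚ.m≤m+n (suc i) r)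
        Fx Lo Hi : ℕ → List ℕ → Carrier
        Fx = fixedTerm i P i<m P≥
        Lo = lowTerm i P i<m P≥
        Hi = highTerm i P i<m P≥
        rest : ∀ Q b {l} → (∀ v → i < v → Q v ≡ false) → card m (upd Q i b) ≡ l →
          ∑ₗ m r (G i P i<m P≥ Q b) ≈ T l
        rest Q b Q> e = trans
          (∑ₗ-total r (suc i) (upd Q i b) 1+i+r≡m
            (λ v lt → ≡.trans (upd-neq Q i b (ℕₚ.<⇒≢ lt ∘ ≡.sym)) (Q> v lt)))
          (reflexive (≡.cong T e))
        P> : ∀ v → i < v → P v ≡ false
        P> v lt = P≥ v (ℕₚ.<⇒≤ lt)
        upd-same : ∀ Q → Q i ≡ false → card m (upd Q i false) ≡ card m Q
        upd-same Q e = card-cong m same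
          where
          same : ∀ v → v < m → upd Q i false v ≡ Q v
          same v _ with v ≡ᵇ i in eq
          ... | true = ≡.sym (≡.trans (≡.cong Q (≡ᵇ-true eq)) e)
          ... | false = ≡.refl
        fixeds : ∑ m (λ a → ∑ₗ m r (Fx a)) ≈ fixed i (k ≡ᵇ 0) * T k
        fixeds = begin
          ∑ m (λ a → ∑ₗ m r (Fx a))
            ≈⟨ ∑-cong m (λ a _ → ∑ₗ-ι m r (a ≡ᵇ i) _) ⟩
          ∑ m (λ a → ι (a ≡ᵇ i) (∑ₗ m r (λ τ → fixed i (k ≡ᵇ 0) * G i P i<m P≥ P false τ)))
            ≈⟨ ∑-point m i (λ _ → ∑ₗ m r (λ τ → fixed i (k ≡ᵇ 0) * G i P i<m P≥ P false τ)) i<m ⟩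
          ∑ₗ m r (λ τ → fixed i (k ≡ᵇ 0) * G i P i<m P≥ P false τ)
            ≈⟨ trans (∑ₗ-*ˡ m r _ _) (*-congˡ (rest P false P> (upd-same P (P≥ i ℕₚ.≤-refl)))) ⟩
          fixed i (k ≡ᵇ 0) * T k ∎
        lows : ∑ m (λ a → ∑ₗ m r (Lo a)) ≈ pick (peak i) k * T (pred k) + pick (fall i) k * T k
        lows = begin
          ∑ m (λ a → ∑ₗ m r (Lo a))
            -- For a low value the candidates are the elements of `P`, whatever `τ` is, so here `τ`
            -- can be summed out first.
            ≈⟨ ∑-cong m (λ a a<m → trans (∑ₗ-ι m r (P a) _) (ι-cong (P a) (λ Pa →
                 trans (∑ₗ-+ m r _ _) (+-cong
                   (trans (∑ₗ-*ˡ m r _ _) (*-congˡ (rest (upd P a false) false (Q> a) (cardF a a<m Pa))))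
                   (trans (∑ₗ-*ˡ m r _ _) (*-congˡ (rest (upd P a false) true (Q> a) (cardT a a<m Pa)))))))) ⟩
          ∑ m (λ a → ι (P a) (peak i (leastᵇ P a) * T (pred k) + fall i (leastᵇ P a) * T k))
            ≈⟨ ∑-cong m (λ a _ → trans (ι-+ (P a) _ _) (+-cong (ι-*-comm (P a) _ _) (ι-*-comm (P a) _ _))) ⟩
          ∑ m (λ a → ι (P a) (peak i (leastᵇ P a)) * T (pred k) + ι (P a) (fall i (leastᵇ P a)) * T k)
            ≈⟨ trans (∑-+ m _ _) (+-cong (∑-*ʳ m _ _) (∑-*ʳ m _ _)) ⟩
          ∑ m (λ a → ι (P a) (peak i (leastᵇ P a))) * T (pred k) + ∑ m (λ a → ι (P a) (fall i (leastᵇ P a))) * T k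
            ≈⟨ +-cong (*-congʳ (∑-pick m P (peak i) (leastᵇ P) ≡.refl (least-mark m)))
                      (*-congʳ (∑-pick m P (fall i) (leastᵇ P) ≡.refl (least-mark m))) ⟩
          pick (peak i) k * T (pred k) + pick (fall i) k * T k ∎
          where
          Q≥ : ∀ a v → i ≤ v → upd P a false v ≡ false
          Q≥ a v le with v ≡ᵇ a
          ... | true = ≡.refl
          ... | false = P≥ v le
          Q> : ∀ a v → i < v → upd P a false v ≡ false
          Q> a v lt = Q≥ a v (ℕₚ.<⇒≤ lt)
          cardF : ∀ a → a < m → P a ≡ true → card m (upd (upd P a false) i false) ≡ pred k
          cardF a a<m Pa = ≡.trans (upd-same (upd P a false) (Q≥ a i ℕₚ.≤-refl))
            (≡.cong pred (≡.sym (card-remove m P a a<m Pa)))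
          cardT : ∀ a → a < m → P a ≡ true → card m (upd (upd P a false) i true) ≡ k
          cardT a a<m Pa = ≡.trans (card-insert m (upd P a false) i i<m (Q≥ a i ℕₚ.≤-refl))
            (≡.sym (card-remove m P a a<m Pa))
        highs : ∑ m (λ a → ∑ₗ m r (Hi a)) ≈ pick (rise i) k * T k + valley i * (cycle + nat R k) * T (suc k)
        highs = begin
          ∑ m (λ a → ∑ₗ m r (Hi a))
            ≈⟨ ∑ₗ-∑ m r m Hi ⟩
          ∑ₗ m r (λ τ → ∑ m (λ a → Hi a τ))
            ≈⟨ ∑ₗ-cong m r (λ τ len vals → ∑-highTerm i P i<m P≥ τ (suffix? τ len vals)) ⟩
          ∑ₗ m r (λ τ → pick (rise i) k * G i P i<m P≥ P false τ
            + valley i * (cycle + nat R k) * G i P i<m P≥ P true τ)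
            ≈⟨ trans (∑ₗ-+ m r _ _) (+-cong
                 (trans (∑ₗ-*ˡ m r _ _) (*-congˡ (rest P false P> (upd-same P (P≥ i ℕₚ.≤-refl)))))
                 (trans (∑ₗ-*ˡ m r _ _) (*-congˡ (rest P true P> (card-insert m P i i<m (P≥ i ℕₚ.≤-refl)))))) ⟩
          pick (rise i) k * T k + valley i * (cycle + nat R k) * T (suc k) ∎
          where
          suffix? : ∀ τ → length τ ≡ r → All (_< m) τ → IsSuffix (suc i) τ ⊎ uniqueᵇ τ ≡ false
          suffix? τ len vals with uniqueᵇ τ in u
          ... | true = inj₁ (isSuffix (≡.trans (≡.cong (suc i ℕ.+_) len) 1+i+r≡m) vals u)
          ... | false = inj₂ ≡.refl

-- Permutations of Fin m

all-∈ : ∀ {a} {A : Set a} (p : A → Bool) {xs x} → all p xs ≡ true → x ∈ xs → p x ≡ true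
all-∈ p e (here ≡.refl) = proj₁ (∧-split e)
all-∈ p {y ∷ ys} e (there x∈) = all-∈ p (proj₂ (∧-split {p y} e)) x∈

∈-all : ∀ {a} {A : Set a} (p : A → Bool) xs → (∀ x → x ∈ xs → p x ≡ true) → all p xs ≡ true
∈-all p [] h = ≡.refl
∈-all p (x ∷ xs) h = ∧-join (h x (here ≡.refl)) (∈-all p xs (λ y y∈ → h y (there y∈)))

∨-elim : ∀ {b c} → not b ∨ c ≡ true → b ≡ true → c ≡ true
∨-elim e ≡.refl = e

∨-intro : ∀ {b c} → (b ≡ true → c ≡ true) → not b ∨ c ≡ true
∨-intro {false} h = ≡.refl
∨-intro {true} h = h ≡.refl

module _ {m : ℕ} where

  rec-true : ∀ (f : Fin m → Fin m) {x} → recᵇ f x ≡ true → ∀ j → toℕ j < toℕ x → toℕ (f j) < toℕ (f x)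
  rec-true f e j lt = <ᵇ-true (∨-elim (all-∈ _ e (∈-allFin j)) (true-<ᵇ lt))

  true-rec : ∀ (f : Fin m → Fin m) {x} → (∀ j → toℕ j < toℕ x → toℕ (f j) < toℕ (f x)) → recᵇ f x ≡ true
  true-rec f h = ∈-all _ (allFin m) (λ j _ → ∨-intro (λ lt → true-<ᵇ (h j (<ᵇ-true lt))))

  arec-true : ∀ (f : Fin m → Fin m) {x} → arecᵇ f x ≡ true → ∀ j → toℕ x < toℕ j → toℕ (f x) < toℕ (f j)
  arec-true f e j lt = <ᵇ-true (∨-elim (all-∈ _ e (∈-allFin j)) (true-<ᵇ lt))

  true-arec : ∀ (f : Fin m → Fin m) {x} → (∀ j → toℕ x < toℕ j → toℕ (f x) < toℕ (f j)) → arecᵇ f x ≡ true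
  true-arec f h = ∈-all _ (allFin m) (λ j _ → ∨-intro (λ lt → true-<ᵇ (h j (<ᵇ-true lt))))

  record Inverses (f g : Fin m → Fin m) : Set where
    field
      right : ∀ i → f (g i) ≡ i
      left : ∀ i → g (f i) ≡ i

  swap-inverses : ∀ {f g} → Inverses f g → Inverses g f
  swap-inverses v = record { right = Inverses.left v ; left = Inverses.right v }

  inverses-injective : ∀ {f g} → Inverses f g → ∀ {i j} → f i ≡ f j → i ≡ j
  inverses-injective {f} {g} v {i} {j} e =
    ≡.trans (≡.sym (Inverses.left v i)) (≡.trans (≡.cong g e) (Inverses.left v j))

  -- `inv` returns its default `i` only if the search fails, which the preimage `j` rules out.
  inv-hits : ∀ (f : Fin m → Fin m) i j → f j ≡ i → f (inv f i) ≡ i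
  inv-hits f i j e = go (allFin m) (∈-allFin j)
    where
    go : ∀ xs → j ∈ xs → f (foldr (λ j r → if toℕ (f j) ≡ᵇ toℕ i then j else r) i xs) ≡ i
    go (x ∷ xs) j∈ with toℕ (f x) ≡ᵇ toℕ i in eq
    go (x ∷ xs) j∈ | true = Finₚ.toℕ-injective (≡ᵇ-true eq)
    go (x ∷ xs) (here ≡.refl) | false = ⊥-elim (false≢true eq (≡.trans (≡.cong (λ y → toℕ y ≡ᵇ toℕ i) e) (≡ᵇ-refl (toℕ i))))
    go (x ∷ xs) (there j∈) | false = go xs j∈

  inverses-inv : ∀ {f g} → Inverses f g → ∀ i → inv f i ≡ g i
  inverses-inv {f} {g} v i = ≡.trans (≡.sym (Inverses.left v (inv f i)))
    (≡.cong g (inv-hits f i (g i) (Inverses.right v i)))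

  perm-injective : ∀ {f : Fin m → Fin m} → isPermᵇ f ≡ true → ∀ {i j} → f i ≡ f j → i ≡ j
  perm-injective {f} e {i} {j} eq = Finₚ.toℕ-injective (≡ᵇ-true (∨-elim
    (all-∈ _ (all-∈ _ e (∈-allFin i)) (∈-allFin j))
    (≡.trans (≡.cong (λ y → toℕ y ≡ᵇ toℕ (f j)) eq) (≡ᵇ-refl (toℕ (f j))))))

  injective-perm : ∀ {f : Fin m → Fin m} → (∀ {i j} → f i ≡ f j → i ≡ j) → isPermᵇ f ≡ true
  injective-perm {f} inj = ∈-all _ (allFin m) (λ i _ → ∈-all _ (allFin m) (λ j _ →
    ∨-intro (λ e → ≡.trans (≡.cong (λ y → toℕ i ≡ᵇ toℕ y) (≡.sym (inj (Finₚ.toℕ-injective (≡ᵇ-true e))))) (≡ᵇ-refl (toℕ i)))))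

-- If `i` were missed, punching it out would inject `Fin (suc m)` into `Fin m`.
injective⇒surjective : ∀ {m} (f : Fin m → Fin m) → (∀ {i j} → f i ≡ f j → i ≡ j) → ∀ i → ∃ λ j → f j ≡ i
injective⇒surjective {suc m} f inj i with Finₚ.any? (λ j → f j Finₚ.≟ i)
... | yes hit = hit
... | no miss = ⊥-elim (ℕₚ.1+n≰n (Finₚ.injective⇒≤ {f = λ j → Fin.punchOut (λ e → miss (j , ≡.sym e))}
    (λ {j} {k} e → inj (Finₚ.punchOut-injective (λ e′ → miss (j , ≡.sym e′)) (λ e′ → miss (k , ≡.sym e′)) e))))

module _ {m : ℕ} where

  perm-inverses : ∀ {f : Fin m → Fin m} → isPermᵇ f ≡ true → Inverses f (inv f)
  perm-inverses {f} e = record { right = right ; left = λ i → perm-injective {f = f} e (right (f i)) }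
    where
    right : ∀ i → f (inv f i) ≡ i
    right i = let j , fj≡i = injective⇒surjective f (perm-injective {f = f} e) i in inv-hits f i j fj≡i

  inverses-perm : ∀ {f g : Fin m → Fin m} → Inverses f g → isPermᵇ f ≡ true
  inverses-perm v = injective-perm (inverses-injective v)

  -- Pigeonhole: if `f j` were below `i`, then `j` together with the `i` smaller indices would be
  -- mapped injectively into `i` values.
  upper-closed : ∀ {f g : Fin m → Fin m} → Inverses f g → ∀ i → i ≤ m →
    (∀ j → toℕ j < i → toℕ (f j) < i) → ∀ j → i ≤ toℕ j → i ≤ toℕ (f j)
  upper-closed {f} {g} v i i≤m h j i≤j = ℕₚ.≮⇒≥ λ fj<i →
    ℕₚ.1+n≰n (Finₚ.injective⇒≤ {f = F fj<i} (λ {a} {b} → F-injective fj<i a b))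
    where
    emb : Fin i → Fin m
    emb k = inject≤ k i≤m
    emb< : ∀ k → toℕ (emb k) < i
    emb< k = ≡.subst (_< i) (≡.sym (Finₚ.toℕ-inject≤ k i≤m)) (Finₚ.toℕ<n k)
    F : toℕ (f j) < i → Fin (suc i) → Fin i
    F lt Fin.zero = fromℕ< lt
    F lt (Fin.suc k) = fromℕ< (h (emb k) (emb< k))
    reflect : ∀ a b (p : toℕ (f a) < i) (q : toℕ (f b) < i) → fromℕ< p ≡ fromℕ< q → a ≡ b
    reflect a b p q e = inverses-injective v (Finₚ.toℕ-injective (Finₚ.fromℕ<-injective _ _ p q e))
    emb≢j : ∀ k → emb k ≢ j
    emb≢j k e = ℕₚ.<⇒≱ (emb< k) (≡.subst (λ y → i ≤ toℕ y) (≡.sym e) i≤j)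
    F-injective : ∀ lt a b → F lt a ≡ F lt b → a ≡ b
    F-injective lt Fin.zero Fin.zero e = ≡.refl
    F-injective lt Fin.zero (Fin.suc k) e = ⊥-elim (emb≢j k (≡.sym (reflect j (emb k) lt (h (emb k) (emb< k)) e)))
    F-injective lt (Fin.suc k) Fin.zero e = ⊥-elim (emb≢j k (reflect (emb k) j (h (emb k) (emb< k)) lt e))
    F-injective lt (Fin.suc k) (Fin.suc l) e = ≡.cong Fin.suc (Finₚ.inject≤-injective i≤m i≤m k l (reflect (emb k) (emb l) (h (emb k) (emb< k)) (h (emb l) (emb< l)) e))

  -- By the hypothesis the inverse keeps small indices small, hence by `upper-closed` it keeps large
  -- ones large; so a large `f j` would make `j` large.
  lower-closed : ∀ {f g : Fin m → Fin m} → Inverses f g → ∀ i → i ≤ m →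
    (∀ j → i ≤ toℕ j → i ≤ toℕ (f j)) → ∀ j → toℕ j < i → toℕ (f j) < i
  lower-closed {f} {g} v i i≤m h j j<i = ℕₚ.≰⇒> λ i≤fj →
    ℕₚ.<⇒≱ j<i (≡.subst (λ y → i ≤ toℕ y) (Inverses.left v j)
      (upper-closed (swap-inverses v) i i≤m back (f j) i≤fj))
    where
    back : ∀ k → toℕ k < i → toℕ (g k) < i
    back k k<i = ℕₚ.≰⇒> λ i≤gk → ℕₚ.<⇒≱ k<i (≡.subst (λ y → i ≤ toℕ y) (Inverses.right v k) (h (g k) i≤gk))

  module _ {f g : Fin m → Fin m} (v : Inverses f g) (x : Fin m) where

    private
      x≤m : toℕ x ≤ m
      x≤m = ℕₚ.<⇒≤ (Finₚ.toℕ<n x)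

    -- A record at `x` would bound all earlier values by `f x < x`. The indices below `x` would then
    -- be mapped among themselves, which forces `f x ≥ x`.
    below-not-rec : toℕ (f x) < toℕ x → recᵇ f x ≡ false
    below-not-rec lt = ≢true⇒false λ r → ℕₚ.<⇒≱ lt
      (upper-closed v (toℕ x) x≤m (λ j j<x → ℕₚ.<-trans (rec-true f r j j<x) lt) x ℕₚ.≤-refl)

    -- For an antirecord all values from position `x` on would exceed `x`, hence the earlier
    -- positions would have values below `x`, and nothing would be mapped to `x`.
    above-not-arec : toℕ x < toℕ (f x) → arecᵇ f x ≡ false
    above-not-arec lt = ≢true⇒false λ r → missed r (ℕₚ.<-cmp (toℕ (g x)) (toℕ x))
      where
      closed : arecᵇ f x ≡ true → ∀ j → toℕ x ≤ toℕ j → toℕ x < toℕ (f j)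
      closed r j x≤j with toℕ x ℕₚ.≟ toℕ j
      ... | yes e = ≡.subst (λ y → toℕ x < toℕ (f y)) (Finₚ.toℕ-injective e) lt
      ... | no x≢j = ℕₚ.<-trans lt (arec-true f r j (ℕₚ.≤∧≢⇒< x≤j x≢j))
      late : arecᵇ f x ≡ true → ¬ (toℕ x ≤ toℕ (g x))
      late r le = ℕₚ.<⇒≢ (closed r (g x) le) (≡.cong toℕ (≡.sym (Inverses.right v x)))
      missed : arecᵇ f x ≡ true → Tri (toℕ (g x) < toℕ x) (toℕ (g x) ≡ toℕ x) (toℕ x < toℕ (g x)) → ⊥
      missed r (tri< gx<x _ _) = ℕₚ.<⇒≢
        (lower-closed v (toℕ x) x≤m (λ j le → ℕₚ.<⇒≤ (closed r j le)) (g x) gx<x)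
        (≡.cong toℕ (Inverses.right v x))
      missed r (tri≈ _ e _) = late r (ℕₚ.≤-reflexive (≡.sym e))
      missed r (tri> _ _ x<gx) = late r (ℕₚ.<⇒≤ x<gx)

    -- At a fixed point, being a record means that the smaller indices are mapped among themselves,
    -- and being an antirecord that the larger ones are; for a permutation these are equivalent.
    fixed-rec≡arec : f x ≡ x → recᵇ f x ≡ arecᵇ f x
    fixed-rec≡arec e = bool-ext
      (λ r → true-arec f (λ j x<j → ℕₚ.≤∧≢⇒<
        (≡.subst (λ y → toℕ y ≤ toℕ (f j)) (≡.sym e) (upper-closed v (toℕ x) x≤m
          (λ k k<x → ≡.subst (λ y → toℕ (f k) < toℕ y) e (rec-true f r k k<x)) j (ℕₚ.<⇒≤ x<j)))
        (distinct (ℕₚ.<⇒≢ x<j))))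
      (λ r → true-rec f (λ j j<x → ≡.subst (λ y → toℕ (f j) < toℕ y) (≡.sym e)
        (lower-closed v (toℕ x) x≤m (λ k x≤k → up r k (ℕₚ.m≤n⇒m<n∨m≡n x≤k)) j j<x)))
      where
      distinct : ∀ {j} → toℕ x ≢ toℕ j → toℕ (f x) ≢ toℕ (f j)
      distinct ne eq = ne (≡.cong toℕ (inverses-injective v (Finₚ.toℕ-injective eq)))
      up : arecᵇ f x ≡ true → ∀ k → toℕ x < toℕ k ⊎ toℕ x ≡ toℕ k → toℕ x ≤ toℕ (f k)
      up r k (inj₁ x<k) = ≡.subst (λ y → toℕ y ≤ toℕ (f k)) e (ℕₚ.<⇒≤ (arec-true f r k x<k))
      up r k (inj₂ x≡k) rewrite ≡.sym (Finₚ.toℕ-injective x≡k) = ℕₚ.≤-reflexive (≡.cong toℕ (≡.sym e))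

    -- Transposing the permutation matrix exchanges records and antirecords.
    rec-inverse : recᵇ f (g x) ≡ arecᵇ g x
    rec-inverse = bool-ext
      (λ r → true-arec g λ j x<j → ℕₚ.≰⇒> λ gj≤gx → case j x<j (ℕₚ.m≤n⇒m<n∨m≡n gj≤gx) r)
      (λ r → true-rec f λ j j<gx → ℕₚ.≰⇒> λ fgx≤fj → case′ j j<gx
        (ℕₚ.m≤n⇒m<n∨m≡n (≡.subst (λ y → toℕ y ≤ toℕ (f j)) (Inverses.right v x) fgx≤fj)) r)
      where
      case : ∀ j → toℕ x < toℕ j → toℕ (g j) < toℕ (g x) ⊎ toℕ (g j) ≡ toℕ (g x) → ¬ (recᵇ f (g x) ≡ true)
      case j x<j (inj₁ lt) r = ℕₚ.<-asym x<j (≡.subst₂ (λ a b → toℕ a < toℕ b)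
        (Inverses.right v j) (Inverses.right v x) (rec-true f r (g j) lt))
      case j x<j (inj₂ e) r = ℕₚ.<⇒≢ x<j (≡.cong toℕ (≡.sym (inverses-injective (swap-inverses v) (Finₚ.toℕ-injective e))))
      case′ : ∀ j → toℕ j < toℕ (g x) → toℕ x < toℕ (f j) ⊎ toℕ x ≡ toℕ (f j) → ¬ (arecᵇ g x ≡ true)
      case′ j j<gx (inj₁ lt) r = ℕₚ.<-asym j<gx (≡.subst (λ y → toℕ (g x) < toℕ y) (Inverses.left v j) (arec-true g r (f j) lt))
      case′ j j<gx (inj₂ e) r = ℕₚ.<⇒≢ j<gx (≡.cong toℕ (≡.sym (≡.trans (≡.cong g (Finₚ.toℕ-injective e)) (Inverses.left v j))))

    arec-inverse : arecᵇ f (g x) ≡ recᵇ g x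
    arec-inverse = bool-ext
      (λ r → true-rec g λ j j<x → ℕₚ.≰⇒> λ gx≤gj → case j j<x (ℕₚ.m≤n⇒m<n∨m≡n gx≤gj) r)
      (λ r → true-arec f λ j gx<j → ℕₚ.≰⇒> λ fj≤fgx → case′ j gx<j
        (ℕₚ.m≤n⇒m<n∨m≡n (≡.subst (λ y → toℕ (f j) ≤ toℕ y) (Inverses.right v x) fj≤fgx)) r)
      where
      case : ∀ j → toℕ j < toℕ x → toℕ (g x) < toℕ (g j) ⊎ toℕ (g x) ≡ toℕ (g j) → ¬ (arecᵇ f (g x) ≡ true)
      case j j<x (inj₁ lt) r = ℕₚ.<-asym j<x (≡.subst₂ (λ a b → toℕ a < toℕ b)
        (Inverses.right v x) (Inverses.right v j) (arec-true f r (g j) lt))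
      case j j<x (inj₂ e) r = ℕₚ.<⇒≢ j<x (≡.cong toℕ (≡.sym (inverses-injective (swap-inverses v) (Finₚ.toℕ-injective e))))
      case′ : ∀ j → toℕ (g x) < toℕ j → toℕ (f j) < toℕ x ⊎ toℕ (f j) ≡ toℕ x → ¬ (recᵇ g x ≡ true)
      case′ j gx<j (inj₁ lt) r = ℕₚ.<-asym gx<j (≡.subst (λ y → toℕ y < toℕ (g x)) (Inverses.left v j) (rec-true g r (f j) lt))
      case′ j gx<j (inj₂ e) r = ℕₚ.<⇒≢ gx<j (≡.cong toℕ (≡.trans (≡.cong g (≡.sym (Finₚ.toℕ-injective e))) (Inverses.left v j)))

  -- Least elements of cycles, and walks along the arcs

  cycleMinᵇ : (Fin m → Fin m) → Fin m → Bool
  cycleMinᵇ f x = all (λ k → toℕ x ≤ᵇ toℕ (iter f (suc k) x)) (upTo m)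

  module _ {f g : Fin m → Fin m} (v : Inverses f g) (x : Fin m) where

    period : ∃ λ d → suc d ≤ m × iter f (suc d) x ≡ x
    period with Finₚ.pigeonhole (ℕₚ.n<1+n m) (λ k → iter f (toℕ k) x)
    ... | i , j , i<j , e = go (toℕ i) (toℕ j) i<j (ℕ.≤-pred (Finₚ.toℕ<n j)) e
      where
      go : ∀ a b → a < b → b ≤ m → iter f a x ≡ iter f b x → ∃ λ d → suc d ≤ m × iter f (suc d) x ≡ x
      go zero (suc b) a<b b≤m e = b , b≤m , ≡.sym e
      go (suc a) (suc b) (s≤s a<b) b≤m e = go a b a<b (ℕₚ.<⇒≤ b≤m) (inverses-injective v e)

    -- Only the first `m` iterates are tested, but some period is at most `m`, so every exponent
    -- reduces to a tested one or to 0.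
    cycleMin-true : cycleMinᵇ f x ≡ true → ∀ k → toℕ x ≤ toℕ (iter f k x)
    cycleMin-true e k with period
    ... | d , 1+d≤m , closed with reduce k
      where
      reduce : ∀ k → ∃ λ l → l ≤ d × iter f k x ≡ iter f l x
      reduce zero = 0 , z≤n , ≡.refl
      reduce (suc k) with reduce k
      ... | l , l≤d , eq with ℕₚ.m≤n⇒m<n∨m≡n l≤d
      ...   | inj₁ l<d = suc l , l<d , ≡.cong f eq
      ...   | inj₂ ≡.refl = 0 , z≤n , ≡.trans (≡.cong f eq) closed
    ...   | zero , _ , eq = ℕₚ.≤-reflexive (≡.cong toℕ (≡.sym eq))
    ...   | suc l , l<d , eq = ≡.subst (λ y → toℕ x ≤ toℕ y) (≡.sym eq)
      (≤ᵇ-true (all-∈ (λ k → toℕ x ≤ᵇ toℕ (iter f (suc k) x)) {upTo m} {l} e (∈-upTo⁺ (ℕₚ.<-trans l<d 1+d≤m))))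

  true-cycleMin : ∀ (f : Fin m → Fin m) x → (∀ k → toℕ x ≤ toℕ (iter f k x)) → cycleMinᵇ f x ≡ true
  true-cycleMin f x h = ∈-all _ (upTo m) (λ k _ → true-≤ᵇ (h (suc k)))

  iter-shift : ∀ (f : Fin m → Fin m) k x → iter f k (f x) ≡ iter f (suc k) x
  iter-shift f zero x = ≡.refl
  iter-shift f (suc k) x = ≡.cong f (iter-shift f k x)

  cycleMin-inverse : ∀ {f g : Fin m → Fin m} → Inverses f g → ∀ x → cycleMinᵇ f x ≡ cycleMinᵇ g x
  cycleMin-inverse v x = bool-ext (to v) (to (swap-inverses v))
    where
    to : ∀ {f g : Fin m → Fin m} → Inverses f g → cycleMinᵇ f x ≡ true → cycleMinᵇ g x ≡ true
    to {f} {g} v e = true-cycleMin g x λ k → let l , eq = forward k in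
      ≡.subst (λ y → toℕ x ≤ toℕ y) (≡.sym eq) (cycleMin-true v x e l)
      where
      forward : ∀ k → ∃ λ l → iter g k x ≡ iter f l x
      forward zero = 0 , ≡.refl
      forward (suc k) with forward k
      ... | suc l , eq = l , ≡.trans (≡.cong g eq) (Inverses.left v _)
      ... | zero , eq with period v x
      ...   | d , _ , closed = d , ≡.trans (≡.cong g (≡.trans eq (≡.sym closed))) (Inverses.left v _)

  -- The bound concerns every point but the last, so a walk uses only arcs at positions from `i` on,
  -- those that a restriction knows. The end is a number because `root` works with numbers.
  data Walk (f : Fin m → Fin m) (i : ℕ) : Fin m → ℕ → Set where
    done : ∀ {y p} → toℕ y ≡ p → Walk f i y p
    step : ∀ {y p} → i ≤ toℕ y → Walk f i (f y) p → Walk f i y p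

  weaken : ∀ {f i y p} → Walk f (suc i) y p → Walk f i y p
  weaken (done e) = done e
  weaken (step le w) = step (ℕₚ.<⇒≤ le) (weaken w)

  join : ∀ {f i y p q} → Walk f i y p → (∀ z → toℕ z ≡ p → Walk f i z q) → Walk f i y q
  join (done e) h = h _ e
  join (step le w) h = step le (join w h)

  walk-iter : ∀ {f i y p} → Walk f i y p → ∃ λ n → toℕ (iter f n y) ≡ p
  walk-iter (done e) = 0 , e
  walk-iter {f} {y = y} (step _ w) = let n , e = walk-iter w in
    suc n , ≡.trans (≡.cong toℕ (≡.sym (iter-shift f n y))) e

  closed-walk : ∀ {f : Fin m → Fin m} {x} → Walk f (suc (toℕ x)) (f x) (toℕ x) → cycleMinᵇ f x ≡ true
  closed-walk {f} {x} loop = true-cycleMin f x λ k → stays k x (done ≡.refl)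
    where
    stays : ∀ k y → Walk f (toℕ x) y (toℕ x) → toℕ x ≤ toℕ (iter f k y)
    stays zero y (done e) = ℕₚ.≤-reflexive (≡.sym e)
    stays zero y (step le _) = le
    stays (suc k) y w = ≡.subst (λ z → toℕ x ≤ toℕ z) (iter-shift f k y) (stays k (f y) (advance w))
      where
      advance : Walk f (toℕ x) y (toℕ x) → Walk f (toℕ x) (f y) (toℕ x)
      -- Having arrived at `x`, the next point is `f x`, where the loop begins anew.
      advance (done e) rewrite Finₚ.toℕ-injective e = weaken loop
      advance (step _ w) = w

  escaping-walk : ∀ {f g : Fin m → Fin m} {x i p} → Inverses f g → Walk f i (f x) p → p < toℕ x → cycleMinᵇ f x ≡ false
  escaping-walk {f} {x = x} v w p<x = ≢true⇒false λ e → let n , eq = walk-iter w in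
    ℕₚ.<⇒≱ p<x (≡.subst (toℕ x ≤_) (≡.trans (≡.cong toℕ (≡.sym (iter-shift f n x))) eq) (cycleMin-true v x e (suc n)))

  -- The link between functions and lists of values, as a relation with numeric positions: it can be
  -- peeled by matching, without coercions between `Fin` types.
  data Tail (f : Fin m → Fin m) : ℕ → List ℕ → Set where
    [] : ∀ {i} → i ≡ m → Tail f i []
    cons : ∀ {i a τ} x → toℕ x ≡ i → toℕ (f x) ≡ a → Tail f (suc i) τ → Tail f i (a ∷ τ)

  tail-length : ∀ {f i τ} → Tail f i τ → i ℕ.+ length τ ≡ m
  tail-length {i = i} ([] e) = ≡.trans (ℕₚ.+-identityʳ i) e
  tail-length {i = i} (cons _ _ _ t) = ≡.trans (ℕₚ.+-suc i _) (tail-length t)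

  tail-values : ∀ {f i τ} → Tail f i τ → All (_< m) τ
  tail-values ([] e) = []
  tail-values {f} (cons x _ e t) = ≡.subst (_< m) e (Finₚ.toℕ<n (f x)) ∷ tail-values t

  tail-mem : ∀ {f i τ} → Tail f i τ → ∀ v → mem v τ ≡ true → ∃ λ j → i ≤ toℕ j × toℕ (f j) ≡ v
  tail-mem {i = i} (cons {a = a} x e e′ t) v v∈ with v ≡ᵇ a in eq
  ... | true = x , ℕₚ.≤-reflexive (≡.sym e) , ≡.trans e′ (≡.sym (≡ᵇ-true eq))
  ... | false = let j , le , q = tail-mem t v v∈ in j , ℕₚ.<⇒≤ le , q

  mem-tail : ∀ {f i τ} → Tail f i τ → ∀ j → i ≤ toℕ j → mem (toℕ (f j)) τ ≡ true
  mem-tail ([] ≡.refl) j le = ⊥-elim (ℕₚ.<⇒≱ (Finₚ.toℕ<n j) le)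
  mem-tail {f} {i} (cons {a = a} {τ = τ} x e e′ t) j le with ℕₚ.m≤n⇒m<n∨m≡n le
  ... | inj₁ lt = mem-∷ {toℕ (f j)} a τ (mem-tail t j lt)
  ... | inj₂ eq rewrite Finₚ.toℕ-injective (≡.trans e eq) | e′ = mem-here a τ

  tail-unique : ∀ {f g i τ} → Inverses f g → Tail f i τ → uniqueᵇ τ ≡ true
  tail-unique v ([] _) = ≡.refl
  tail-unique {f} {i = i} v (cons {a = a} {τ = τ} x e e′ t) = ∧-join
    (true-not (≢true⇒false λ a∈ → let j , lt , q = tail-mem t a a∈ in
      ℕₚ.<⇒≢ lt (≡.trans (≡.sym e) (≡.cong toℕ (inverses-injective v (Finₚ.toℕ-injective (≡.trans e′ (≡.sym q))))))))
    (tail-unique v t)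

  tail-suffix : ∀ {f g i τ} → Inverses f g → Tail f i τ → IsSuffix {m} i τ
  tail-suffix v t = isSuffix (tail-length t) (tail-values t) (tail-unique v t)

  -- The induction follows the recursion of `root`. If `a < i` and `p` is `a`, the walk runs to `i`
  -- and on along the new arc. If `a > i` and the old walk to `p` started at `a`, the walk to `i`
  -- and the new arc are put in front of it.
  root-walk : ∀ {f g i τ} → Inverses f g → Tail f i τ → ∀ p → p < i → mem p τ ≡ true →
    ∀ y → toℕ y ≡ root i τ p → Walk f i y p
  root-walk {f} {i = i} v (cons {a = a} {τ = τ} x e e′ t) p p<i p∈ y y≡ = cases (ℕₚ.<-cmp a i)
    where
    to-i : ∀ y → toℕ y ≡ root (suc i) τ i → Walk f i y i
    to-i y y≡ with mem i τ in i∈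
    ... | true = weaken (root-walk v t i ℕₚ.≤-refl i∈ y y≡)
    ... | false = done (≡.trans y≡ (root-outside (suc i) τ i ℕₚ.≤-refl i∈))
    i-to-a : ∀ z → toℕ z ≡ i → Walk f i z a
    i-to-a z z≡ rewrite Finₚ.toℕ-injective (≡.trans z≡ (≡.sym e)) = step (ℕₚ.≤-reflexive (≡.sym e)) (done e′)
    to-p : mem p τ ≡ true → ∀ y → toℕ y ≡ root (suc i) τ p → Walk f i y p
    to-p p∈ y y≡ = weaken (root-walk v t p (ℕₚ.m<n⇒m<1+n p<i) p∈ y y≡)
    cases : Tri (a < i) (a ≡ i) (i < a) → Walk f i y p
    cases (tri< a<i _ _) = low (p ≡ᵇ a) ≡.refl
      where
      low : ∀ b → (p ≡ᵇ a) ≡ b → Walk f i y p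
      low true eq = ≡.subst (Walk f i y) (≡.sym (≡ᵇ-true eq))
        (join (to-i y (≡.trans y≡ (≡.trans (root-< τ a<i p) (if-true eq)))) i-to-a)
      low false eq = to-p (≡.trans (≡.cong (_∨ mem p τ) (≡.sym eq)) p∈) y
        (≡.trans y≡ (≡.trans (root-< τ a<i p) (if-false eq)))
    cases (tri≈ _ ≡.refl _) = to-p (≡.trans (≡.sym (mem-≢ τ (ℕₚ.<⇒≢ p<i))) p∈) y (≡.trans y≡ (root-≡ i τ p))
    cases (tri> _ _ i<a) = high (root (suc i) τ p ≡ᵇ a) ≡.refl
      where
      p∈τ : mem p τ ≡ true
      p∈τ = ≡.trans (≡.sym (mem-≢ τ (ℕₚ.<⇒≢ (ℕₚ.<-trans p<i i<a)))) p∈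
      high : ∀ b → (root (suc i) τ p ≡ᵇ a) ≡ b → Walk f i y p
      high true eq = join (join (to-i y (≡.trans y≡ (≡.trans (root-> τ i<a p) (if-true eq)))) i-to-a)
        (λ z z≡ → to-p p∈τ z (≡.trans z≡ (≡.sym (≡ᵇ-true eq))))
      high false eq = to-p p∈τ y (≡.trans y≡ (≡.trans (root-> τ i<a p) (if-false eq)))

-- The weight at an index

module LocalAnalysis {c ℓ : Level} (R : CommutativeSemiring c ℓ) where
  open CommutativeSemiring R hiding (zero)
  open SuffixSums R

  module _ (w : LocalWeights) {m : ℕ} where
    open LocalWeights w

    -- The index is the local weight, so a match yields the form of the weight together with the
    -- facts about `x` that the statistics consult. Keeping `g` as a parameter allows the view of an
    -- inverse permutation to be used for the primed statistics.
    data View (f g : Fin m → Fin m) (x : Fin m) : Carrier → Set where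
      peakView : toℕ (f x) < toℕ x → toℕ (g x) < toℕ x → recᵇ f x ≡ false → cycleMinᵇ f x ≡ false →
        View f g x (peak (toℕ x) (arecᵇ f x))
      fallView : toℕ (f x) < toℕ x → toℕ x < toℕ (g x) → recᵇ f x ≡ false → cycleMinᵇ f x ≡ false →
        View f g x (fall (toℕ x) (arecᵇ f x))
      fixedView : f x ≡ x → recᵇ f x ≡ arecᵇ f x → cycleMinᵇ f x ≡ true →
        View f g x (fixed (toℕ x) (arecᵇ f x))
      valleyView : toℕ x < toℕ (f x) → toℕ x < toℕ (g x) → arecᵇ f x ≡ false →
        View f g x (valley (toℕ x) * (if cycleMinᵇ f x then cycle else 1#))
      riseView : toℕ x < toℕ (f x) → toℕ (g x) < toℕ x → arecᵇ f x ≡ false → cycleMinᵇ f x ≡ false →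
        View f g x (rise (toℕ x) (recᵇ f x))

    module _ {f g : Fin m → Fin m} (v : Inverses f g) (x : Fin m) {τ : List ℕ} (t : Tail f (suc (toℕ x)) τ) where

      private
        i : ℕ
        i = toℕ x

      mem-i : mem i τ ≡ true → i < toℕ (g x)
      mem-i i∈ = let j , lt , e = tail-mem t i i∈ in ≡.subst (λ y → i < toℕ y)
        (≡.trans (≡.sym (Inverses.left v j)) (≡.cong g (Finₚ.toℕ-injective e))) lt

      i-mem : i < toℕ (g x) → mem i τ ≡ true
      i-mem lt = ≡.subst (λ y → mem (toℕ y) τ ≡ true) (Inverses.right v x) (mem-tail t (g x) lt)

      value-∉ : mem (toℕ (f x)) τ ≡ false
      value-∉ = ≢true⇒false λ e → let j , lt , eq = tail-mem t _ e in
        ℕₚ.<⇒≢ lt (≡.cong toℕ (≡.sym (inverses-injective v (Finₚ.toℕ-injective eq))))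

      gx<x : i ≢ toℕ (f x) → mem i τ ≡ false → toℕ (g x) < i
      gx<x ne i∉ = ℕₚ.≤∧≢⇒< (ℕₚ.≮⇒≥ (λ lt → false≢true i∉ (i-mem lt)))
        (λ e → ne (≡.cong toℕ (≡.trans (≡.sym (Inverses.right v x)) (≡.cong f (Finₚ.toℕ-injective e)))))

      below≡arec : belowᵇ (toℕ (f x)) τ ≡ arecᵇ f x
      below≡arec = bool-ext
        (λ b → true-arec f λ j lt → below-true τ b (toℕ (f j)) (mem-tail t j lt))
        (λ r → true-below τ λ u u∈ → let j , lt , e = tail-mem t u u∈ in
          ≡.subst (toℕ (f x) <_) e (arec-true f r j lt))

      -- The missing values above `i` are the large values at the positions up to `x`. To be a
      -- record, `f x` has to beat only these, because the other earlier values are at most `i`.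
      greatest≡rec : i < toℕ (f x) → greatestᵇ m (freeᵇ (suc i) τ) (toℕ (f x)) ≡ recᵇ f x
      greatest≡rec i<fx = bool-ext
        (λ h → true-rec f λ j j<x → ℕₚ.≰⇒> λ fx≤fj → strict j j<x (ℕₚ.m≤n⇒m<n∨m≡n fx≤fj) h)
        (λ r → true-greatest m {freeᵇ (suc i) τ} λ u u<m free → bound r u u<m (free-split {suc i} τ {u} free))
        where
        strict : ∀ j → toℕ j < i → toℕ (f x) < toℕ (f j) ⊎ toℕ (f x) ≡ toℕ (f j) →
          ¬ (greatestᵇ m (freeᵇ (suc i) τ) (toℕ (f x)) ≡ true)
        strict j j<x (inj₂ e) h = ℕₚ.<⇒≢ j<x (≡.cong toℕ (≡.sym (inverses-injective v (Finₚ.toℕ-injective e))))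
        strict j j<x (inj₁ lt) h = ℕₚ.<⇒≱ lt (greatest-true m {freeᵇ (suc i) τ} h (toℕ (f j)) (Finₚ.toℕ<n (f j))
          (free-join {suc i} τ {toℕ (f j)} (ℕₚ.<-trans i<fx lt) (≢true⇒false λ e → let k , gt , eq = tail-mem t _ e in
            ℕₚ.<⇒≢ (ℕₚ.<-trans j<x gt) (≡.cong toℕ (≡.sym (inverses-injective v (Finₚ.toℕ-injective eq)))))))
        bound : recᵇ f x ≡ true → ∀ u → u < m → suc i ≤ u × mem u τ ≡ false → u ≤ toℕ (f x)
        bound r u u<m (_ , u∉) = ≡.subst (_≤ toℕ (f x)) fj≡u (le (ℕₚ.<-cmp (toℕ j) i))
          where
          j : Fin m
          j = g (fromℕ< u<m)
          fj≡u : toℕ (f j) ≡ u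
          fj≡u = ≡.trans (≡.cong toℕ (Inverses.right v _)) (Finₚ.toℕ-fromℕ< u<m)
          le : Tri (toℕ j < i) (toℕ j ≡ i) (i < toℕ j) → toℕ (f j) ≤ toℕ (f x)
          le (tri< j<x _ _) = ℕₚ.<⇒≤ (rec-true f r j j<x)
          le (tri≈ _ e _) = ℕₚ.≤-reflexive (≡.cong (toℕ ∘ f) (Finₚ.toℕ-injective e))
          le (tri> _ _ x<j) = ⊥-elim (false≢true u∉ (≡.subst (λ u → mem u τ ≡ true) fj≡u (mem-tail t j x<j)))

      falling-not-min : toℕ (f x) < i → cycleMinᵇ f x ≡ false
      falling-not-min lt = escaping-walk {i = 0} v (done ≡.refl) lt

      fixed-min : f x ≡ x → cycleMinᵇ f x ≡ true
      fixed-min e = closed-walk {f = f} (done (≡.cong toℕ e))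

      -- The start of the walk that ends at i is the only value of f x that closes a cycle.
      rising-min : i < toℕ (f x) → cycleMinᵇ f x ≡ mem i τ ∧ (toℕ (f x) ≡ᵇ root (suc i) τ i)
      rising-min lt with Roots.surjective (roots (suc i) τ (tail-suffix v t)) lt (Finₚ.toℕ<n (f x)) value-∉
      ... | p , p≤i , p∈ , e with ℕₚ.m≤n⇒m<n∨m≡n (ℕ.≤-pred p≤i)
      ...   | inj₂ ≡.refl = ≡.trans (closed-walk (root-walk v t i p≤i p∈ (f x) (≡.sym e)))
        (≡.sym (∧-join p∈ (≡.subst (λ r → (toℕ (f x) ≡ᵇ r) ≡ true) (≡.sym e) (≡ᵇ-refl (toℕ (f x))))))
      ...   | inj₁ p<i = ≡.trans (escaping-walk v (root-walk v t p p≤i p∈ (f x) (≡.sym e)) p<i)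
        (≡.sym (≢true⇒false λ h → let i∈ , q = ∧-split {mem i τ} h in ℕₚ.<⇒≢ p<i
          (Roots.injective (roots (suc i) τ (tail-suffix v t)) p≤i ℕₚ.≤-refl p∈ i∈
            (≡.trans e (≡ᵇ-true q)))))

      view : View f g x (local w m i (toℕ (f x)) τ)
      view = compare (ℕₚ.<-cmp (toℕ (f x)) i)
        where
        low : toℕ (f x) < i → ∀ b → mem i τ ≡ b →
          View f g x (if b then fall i (belowᵇ (toℕ (f x)) τ) else peak i (belowᵇ (toℕ (f x)) τ))
        low lt true i∈ = ≡.subst (View f g x ∘ fall i) (≡.sym below≡arec)
          (fallView lt (mem-i i∈) (below-not-rec v x lt) (falling-not-min lt))
        low lt false i∉ = ≡.subst (View f g x ∘ peak i) (≡.sym below≡arec)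
          (peakView lt (gx<x (ℕₚ.<⇒≢ lt ∘ ≡.sym) i∉) (below-not-rec v x lt) (falling-not-min lt))
        high : i < toℕ (f x) → ∀ b → mem i τ ≡ b → View f g x (if b
          then valley i * (if toℕ (f x) ≡ᵇ root (suc i) τ i then cycle else 1#)
          else rise i (greatestᵇ m (freeᵇ (suc i) τ) (toℕ (f x))))
        high lt true i∈ = ≡.subst (λ b → View f g x (valley i * (if b then cycle else 1#)))
          (≡.trans (rising-min lt) (≡.cong (_∧ (toℕ (f x) ≡ᵇ root (suc i) τ i)) i∈))
          (valleyView lt (mem-i i∈) (above-not-arec v x lt))
        high lt false i∉ = ≡.subst (View f g x ∘ rise i) (≡.sym (greatest≡rec lt))
          (riseView lt (gx<x (ℕₚ.<⇒≢ lt) i∉) (above-not-arec v x lt)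
            (≡.trans (rising-min lt) (≡.cong (_∧ (toℕ (f x) ≡ᵇ root (suc i) τ i)) i∉)))
        compare : Tri (toℕ (f x) < i) (toℕ (f x) ≡ i) (i < toℕ (f x)) → View f g x (local w m i (toℕ (f x)) τ)
        compare (tri< lt _ _) = ≡.subst (View f g x) (≡.sym (local-< w m τ lt)) (low lt (mem i τ) ≡.refl)
        compare (tri≈ _ e _) = ≡.subst (View f g x)
          (≡.sym (≡.trans (≡.cong (λ a → local w m i a τ) e) (≡.trans (local-≡ w m i τ)
            (≡.cong (fixed i) (≡.trans (≡.cong (λ a → belowᵇ a τ) (≡.sym e)) below≡arec)))))
          (fixedView fx≡x (fixed-rec≡arec v x fx≡x) (fixed-min fx≡x))
          where
          fx≡x : f x ≡ x
          fx≡x = Finₚ.toℕ-injective e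
        compare (tri> _ _ lt) = ≡.subst (View f g x) (≡.sym (local-> w m τ lt)) (high lt (mem i τ) ≡.refl)

  prod : ∀ {n} → (Fin n → Carrier) → Carrier
  prod {zero} h = 1#
  prod {suc n} h = h Fin.zero * prod (h ∘ Fin.suc)

  values : ∀ {m} → (Fin m → Fin m) → List ℕ
  values f = tabulate (toℕ ∘ f)

  tail-tabulate : ∀ {m} (f : Fin m → Fin m) {r} (e : Fin r → Fin m) i → (∀ j → toℕ (e j) ≡ i ℕ.+ toℕ j) → i ℕ.+ r ≡ m →
    Tail f i (tabulate (toℕ ∘ f ∘ e))
  tail-tabulate f {zero} e i pos end = [] (≡.trans (≡.sym (ℕₚ.+-identityʳ i)) end)
  tail-tabulate f {suc r} e i pos end = cons (e Fin.zero) (≡.trans (pos Fin.zero) (ℕₚ.+-identityʳ i)) ≡.refl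
    (tail-tabulate f (e ∘ Fin.suc) (suc i) (λ j → ≡.trans (pos (Fin.suc j)) (ℕₚ.+-suc i (toℕ j)))
      (≡.trans (≡.sym (ℕₚ.+-suc i r)) end))

  -- `K` is left open so that the product may be expressed through the permutation itself or through
  -- its inverse.
  total≈prod : ∀ (w : LocalWeights) {m} {f g : Fin m → Fin m} → Inverses f g → (K : Fin m → Carrier) →
    (∀ x {k} → View w f g x k → k ≈ K x) → total w m 0 (values f) ≈ prod K
  total≈prod w {m} {f} {g} v K h = go id 0 (λ _ → ≡.refl) ≡.refl
    where
    go : ∀ {r} (e : Fin r → Fin m) i → (∀ j → toℕ (e j) ≡ i ℕ.+ toℕ j) → i ℕ.+ r ≡ m →
      total w m i (tabulate (toℕ ∘ f ∘ e)) ≈ prod (K ∘ e)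
    go {zero} e i pos end = refl
    go {suc r} e i pos end = *-cong
      (trans (reflexive (≡.cong (λ j → local w m j (toℕ (f x)) τ) (≡.sym x≡i)))
        (h x (view w v x (≡.subst (λ j → Tail f (suc j) τ) (≡.sym x≡i) tail))))
      (go (e ∘ Fin.suc) (suc i) pos′ end′)
      where
      x : Fin m
      x = e Fin.zero
      τ : List ℕ
      τ = tabulate (toℕ ∘ f ∘ e ∘ Fin.suc)
      x≡i : toℕ x ≡ i
      x≡i = ≡.trans (pos Fin.zero) (ℕₚ.+-identityʳ i)
      pos′ : ∀ j → toℕ (e (Fin.suc j)) ≡ suc i ℕ.+ toℕ j
      pos′ j = ≡.trans (pos (Fin.suc j)) (ℕₚ.+-suc i (toℕ j))
      end′ : suc i ℕ.+ r ≡ m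
      end′ = ≡.trans (≡.sym (ℕₚ.+-suc i r)) end
      tail : Tail f (suc i) τ
      tail = tail-tabulate f (e ∘ Fin.suc) (suc i) pos′ end′

-- D-permutations

module FunctionSums {c ℓ : Level} (R : CommutativeSemiring c ℓ) where
  open CommutativeSemiring R hiding (zero)
  open import Relation.Binary.Reasoning.Setoid setoid
  open import Algebra.Solver.Ring.NaturalCoefficients.Default R using (solve; _:=_; _:+_; _:*_)
  open FiniteSums R
  open MotzkinPaths R using (Steps; paths; paths-cong; paths≈cfCoeff)
  open SuffixSums R
  open LocalAnalysis R

  private variable
    A B C : Set

  ∑ᴸ : List A → (A → Carrier) → Carrier
  ∑ᴸ xs h = sumL R (map h xs)

  ∑ᴸ-cong : ∀ (xs : List A) {h h′ : A → Carrier} → (∀ x → h x ≈ h′ x) → ∑ᴸ xs h ≈ ∑ᴸ xs h′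
  ∑ᴸ-cong [] e = refl
  ∑ᴸ-cong (x ∷ xs) e = +-cong (e x) (∑ᴸ-cong xs e)

  ∑ᴸ-zero : ∀ (xs : List A) → ∑ᴸ xs (λ _ → 0#) ≈ 0#
  ∑ᴸ-zero [] = refl
  ∑ᴸ-zero (x ∷ xs) = trans (+-identityˡ _) (∑ᴸ-zero xs)

  ∑ᴸ-+ : ∀ (xs : List A) h h′ → ∑ᴸ xs (λ x → h x + h′ x) ≈ ∑ᴸ xs h + ∑ᴸ xs h′
  ∑ᴸ-+ [] h h′ = sym (+-identityˡ _)
  ∑ᴸ-+ (x ∷ xs) h h′ = trans (+-congˡ (∑ᴸ-+ xs h h′))
    (solve 4 (λ a b x y → (a :+ b) :+ (x :+ y) := (a :+ x) :+ (b :+ y)) refl _ _ _ _)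

  ∑ᴸ-*ʳ : ∀ (xs : List A) y h → ∑ᴸ xs (λ x → h x * y) ≈ ∑ᴸ xs h * y
  ∑ᴸ-*ʳ [] y h = sym (zeroˡ y)
  ∑ᴸ-*ʳ (x ∷ xs) y h = trans (+-congˡ (∑ᴸ-*ʳ xs y h)) (sym (distribʳ _ _ _))

  ∑ᴸ-ι : ∀ (xs : List A) b h → ∑ᴸ xs (λ x → ι b (h x)) ≈ ι b (∑ᴸ xs h)
  ∑ᴸ-ι xs true h = refl
  ∑ᴸ-ι xs false h = ∑ᴸ-zero xs

  ∑ᴸ-swap : ∀ (xs : List A) (ys : List B) (h : A → B → Carrier) →
    ∑ᴸ xs (λ x → ∑ᴸ ys (h x)) ≈ ∑ᴸ ys (λ y → ∑ᴸ xs (λ x → h x y))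
  ∑ᴸ-swap [] ys h = sym (∑ᴸ-zero ys)
  ∑ᴸ-swap (x ∷ xs) ys h = trans (+-congˡ (∑ᴸ-swap xs ys h)) (sym (∑ᴸ-+ ys _ _))

  ∑ᴸ-++ : ∀ (xs ys : List A) h → ∑ᴸ (xs ++ ys) h ≈ ∑ᴸ xs h + ∑ᴸ ys h
  ∑ᴸ-++ [] ys h = sym (+-identityˡ _)
  ∑ᴸ-++ (x ∷ xs) ys h = trans (+-congˡ (∑ᴸ-++ xs ys h)) (sym (+-assoc _ _ _))

  ∑ᴸ-filter : ∀ p (xs : List A) h → ∑ᴸ (filterᵇ p xs) h ≈ ∑ᴸ xs (λ x → ι (p x) (h x))
  ∑ᴸ-filter p [] h = refl
  ∑ᴸ-filter p (x ∷ xs) h with p x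
  ... | true = +-congˡ (∑ᴸ-filter p xs h)
  ... | false = trans (∑ᴸ-filter p xs h) (sym (+-identityˡ _))

  ∑ᴸ-concatMap : ∀ (c : A → B → C) xs ys (h : C → Carrier) →
    ∑ᴸ (concatMap (λ a → map (c a) ys) xs) h ≈ ∑ᴸ xs (λ a → ∑ᴸ ys (λ f → h (c a f)))
  ∑ᴸ-concatMap c [] ys h = refl
  ∑ᴸ-concatMap c (a ∷ xs) ys h = trans (∑ᴸ-++ (map (c a) ys) _ h)
    (+-cong (reflexive (≡.cong (sumL R) (≡.sym (Listₚ.map-∘ ys)))) (∑ᴸ-concatMap c xs ys h))

  ∑ᴸ-tabulate : ∀ {n} (e : Fin n → A) (h : A → Carrier) (h′ : ℕ → Carrier) → (∀ j → h (e j) ≈ h′ (toℕ j)) →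
    ∑ᴸ (tabulate e) h ≈ ∑ n h′
  ∑ᴸ-tabulate {n = zero} e h h′ eq = refl
  ∑ᴸ-tabulate {n = suc n} e h h′ eq = +-cong (eq Fin.zero) (∑ᴸ-tabulate (e ∘ Fin.suc) h (h′ ∘ suc) (eq ∘ Fin.suc))

  ∑ᴸ-funs : ∀ m k (H : List ℕ → Carrier) → ∑ᴸ (funs m k) (λ f → H (tabulate (toℕ ∘ f))) ≈ ∑ₗ m k H
  ∑ᴸ-funs m zero H = +-identityʳ _
  ∑ᴸ-funs m (suc k) H = trans (∑ᴸ-concatMap _ (allFin m) (funs m k) _)
    (∑ᴸ-tabulate {n = m} id _ (λ a → ∑ₗ m k (λ τ → H (a ∷ τ))) (λ a → ∑ᴸ-funs m k (λ τ → H (toℕ a ∷ τ))))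

  sameᵇ : ∀ {m k} → (Fin k → Fin m) → (Fin k → Fin m) → Bool
  sameᵇ {k = zero} f g = true
  sameᵇ {k = suc k} f g = (toℕ (f Fin.zero) ≡ᵇ toℕ (g Fin.zero)) ∧ sameᵇ (f ∘ Fin.suc) (g ∘ Fin.suc)

  same-true : ∀ {m k} {f g : Fin k → Fin m} → sameᵇ f g ≡ true → ∀ j → f j ≡ g j
  same-true e Fin.zero = Finₚ.toℕ-injective (≡ᵇ-true (proj₁ (∧-split e)))
  same-true {f = f} {g} e (Fin.suc j) = same-true (proj₂ (∧-split {toℕ (f Fin.zero) ≡ᵇ toℕ (g Fin.zero)} e)) j

  true-same : ∀ {m k} {f g : Fin k → Fin m} → (∀ j → f j ≡ g j) → sameᵇ f g ≡ true
  true-same {k = zero} h = ≡.refl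
  true-same {k = suc k} {f} h = ∧-join
    (≡.subst (λ y → (toℕ (f Fin.zero) ≡ᵇ toℕ y) ≡ true) (h Fin.zero) (≡ᵇ-refl (toℕ (f Fin.zero))))
    (true-same (h ∘ Fin.suc))

  ι-∧ : ∀ b c x → ι (b ∧ c) x ≈ ι b (ι c x)
  ι-∧ true c x = refl
  ι-∧ false c x = refl

  ∑ᴸ-same : ∀ m k (g : Fin k → Fin m) → ∑ᴸ (funs m k) (λ f → ι (sameᵇ f g) 1#) ≈ 1#
  ∑ᴸ-same m zero g = +-identityʳ 1#
  ∑ᴸ-same m (suc k) g = trans (∑ᴸ-concatMap _ (allFin m) (funs m k) _)
    (trans (∑ᴸ-tabulate {n = m} id _ (λ a → ι (a ≡ᵇ toℕ (g Fin.zero)) 1#) (λ a → trans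
        (∑ᴸ-cong (funs m k) (λ f → ι-∧ (toℕ a ≡ᵇ toℕ (g Fin.zero)) (sameᵇ f (g ∘ Fin.suc)) 1#))
        (trans (∑ᴸ-ι (funs m k) (toℕ a ≡ᵇ toℕ (g Fin.zero)) _)
          (ι-cong (toℕ a ≡ᵇ toℕ (g Fin.zero)) (λ _ → ∑ᴸ-same m k (g ∘ Fin.suc))))))
      (∑-point m (toℕ (g Fin.zero)) (λ _ → 1#) (Finₚ.toℕ<n (g Fin.zero))))

  -- Both sides are the sum over the pairs of mutually inverse f and g.
  ∑-inverse : ∀ m (A B : (Fin m → Fin m) → Carrier) → (∀ {f g} → Inverses f g → A f ≈ B g) →
    ∑ᴸ (funs m m) (λ f → ι (isPermᵇ f) (A f)) ≈ ∑ᴸ (funs m m) (λ g → ι (isPermᵇ g) (B g))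
  ∑-inverse m A B e = begin
    ∑ᴸ F (λ f → ι (isPermᵇ f) (A f))
      ≈⟨ ∑ᴸ-cong F (λ f → sym (spread A f)) ⟩
    ∑ᴸ F (λ f → ∑ᴸ F (λ g → ι (isPermᵇ f ∧ sameᵇ g (inv f)) (A f)))
      ≈⟨ ∑ᴸ-cong F (λ f → ∑ᴸ-cong F (λ g → exchange f g)) ⟩
    ∑ᴸ F (λ f → ∑ᴸ F (λ g → ι (isPermᵇ g ∧ sameᵇ f (inv g)) (B g)))
      ≈⟨ ∑ᴸ-swap F F (λ f g → ι (isPermᵇ g ∧ sameᵇ f (inv g)) (B g)) ⟩
    ∑ᴸ F (λ g → ∑ᴸ F (λ f → ι (isPermᵇ g ∧ sameᵇ f (inv g)) (B g)))
      ≈⟨ ∑ᴸ-cong F (spread B) ⟩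
    ∑ᴸ F (λ g → ι (isPermᵇ g) (B g)) ∎
    where
    F : List (Fin m → Fin m)
    F = funs m m
    spread : ∀ D f → ∑ᴸ F (λ g → ι (isPermᵇ f ∧ sameᵇ g (inv f)) (D f)) ≈ ι (isPermᵇ f) (D f)
    spread D f = begin
      ∑ᴸ F (λ g → ι (isPermᵇ f ∧ sameᵇ g (inv f)) (D f))
        ≈⟨ ∑ᴸ-cong F (λ g → trans (ι-∧ (isPermᵇ f) _ _) (ι-cong (isPermᵇ f) (λ _ →
             trans (ι-cong (sameᵇ g (inv f)) (λ _ → sym (*-identityˡ _))) (ι-*-comm (sameᵇ g (inv f)) 1# (D f))))) ⟩
      ∑ᴸ F (λ g → ι (isPermᵇ f) (ι (sameᵇ g (inv f)) 1# * D f))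
        ≈⟨ ∑ᴸ-ι F (isPermᵇ f) _ ⟩
      ι (isPermᵇ f) (∑ᴸ F (λ g → ι (sameᵇ g (inv f)) 1# * D f))
        ≈⟨ ι-cong (isPermᵇ f) (λ _ → trans (∑ᴸ-*ʳ F (D f) _)
             (trans (*-congʳ (∑ᴸ-same m m (inv f))) (*-identityˡ _))) ⟩
      ι (isPermᵇ f) (D f) ∎
    inverses : ∀ f g → isPermᵇ f ∧ sameᵇ g (inv f) ≡ true → Inverses f g
    inverses f g eq = record
      { right = λ i → ≡.trans (≡.cong f (g≗ i)) (Inverses.right v i)
      ; left = λ i → ≡.trans (g≗ (f i)) (Inverses.left v i) }
      where
      v : Inverses f (inv f)
      v = perm-inverses (proj₁ (∧-split {isPermᵇ f} eq))
      g≗ : ∀ i → g i ≡ inv f i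
      g≗ = same-true (proj₂ (∧-split {isPermᵇ f} eq))
    matched : ∀ f g → isPermᵇ f ∧ sameᵇ g (inv f) ≡ true → isPermᵇ g ∧ sameᵇ f (inv g) ≡ true
    matched f g eq = ∧-join (inverses-perm v) (true-same (λ i → ≡.sym (inverses-inv v i)))
      where
      v : Inverses g f
      v = swap-inverses (inverses f g eq)
    exchange : ∀ f g → ι (isPermᵇ f ∧ sameᵇ g (inv f)) (A f) ≈ ι (isPermᵇ g ∧ sameᵇ f (inv g)) (B g)
    exchange f g = trans (ι-cong _ (λ eq → e (inverses f g eq)))
      (reflexive (≡.cong (λ b → ι b (B g)) (bool-ext (matched f g) (matched g f))))

  isPerm≡unique : ∀ {m} (f : Fin m → Fin m) → isPermᵇ f ≡ uniqueᵇ (values f)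
  isPerm≡unique {m} f = bool-ext
    (λ e → tail-unique (perm-inverses e) (tail-tabulate f id 0 (λ _ → ≡.refl) ≡.refl))
    (λ u → injective-perm (injective (λ j → f j) u))
    where
    mem-values : ∀ {k} (h : Fin k → Fin m) j → mem (toℕ (h j)) (tabulate (toℕ ∘ h)) ≡ true
    mem-values h Fin.zero = mem-here (toℕ (h Fin.zero)) (tabulate (toℕ ∘ h ∘ Fin.suc))
    mem-values h (Fin.suc j) = mem-∷ {toℕ (h (Fin.suc j))} (toℕ (h Fin.zero)) (tabulate (toℕ ∘ h ∘ Fin.suc)) (mem-values (h ∘ Fin.suc) j)
    injective : ∀ {k} (h : Fin k → Fin m) → uniqueᵇ (tabulate (toℕ ∘ h)) ≡ true → ∀ {i j} → h i ≡ h j → i ≡ j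
    injective h u {Fin.zero} {Fin.zero} e = ≡.refl
    injective h u {Fin.zero} {Fin.suc j} e = ⊥-elim (false≢true (proj₁ (unique-∷ (toℕ (h Fin.zero)) (tabulate (toℕ ∘ h ∘ Fin.suc)) u))
      (≡.subst (λ y → mem (toℕ y) (tabulate (toℕ ∘ h ∘ Fin.suc)) ≡ true) (≡.sym e) (mem-values (h ∘ Fin.suc) j)))
    injective h u {Fin.suc i} {Fin.zero} e = ⊥-elim (false≢true (proj₁ (unique-∷ (toℕ (h Fin.zero)) (tabulate (toℕ ∘ h ∘ Fin.suc)) u))
      (≡.subst (λ y → mem (toℕ y) (tabulate (toℕ ∘ h ∘ Fin.suc)) ≡ true) e (mem-values (h ∘ Fin.suc) i)))
    injective h u {Fin.suc i} {Fin.suc j} e =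
      ≡.cong Fin.suc (injective (h ∘ Fin.suc) (proj₂ (unique-∷ (toℕ (h Fin.zero)) (tabulate (toℕ ∘ h ∘ Fin.suc)) u)) e)

  ∑-perms : ∀ (w : LocalWeights) m →
    ∑ᴸ (funs m m) (λ f → ι (isPermᵇ f) (total w m 0 (values f))) ≈ paths (steps w) m 0 0
  ∑-perms w m = begin
    ∑ᴸ (funs m m) (λ f → ι (isPermᵇ f) (total w m 0 (values f)))
      -- At position 0 there are no smaller values to agree on, so `fitsᵇ` amounts to uniqueness.
      ≈⟨ ∑ᴸ-cong (funs m m) (λ f → reflexive (≡.cong (λ b → ι b (total w m 0 (values f)))
           (≡.trans (isPerm≡unique f) (≡.sym (𝔹ₚ.∧-identityʳ _))))) ⟩
    ∑ᴸ (funs m m) (λ f → ι (fitsᵇ 0 (λ _ → false) (values f)) (total w m 0 (values f)))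
      ≈⟨ ∑ᴸ-funs m m (λ τ → ι (fitsᵇ 0 (λ _ → false) τ) (total w m 0 τ)) ⟩
    ∑ₗ m m (λ τ → ι (fitsᵇ 0 (λ _ → false) τ) (total w m 0 τ))
      ≈⟨ ∑ₗ-total w m m 0 (λ _ → false) ≡.refl (λ _ _ → ≡.refl) ⟩
    paths (steps w) m 0 (card m (λ _ → false))
      ≈⟨ reflexive (≡.cong (paths (steps w) m 0) (card-false m (λ _ _ → ≡.refl))) ⟩
    paths (steps w) m 0 0 ∎

-- The weights of D-permutations as products over the indices

module DPermutations {c ℓ : Level} (R : CommutativeSemiring c ℓ) (a : Vars R) where
  open CommutativeSemiring R hiding (zero)
  open import Algebra.Solver.Ring.NaturalCoefficients.Default R using (solve; _:=_; _:+_; _:*_)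
  open FiniteSums R
  open MotzkinPaths R using (Steps; paths; paths-cong; paths≈cfCoeff)
  open SuffixSums R
  open LocalAnalysis R
  open FunctionSums R
  open Vars (specV₁ a)

  prod-* : ∀ {n} (h h′ : Fin n → Carrier) → prod h * prod h′ ≈ prod (λ j → h j * h′ j)
  prod-* {zero} h h′ = *-identityˡ 1#
  prod-* {suc n} h h′ = trans
    (solve 4 (λ a b x y → (a :* b) :* (x :* y) := (a :* x) :* (b :* y)) refl _ _ _ _)
    (*-congˡ (prod-* (h ∘ Fin.suc) (h′ ∘ Fin.suc)))

  factor : Bool → Carrier → Carrier
  factor b x = if b then x else 1#

  pow-count : ∀ {A : Set} x (p : A → Bool) {n} (e : Fin n → A) →
    pow R x (count p (tabulate e)) ≈ prod (λ j → factor (p (e j)) x)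
  pow-count x p {zero} e = refl
  pow-count x p {suc n} e with p (e Fin.zero)
  ... | true = *-congˡ (pow-count x p (e ∘ Fin.suc))
  ... | false = trans (pow-count x p (e ∘ Fin.suc)) (sym (*-identityˡ _))

  ι-all : ∀ {A : Set} (p : A → Bool) {n} (e : Fin n → A) →
    ι (all p (tabulate e)) 1# ≈ prod (λ j → ι (p (e j)) 1#)
  ι-all p {zero} e = refl
  ι-all p {suc n} e with p (e Fin.zero)
  ... | true = trans (ι-all p (e ∘ Fin.suc)) (sym (*-identityˡ _))
  ... | false = sym (zeroˡ _)

  module _ (b₁ b₂ b₃ b₄ b₅ b₆ b₇ b₈ b₉ b₁₀ b₁₁ b₁₂ b₁₃ : Bool) where

    factors : Carrier
    factors = factor b₁ x₁ * factor b₂ x₂ * factor b₃ y₁ * factor b₄ y₂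
      * factor b₅ u₁ * factor b₆ u₂ * factor b₇ v₁ * factor b₈ v₂
      * (factor b₉ wₑ * factor b₁₀ wₒ * factor b₁₁ zₑ * factor b₁₂ zₒ * factor b₁₃ λ′)

    selection : List (Bool × Carrier)
    selection = (b₁ , x₁) ∷ (b₂ , x₂) ∷ (b₃ , y₁) ∷ (b₄ , y₂) ∷ (b₅ , u₁) ∷ (b₆ , u₂) ∷ (b₇ , v₁) ∷ (b₈ , v₂)
      ∷ (b₉ , wₑ) ∷ (b₁₀ , wₒ) ∷ (b₁₁ , zₑ) ∷ (b₁₂ , zₒ) ∷ (b₁₃ , λ′) ∷ []

  selected : List (Bool × Carrier) → Carrier
  selected [] = 1#
  selected ((b , x) ∷ s) = if b then x * selected s else selected s

  allFactors : List (Bool × Carrier) → Carrier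
  allFactors [] = 1#
  allFactors ((b , x) ∷ s) = factor b x * allFactors s

  allFactors≈selected : ∀ s → allFactors s ≈ selected s
  allFactors≈selected [] = refl
  allFactors≈selected ((true , x) ∷ s) = *-congˡ (allFactors≈selected s)
  allFactors≈selected ((false , x) ∷ s) = trans (*-identityˡ _) (allFactors≈selected s)

  -- Once the conditions are known Booleans, `selected` computes to the few indeterminates that are
  -- present, while `factors` retains a unit for each absent one.
  factors≈selected : ∀ {b₁ b₂ b₃ b₄ b₅ b₆ b₇ b₈ b₉ b₁₀ b₁₁ b₁₂ b₁₃} →
    factors b₁ b₂ b₃ b₄ b₅ b₆ b₇ b₈ b₉ b₁₀ b₁₁ b₁₂ b₁₃ ≈ selected (selection b₁ b₂ b₃ b₄ b₅ b₆ b₇ b₈ b₉ b₁₀ b₁₁ b₁₂ b₁₃)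
  factors≈selected {b₁} {b₂} {b₃} {b₄} {b₅} {b₆} {b₇} {b₈} {b₉} {b₁₀} {b₁₁} {b₁₂} {b₁₃} =
    trans (trans (*-congˡ last5) first8)
      (allFactors≈selected (selection b₁ b₂ b₃ b₄ b₅ b₆ b₇ b₈ b₉ b₁₀ b₁₁ b₁₂ b₁₃))
    where
    last5 : ∀ {p q r s t} → p * q * r * s * t ≈ p * (q * (r * (s * (t * 1#))))
    last5 = trans (*-assoc _ _ _) (trans (*-assoc _ _ _) (trans (*-assoc _ _ _)
      (*-congˡ (*-congˡ (*-congˡ (*-congˡ (sym (*-identityʳ _))))))))
    first8 : ∀ {p q r s t u v w z} → p * q * r * s * t * u * v * w * z ≈ p * (q * (r * (s * (t * (u * (v * (w * z)))))))
    first8 = trans (*-assoc _ _ _) (trans (*-assoc _ _ _) (trans (*-assoc _ _ _) (trans (*-assoc _ _ _)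
      (trans (*-assoc _ _ _) (trans (*-assoc _ _ _) (*-assoc _ _ _))))))

  module _ {m : ℕ} (p₁ p₂ p₃ p₄ p₅ p₆ p₇ p₈ p₉ p₁₀ p₁₁ p₁₂ p₁₃ : Fin m → Bool) where

    private
      C : Carrier → (Fin m → Bool) → Carrier
      C x p = pow R x (count p (allFin m))
      Q : Carrier → (Fin m → Bool) → Fin m → Carrier
      Q x p j = factor (p j) x

    powers : C x₁ p₁ * C x₂ p₂ * C y₁ p₃ * C y₂ p₄ * C u₁ p₅ * C u₂ p₆ * C v₁ p₇ * C v₂ p₈
        * (C wₑ p₉ * C wₒ p₁₀ * C zₑ p₁₁ * C zₒ p₁₂ * C λ′ p₁₃)
      ≈ prod (λ j → factors (p₁ j) (p₂ j) (p₃ j) (p₄ j) (p₅ j) (p₆ j) (p₇ j) (p₈ j) (p₉ j) (p₁₀ j) (p₁₁ j) (p₁₂ j) (p₁₃ j))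
    powers = times (times (times (times (times (times (times (times
        (base x₁ p₁) (base x₂ p₂)) (base y₁ p₃)) (base y₂ p₄)) (base u₁ p₅)) (base u₂ p₆)) (base v₁ p₇)) (base v₂ p₈))
        (times (times (times (times (base wₑ p₉) (base wₒ p₁₀)) (base zₑ p₁₁)) (base zₒ p₁₂)) (base λ′ p₁₃))
      where
      base : ∀ x p → C x p ≈ prod (Q x p)
      base x p = pow-count x p id
      times : ∀ {y z} {h h′ : Fin m → Carrier} → y ≈ prod h → z ≈ prod h′ → y * z ≈ prod (λ j → h j * h′ j)
      times {h = h} {h′} e e′ = trans (*-cong e e′) (prod-* h h′)

  -- The factors at an index, in terms of the comparisons of i with σ⁻¹ i (gl, gr) and σ i (fl, fr), the
  -- record conditions e₁ … e₄ and n of the cycle types, those of the fixed points (nw, rr), and the parity.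
  summary : (gl gr fl fr fx e₁ e₂ e₃ e₄ n nw rr ev cy : Bool) → Carrier
  summary gl gr fl fr fx e₁ e₂ e₃ e₄ n nw rr ev cy = factors
    ((gl ∧ fl) ∧ e₁) ((gr ∧ fl) ∧ e₂) ((gr ∧ fr) ∧ e₃) ((gl ∧ fr) ∧ e₄)
    ((gl ∧ fl) ∧ n) ((gr ∧ fl) ∧ n) ((gr ∧ fr) ∧ n) ((gl ∧ fr) ∧ n)
    (fx ∧ nw ∧ not ev) (fx ∧ nw ∧ not (not ev)) (rr ∧ not ev) (rr ∧ not (not ev)) cy

  module _ {gl gr fl fr fx e₁ e₂ e₃ e₄ n nw rr ev cy : Bool} where

    private
      S : Carrier
      S = summary gl gr fl fr fx e₁ e₂ e₃ e₄ n nw rr ev cy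
      closing : ∀ b → (if b then λ′ * 1# else 1#) ≈ (if b then λ′ else 1#)
      closing true = *-identityʳ _
      closing false = refl
      flip : ∀ x → x * (λ′ * 1#) ≈ λ′ * x
      flip x = trans (*-congˡ (*-identityʳ _)) (*-comm _ _)

    summary-peak : gl ≡ true → gr ≡ false → fl ≡ true → fr ≡ false → fx ≡ false → rr ≡ false → cy ≡ false →
      ∀ b → e₁ ≡ b → n ≡ not b → S ≈ (if b then x₁ else u₁)
    summary-peak ≡.refl ≡.refl ≡.refl ≡.refl ≡.refl ≡.refl ≡.refl true ≡.refl ≡.refl = trans factors≈selected (*-identityʳ _)
    summary-peak ≡.refl ≡.refl ≡.refl ≡.refl ≡.refl ≡.refl ≡.refl false ≡.refl ≡.refl = trans factors≈selected (*-identityʳ _)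

    summary-fall : gl ≡ false → gr ≡ true → fl ≡ true → fr ≡ false → fx ≡ false → rr ≡ false → cy ≡ false →
      ∀ b → e₂ ≡ b → n ≡ not b → S ≈ (if b then x₂ else u₂)
    summary-fall ≡.refl ≡.refl ≡.refl ≡.refl ≡.refl ≡.refl ≡.refl true ≡.refl ≡.refl = trans factors≈selected (*-identityʳ _)
    summary-fall ≡.refl ≡.refl ≡.refl ≡.refl ≡.refl ≡.refl ≡.refl false ≡.refl ≡.refl = trans factors≈selected (*-identityʳ _)

    summary-rise : gl ≡ true → gr ≡ false → fl ≡ false → fr ≡ true → fx ≡ false → rr ≡ false → cy ≡ false →
      ∀ b → e₄ ≡ b → n ≡ not b → S ≈ (if b then y₂ else v₂)
    summary-rise ≡.refl ≡.refl ≡.refl ≡.refl ≡.refl ≡.refl ≡.refl true ≡.refl ≡.refl = trans factors≈selected (*-identityʳ _)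
    summary-rise ≡.refl ≡.refl ≡.refl ≡.refl ≡.refl ≡.refl ≡.refl false ≡.refl ≡.refl = trans factors≈selected (*-identityʳ _)

    -- This is where the specialisation enters: `v₁` unfolds to `y₁`, so both record statuses give
    -- the same weight.
    summary-valley : gl ≡ false → gr ≡ true → fl ≡ false → fr ≡ true → fx ≡ false → rr ≡ false →
      ∀ b → e₃ ≡ b → n ≡ not b → S ≈ y₁ * (if cy then λ′ else 1#)
    summary-valley ≡.refl ≡.refl ≡.refl ≡.refl ≡.refl ≡.refl true ≡.refl ≡.refl =
      trans factors≈selected (*-congˡ (closing cy))
    summary-valley ≡.refl ≡.refl ≡.refl ≡.refl ≡.refl ≡.refl false ≡.refl ≡.refl =
      trans factors≈selected (*-congˡ (closing cy))

    summary-fixed : gl ≡ false → gr ≡ false → fl ≡ false → fr ≡ false → fx ≡ true → cy ≡ true →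
      ∀ b → rr ≡ b → nw ≡ not b → ∀ b′ → ev ≡ b′ →
      S ≈ λ′ * (if b′ then (if b then zₒ else wₒ) else (if b then zₑ else wₑ))
    summary-fixed ≡.refl ≡.refl ≡.refl ≡.refl ≡.refl ≡.refl true ≡.refl ≡.refl true ≡.refl = trans factors≈selected (flip _)
    summary-fixed ≡.refl ≡.refl ≡.refl ≡.refl ≡.refl ≡.refl true ≡.refl ≡.refl false ≡.refl = trans factors≈selected (flip _)
    summary-fixed ≡.refl ≡.refl ≡.refl ≡.refl ≡.refl ≡.refl false ≡.refl ≡.refl true ≡.refl = trans factors≈selected (flip _)
    summary-fixed ≡.refl ≡.refl ≡.refl ≡.refl ≡.refl ≡.refl false ≡.refl ≡.refl false ≡.refl = trans factors≈selected (flip _)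

  -- An even index counted from 0 stands for an odd integer, where values below the index are
  -- forbidden: hence the zeros. A fixed point is a cycle of its own, which accounts for `λ′`; its
  -- two record statuses agree, so one flag decides between record-antirecord and neither.
  weights weights′ : LocalWeights
  weights = record
    { peak = λ i b → if evenᵇ i then 0# else (if b then x₁ else u₁)
    ; fall = λ i b → if evenᵇ i then 0# else (if b then x₂ else u₂)
    ; rise = λ i b → if evenᵇ i then (if b then y₂ else v₂) else 0#
    ; fixed = λ i b → λ′ * (if evenᵇ i then (if b then zₒ else wₒ) else (if b then zₑ else wₑ))
    ; valley = λ i → if evenᵇ i then y₁ else 0#
    ; cycle = λ′ }
  -- For the inverse permutation: cycle double rises and falls are exchanged.
  weights′ = record weights
    { fall = LocalWeights.rise weights
    ; rise = LocalWeights.fall weights }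

  -- `p` and `q` are the two branches of the D-condition at an index; its indicator is traded for
  -- the zero in the local weight.
  gate-low : ∀ ev {p q S X} → p ≡ false → q ≡ true → S ≈ X → (if ev then 0# else X) ≈ ι (if ev then p else q) 1# * S
  gate-low true ≡.refl ≡.refl e = sym (zeroˡ _)
  gate-low false ≡.refl ≡.refl e = trans (sym e) (sym (*-identityˡ _))

  gate-high : ∀ ev {p q S X} → p ≡ true → q ≡ false → S ≈ X → (if ev then X else 0#) ≈ ι (if ev then p else q) 1# * S
  gate-high true ≡.refl ≡.refl e = trans (sym e) (sym (*-identityˡ _))
  gate-high false ≡.refl ≡.refl e = sym (zeroˡ _)

  gate-both : ∀ ev {p q S X} → p ≡ true → q ≡ true → S ≈ X → X ≈ ι (if ev then p else q) 1# * S
  gate-both true ≡.refl ≡.refl e = trans (sym e) (sym (*-identityˡ _))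
  gate-both false ≡.refl ≡.refl e = trans (sym e) (sym (*-identityˡ _))

  if-* : ∀ b x y → (if b then x else 0#) * y ≈ (if b then x * y else 0#)
  if-* true x y = refl
  if-* false x y = zeroˡ y

  module _ {m : ℕ} (f : Fin m → Fin m) (x : Fin m) where

    private
      ev : Bool
      ev = evenᵇ (toℕ x)

    isD-at : Bool
    isD-at = if ev then toℕ x ≤ᵇ toℕ (f x) else toℕ (f x) ≤ᵇ toℕ x

    summary-at : (e₁ e₂ e₃ e₄ n : Bool) → Carrier
    summary-at e₁ e₂ e₃ e₄ n = summary
      (toℕ (inv f x) <ᵇ toℕ x) (toℕ x <ᵇ toℕ (inv f x)) (toℕ (f x) <ᵇ toℕ x) (toℕ x <ᵇ toℕ (f x)) (fixᵇ f x)
      e₁ e₂ e₃ e₄ n (nrᵇ f x) (rarᵇ f x) ev (cycleMinᵇ f x)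

    weight-at weight′-at : Carrier
    weight-at = ι isD-at 1# * summary-at (earecᵇ f x) (earecᵇ f x) (erecᵇ f x) (erecᵇ f x) (nrᵇ f x)
    weight′-at = ι isD-at 1# * summary-at
      (erecᵇ f (inv f x)) (earecᵇ f (inv f x)) (earecᵇ f (inv f x)) (erecᵇ f (inv f x)) (nrᵇ f (inv f x))

  ι-as-factor : ∀ b x → ι b x ≈ ι b 1# * x
  ι-as-factor true x = sym (*-identityˡ x)
  ι-as-factor false x = sym (zeroˡ x)

  isD≈prod : ∀ {m} (f : Fin m → Fin m) → ι (isDᵇ f) 1# ≈ prod (λ x → ι (isD-at f x) 1#)
  isD≈prod f = ι-all (isD-at f) id

  weight≈prod : ∀ {m} (f : Fin m → Fin m) → ι (isDᵇ f) (weight R (specV₁ a) f) ≈ prod (weight-at f)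
  weight≈prod f = trans (ι-as-factor (isDᵇ f) _) (trans (*-cong (isD≈prod f)
    (powers
      (λ j → cpeakᵇ f j ∧ earecᵇ f j) (λ j → cdfallᵇ f j ∧ earecᵇ f j)
      (λ j → cvalᵇ f j ∧ erecᵇ f j) (λ j → cdriseᵇ f j ∧ erecᵇ f j)
      (λ j → cpeakᵇ f j ∧ nrᵇ f j) (λ j → cdfallᵇ f j ∧ nrᵇ f j)
      (λ j → cvalᵇ f j ∧ nrᵇ f j) (λ j → cdriseᵇ f j ∧ nrᵇ f j)
      (λ j → fixᵇ f j ∧ nrᵇ f j ∧ evenPosᵇ f j) (λ j → fixᵇ f j ∧ nrᵇ f j ∧ not (evenPosᵇ f j))
      (λ j → rarᵇ f j ∧ evenPosᵇ f j) (λ j → rarᵇ f j ∧ not (evenPosᵇ f j)) (cycleMinᵇ f)))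
    (prod-* (λ x → ι (isD-at f x) 1#)
      (λ x → summary-at f x (earecᵇ f x) (earecᵇ f x) (erecᵇ f x) (erecᵇ f x) (nrᵇ f x))))

  weight′≈prod : ∀ {m} (f : Fin m → Fin m) → ι (isDᵇ f) (weight′ R (specV₁ a) f) ≈ prod (weight′-at f)
  weight′≈prod f = trans (ι-as-factor (isDᵇ f) _) (trans (*-cong (isD≈prod f)
    (powers
      (λ j → cpeakᵇ f j ∧ erecᵇ f (inv f j)) (λ j → cdfallᵇ f j ∧ earecᵇ f (inv f j))
      (λ j → cvalᵇ f j ∧ earecᵇ f (inv f j)) (λ j → cdriseᵇ f j ∧ erecᵇ f (inv f j))
      (λ j → cpeakᵇ f j ∧ nrᵇ f (inv f j)) (λ j → cdfallᵇ f j ∧ nrᵇ f (inv f j))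
      (λ j → cvalᵇ f j ∧ nrᵇ f (inv f j)) (λ j → cdriseᵇ f j ∧ nrᵇ f (inv f j))
      (λ j → fixᵇ f j ∧ nrᵇ f j ∧ evenPosᵇ f j) (λ j → fixᵇ f j ∧ nrᵇ f j ∧ not (evenPosᵇ f j))
      (λ j → rarᵇ f j ∧ evenPosᵇ f j) (λ j → rarᵇ f j ∧ not (evenPosᵇ f j)) (cycleMinᵇ f)))
    (prod-* (λ x → ι (isD-at f x) 1#)
      (λ x → summary-at f x (erecᵇ f (inv f x)) (earecᵇ f (inv f x)) (earecᵇ f (inv f x)) (erecᵇ f (inv f x)) (nrᵇ f (inv f x)))))

  ∧-not : ∀ b {r} → r ≡ false → b ∧ not r ≡ b
  ∧-not b ≡.refl = 𝔹ₚ.∧-identityʳ b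

  not-∧ : ∀ b {r} → r ≡ false → not r ∧ not b ≡ not b
  not-∧ b ≡.refl = ≡.refl

  ∧-zero : ∀ b {r} → r ≡ false → b ∧ r ≡ false
  ∧-zero b ≡.refl = 𝔹ₚ.∧-zeroʳ b

  zero-∧ : ∀ {r} b → r ≡ false → r ∧ b ≡ false
  zero-∧ b ≡.refl = ≡.refl

  module _ {m : ℕ} {f g : Fin m → Fin m} (v : Inverses f g) (x : Fin m) where

    private
      ev : Bool
      ev = evenᵇ (toℕ x)
      inv≡g : inv f x ≡ g x
      inv≡g = inverses-inv v x

    inv<-true : toℕ (g x) < toℕ x → (toℕ (inv f x) <ᵇ toℕ x) ≡ true
    inv<-true lt = true-<ᵇ (≡.subst (λ y → toℕ y < toℕ x) (≡.sym inv≡g) lt)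

    inv<-false : ¬ (toℕ (g x) < toℕ x) → (toℕ (inv f x) <ᵇ toℕ x) ≡ false
    inv<-false nlt = false-<ᵇ (λ lt → nlt (≡.subst (λ y → toℕ y < toℕ x) inv≡g lt))

    <inv-true : toℕ x < toℕ (g x) → (toℕ x <ᵇ toℕ (inv f x)) ≡ true
    <inv-true lt = true-<ᵇ (≡.subst (λ y → toℕ x < toℕ y) (≡.sym inv≡g) lt)

    <inv-false : ¬ (toℕ x < toℕ (g x)) → (toℕ x <ᵇ toℕ (inv f x)) ≡ false
    <inv-false nlt = false-<ᵇ (λ lt → nlt (≡.subst (λ y → toℕ x < toℕ y) inv≡g lt))

    false-≤ᵇ : ∀ {j k} → k < j → (j ≤ᵇ k) ≡ false
    false-≤ᵇ lt = ≢true⇒false (λ e → ℕₚ.<⇒≱ lt (≤ᵇ-true e))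

    module Low (lt : toℕ (f x) < toℕ x) where
      fl : (toℕ (f x) <ᵇ toℕ x) ≡ true
      fl = true-<ᵇ lt
      fr : (toℕ x <ᵇ toℕ (f x)) ≡ false
      fr = false-<ᵇ (ℕₚ.<-asym lt)
      fx : fixᵇ f x ≡ false
      fx = ≡ᵇ-false (ℕₚ.<⇒≢ lt)
      rr : rarᵇ f x ≡ false
      rr = zero-∧ (arecᵇ f x) (below-not-rec v x lt)
      gate : ∀ {S X} → S ≈ X → (if ev then 0# else X) ≈ ι (isD-at f x) 1# * S
      gate = gate-low ev (false-≤ᵇ lt) (true-≤ᵇ (ℕₚ.<⇒≤ lt))

    module High (lt : toℕ x < toℕ (f x)) where
      fl : (toℕ (f x) <ᵇ toℕ x) ≡ false
      fl = false-<ᵇ (ℕₚ.<-asym lt)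
      fr : (toℕ x <ᵇ toℕ (f x)) ≡ true
      fr = true-<ᵇ lt
      fx : fixᵇ f x ≡ false
      fx = ≡ᵇ-false (ℕₚ.<⇒≢ lt ∘ ≡.sym)
      rr : rarᵇ f x ≡ false
      rr = ∧-zero (recᵇ f x) (above-not-arec v x lt)
      gate : ∀ {S X} → S ≈ X → (if ev then X else 0#) ≈ ι (isD-at f x) 1# * S
      gate = gate-high ev (true-≤ᵇ (ℕₚ.<⇒≤ lt)) (false-≤ᵇ lt)

    module Fix (fx≡x : f x ≡ x) where
      gx≡x : g x ≡ x
      gx≡x = ≡.trans (≡.cong g (≡.sym fx≡x)) (Inverses.left v x)
      irrefl : ∀ {y z : Fin m} → y ≡ z → ¬ (toℕ y < toℕ z)
      irrefl e = ℕₚ.<-irrefl (≡.cong toℕ e)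
      gl : (toℕ (inv f x) <ᵇ toℕ x) ≡ false
      gl = inv<-false (irrefl gx≡x)
      gr : (toℕ x <ᵇ toℕ (inv f x)) ≡ false
      gr = <inv-false (irrefl (≡.sym gx≡x))
      fl : (toℕ (f x) <ᵇ toℕ x) ≡ false
      fl = false-<ᵇ (irrefl fx≡x)
      fr : (toℕ x <ᵇ toℕ (f x)) ≡ false
      fr = false-<ᵇ (irrefl (≡.sym fx≡x))
      fx : fixᵇ f x ≡ true
      fx = ≡.trans (≡.cong (λ y → toℕ y ≡ᵇ toℕ x) fx≡x) (≡ᵇ-refl (toℕ x))
      cy : cycleMinᵇ f x ≡ true
      cy = closed-walk {f = f} (done (≡.cong toℕ fx≡x))
      gate : ∀ {S X} → S ≈ X → X ≈ ι (isD-at f x) 1# * S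
      gate = gate-both ev (true-≤ᵇ (ℕₚ.≤-reflexive (≡.cong toℕ (≡.sym fx≡x)))) (true-≤ᵇ (ℕₚ.≤-reflexive (≡.cong toℕ fx≡x)))
      fixed≈ : ∀ b {e₁ e₂ e₃ e₄ n} → recᵇ f x ≡ b → arecᵇ f x ≡ b →
        λ′ * (if ev then (if b then zₒ else wₒ) else (if b then zₑ else wₑ))
        ≈ ι (isD-at f x) 1# * summary-at f x e₁ e₂ e₃ e₄ n
      fixed≈ b r r′ = gate (summary-fixed gl gr fl fr fx cy b
        (≡.trans (≡.cong₂ _∧_ r r′) (𝔹ₚ.∧-idem b))
        (≡.trans (≡.cong₂ (λ y z → not y ∧ not z) r r′) (𝔹ₚ.∧-idem (not b))) ev ≡.refl)

    view≈weight : ∀ {k} → View weights f g x k → k ≈ weight-at f x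
    view≈weight (peakView lt lt′ r cy) = gate (summary-peak (inv<-true lt′) (<inv-false (ℕₚ.<-asym lt′)) fl fr fx rr cy
      (arecᵇ f x) (∧-not (arecᵇ f x) r) (not-∧ (arecᵇ f x) r))
      where open Low lt
    view≈weight (fallView lt lt′ r cy) = gate (summary-fall (inv<-false (ℕₚ.<-asym lt′)) (<inv-true lt′) fl fr fx rr cy
      (arecᵇ f x) (∧-not (arecᵇ f x) r) (not-∧ (arecᵇ f x) r))
      where open Low lt
    view≈weight (riseView lt lt′ r cy) = gate (summary-rise (inv<-true lt′) (<inv-false (ℕₚ.<-asym lt′)) fl fr fx rr cy
      (recᵇ f x) (∧-not (recᵇ f x) r) (∧-not (not (recᵇ f x)) r))
      where open High lt
    view≈weight (valleyView lt lt′ r) = trans (if-* ev y₁ _)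
      (gate (summary-valley (inv<-false (ℕₚ.<-asym lt′)) (<inv-true lt′) fl fr fx rr
        (recᵇ f x) (∧-not (recᵇ f x) r) (∧-not (not (recᵇ f x)) r)))
      where open High lt
    view≈weight (fixedView e r _) = Fix.fixed≈ e (arecᵇ f x) r ≡.refl

    -- A record condition on `f` at the preimage of `x` is a record condition on `g` at `x` itself.
    -- The primed statistics are therefore local along the values of `g`, while the D-condition
    -- still refers to `f`.
    view≈weight′ : ∀ {k} → View weights′ g f x k → k ≈ weight′-at f x
    view≈weight′ = by
      where
      rec-inv : recᵇ f (inv f x) ≡ arecᵇ g x
      rec-inv = ≡.trans (≡.cong (recᵇ f) inv≡g) (rec-inverse v x)
      arec-inv : arecᵇ f (inv f x) ≡ recᵇ g x
      arec-inv = ≡.trans (≡.cong (arecᵇ f) inv≡g) (arec-inverse v x)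
      erec-inv : erecᵇ f (inv f x) ≡ arecᵇ g x ∧ not (recᵇ g x)
      erec-inv = ≡.cong₂ (λ p q → p ∧ not q) rec-inv arec-inv
      earec-inv : earecᵇ f (inv f x) ≡ recᵇ g x ∧ not (arecᵇ g x)
      earec-inv = ≡.cong₂ (λ p q → p ∧ not q) arec-inv rec-inv
      nr-inv : nrᵇ f (inv f x) ≡ not (arecᵇ g x) ∧ not (recᵇ g x)
      nr-inv = ≡.cong₂ (λ p q → not p ∧ not q) rec-inv arec-inv
      min : ∀ {b} → cycleMinᵇ g x ≡ b → cycleMinᵇ f x ≡ b
      min = ≡.trans (cycleMin-inverse v x)
      by : ∀ {k} → View weights′ g f x k → k ≈ weight′-at f x
      by (peakView lt lt′ r cy) = gate (summary-peak (inv<-true lt) (<inv-false (ℕₚ.<-asym lt)) fl fr fx rr (min cy)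
        (arecᵇ g x) (≡.trans erec-inv (∧-not (arecᵇ g x) r)) (≡.trans nr-inv (∧-not (not (arecᵇ g x)) r)))
        where open Low lt′
      -- A double fall of `g` is a double rise of `f`, so it is weighted by `y₂` or `v₂`.
      by (fallView lt lt′ r cy) = gate (summary-rise (inv<-true lt) (<inv-false (ℕₚ.<-asym lt)) fl fr fx rr (min cy)
        (arecᵇ g x) (≡.trans erec-inv (∧-not (arecᵇ g x) r)) (≡.trans nr-inv (∧-not (not (arecᵇ g x)) r)))
        where open High lt′
      by (riseView lt lt′ r cy) = gate (summary-fall (inv<-false (ℕₚ.<-asym lt)) (<inv-true lt) fl fr fx rr (min cy)
        (recᵇ g x) (≡.trans earec-inv (∧-not (recᵇ g x) r)) (≡.trans nr-inv (not-∧ (recᵇ g x) r)))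
        where open Low lt′
      by (valleyView lt lt′ r) = trans (if-* ev y₁ _)
        (trans (reflexive (≡.cong (λ b → if ev then y₁ * (if b then λ′ else 1#) else 0#) (≡.sym (cycleMin-inverse v x))))
          (gate (summary-valley (inv<-false (ℕₚ.<-asym lt)) (<inv-true lt) fl fr fx rr
            (recᵇ g x) (≡.trans earec-inv (∧-not (recᵇ g x) r)) (≡.trans nr-inv (not-∧ (recᵇ g x) r)))))
        where open High lt′
      by (fixedView e r _) = Fix.fixed≈ fx≡x (arecᵇ g x)
        (≡.trans (≡.cong (recᵇ f) (≡.sym e)) (rec-inverse v x))
        (≡.trans (≡.cong (arecᵇ f) (≡.sym e)) (≡.trans (arec-inverse v x) r))
        where
        fx≡x : f x ≡ x
        fx≡x = ≡.trans (≡.cong f (≡.sym e)) (Inverses.right v x)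

  ∑-Dperms : ∀ n (h : (Fin (n ℕ.+ n) → Fin (n ℕ.+ n)) → Carrier) →
    ∑ᴸ (Dperms n) h ≈ ∑ᴸ (funs (n ℕ.+ n) (n ℕ.+ n)) (λ f → ι (isPermᵇ f) (ι (isDᵇ f) (h f)))
  ∑-Dperms n h = trans (∑ᴸ-filter (λ σ → isPermᵇ σ ∧ isDᵇ σ) (funs (n ℕ.+ n) (n ℕ.+ n)) h)
    (∑ᴸ-cong (funs (n ℕ.+ n) (n ℕ.+ n)) (λ f → ι-∧ (isPermᵇ f) (isDᵇ f) (h f)))

  P̂≈paths : ∀ n → P̂ R (specV₁ a) n ≈ paths (steps weights) (n ℕ.+ n) 0 0
  P̂≈paths n = trans (∑-Dperms n (weight R (specV₁ a)))
    (trans (∑ᴸ-cong (funs (n ℕ.+ n) (n ℕ.+ n)) (λ f → ι-cong (isPermᵇ f) (λ e → trans (weight≈prod f)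
        (sym (total≈prod weights (perm-inverses {f = f} e) (weight-at f) (view≈weight (perm-inverses {f = f} e)))))))
      (∑-perms weights (n ℕ.+ n)))

  P̂′≈paths : ∀ n → P̂′ R (specV₁ a) n ≈ paths (steps weights′) (n ℕ.+ n) 0 0
  P̂′≈paths n = trans (∑-Dperms n (weight′ R (specV₁ a)))
    -- The list of values is now that of the inverse `g`, summed over all permutations; the
    -- D-condition on `f` has gone into `weights′`.
    (trans (∑-inverse (n ℕ.+ n) _ (λ g → total weights′ (n ℕ.+ n) 0 (values g)) (λ {f} v → trans (weight′≈prod f)
        (sym (total≈prod weights′ (swap-inverses v) (weight′-at f) (view≈weight′ v)))))
      (∑-perms weights′ (n ℕ.+ n)))

  paths′≈paths : ∀ r i k → paths (steps weights′) r i k ≈ paths (steps weights) r i k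
  paths′≈paths = paths-cong (λ _ _ → refl) (λ _ _ → +-congˡ (+-comm _ _)) (λ _ _ → refl)

  -- At height 0 the only level step is a fixed point, and it is a record-antirecord: the product of
  -- the two level weights there is `δ` at 1. At positive heights the product is an `α` of even
  -- index.
  level₀ level₁ down : ℕ → Carrier
  level₀ zero = λ′ * zₒ
  level₀ (suc k) = y₂ + nat R k * v₂ + λ′ * wₒ
  level₁ zero = λ′ * zₑ
  level₁ (suc k) = x₂ + nat R k * u₂ + λ′ * wₑ
  down zero = 0#
  down (suc k) = x₁ + nat R k * u₁

  pick-zero : ∀ {w : Bool → Carrier} → (∀ b → w b ≈ 0#) → ∀ k → pick w k ≈ 0#
  pick-zero h zero = refl
  pick-zero h (suc k) = trans (+-cong (h true) (trans (*-congˡ (h false)) (zeroʳ _))) (+-identityˡ _)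

  level-even : ∀ i k → evenᵇ i ≡ true → Steps.level (steps weights) i k ≈ level₀ k
  level-even i zero e rewrite e = trans (+-congˡ (+-identityˡ _)) (+-identityʳ _)
  level-even i (suc k) e rewrite e = trans
    (+-congˡ (trans (+-congʳ (pick-zero (λ _ → refl) (suc k))) (+-identityˡ _))) (+-comm _ _)

  level-odd : ∀ i k → evenᵇ i ≡ false → Steps.level (steps weights) i k ≈ level₁ k
  level-odd i zero e rewrite e = trans (+-congˡ (+-identityˡ _)) (+-identityʳ _)
  level-odd i (suc k) e rewrite e = trans
    (+-congˡ (trans (+-congˡ (pick-zero (λ _ → refl) (suc k))) (+-identityʳ _))) (+-comm _ _)

  down-even : ∀ i k → evenᵇ i ≡ true → Steps.down (steps weights) i k ≈ 0#
  down-even i k e = pick-zero (λ b → reflexive (if-true e)) k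

  down-odd : ∀ i k → evenᵇ i ≡ false → Steps.down (steps weights) i k ≈ down k
  down-odd i zero e = refl
  down-odd i (suc k) e rewrite e = refl

  even-double : ∀ k → evenᵇ (double k) ≡ true
  even-double zero = ≡.refl
  even-double (suc k) = ≡.trans (𝔹ₚ.not-involutive _) (even-double k)

  half-double : ∀ k → ⌊ double k /2⌋ ≡ k
  half-double zero = ≡.refl
  half-double (suc k) = ≡.cong suc (half-double k)

  half-1+double : ∀ k → ⌊ suc (double k) /2⌋ ≡ k
  half-1+double zero = ≡.refl
  half-1+double (suc k) = ≡.cong suc (half-1+double k)

  α-odd : ∀ k → α R (specV₁ a) (suc (double k)) ≈ y₁ * (λ′ + nat R k) * down (suc k)
  α-odd k rewrite even-double k | half-double k =
    solve 3 (λ p q y → p :* q :* y := y :* p :* q) refl _ _ _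

  α-even : ∀ k → α R (specV₁ a) (double (suc k)) ≈ level₀ (suc k) * level₁ (suc k)
  α-even k rewrite even-double k | half-1+double k = *-comm _ _

  paths≈cf : ∀ n → paths (steps weights) (n ℕ.+ n) 0 0 ≈ cfCoeff R (α R (specV₁ a)) (δ R (specV₁ a)) n
  paths≈cf = paths≈cfCoeff (steps weights) (α R (specV₁ a)) (δ R (specV₁ a))
    (λ k → y₁ * (λ′ + nat R k)) level₀ level₁ down
    (λ i k e → *-congʳ (reflexive (if-true e))) level-even down-even
    (λ i k e → trans (*-congʳ (reflexive (if-false e))) (zeroˡ _)) level-odd down-odd
    refl α-odd α-even
    (solve 3 (λ l p q → l :* l :* p :* q := l :* q :* (l :* p)) refl λ′ zₑ zₒ)
    (λ _ → refl)

theorem4p5 : ∀ {c ℓ} (R : CommutativeSemiring c ℓ) (a : Vars R) →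
    let open CommutativeSemiring R in
    ((n : ℕ) → P̂′ R (specV₁ a) n ≈ cfCoeff R (α R (specV₁ a)) (δ R (specV₁ a)) n)
    × ((n : ℕ) → P̂′ R (specV₁ a) n ≈ P̂ R (specV₁ a) n)
theorem4p5 R a =
  (λ n → trans (P̂′≈paths n) (trans (paths′≈paths (n ℕ.+ n) 0 0) (paths≈cf n))) ,
  (λ n → trans (P̂′≈paths n) (trans (paths′≈paths (n ℕ.+ n) 0 0) (sym (P̂≈paths n))))
  where
  open CommutativeSemiring R using (trans; sym)
  open DPermutations R a
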